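{- For all integers $n\ge 1$ and $k$ with $0\le 2k\le n$, the polynomial $F_{2^k1^{n-2k}}(z)$ is log-concave. In other words, for every involution $\pi\in\mathfrak{S}_n$ (i.e. $\pi^2=\mathrm{id}$, fixed points allowed), the polynomial $F_\pi(z)$ is log-concave.
   Context: For a positive integer $m$, $\mathfrak{S}_m$ is the symmetric group on $\{1,\dots,m\}$, $Q_m\subseteq\mathfrak{S}_m$ is the set of $m$-cycles, and $c(\eta)$ denotes the number of cycles (including fixed points) of a permutation $\eta$. Permutations are multiplied from left to right. For $\pi\in\mathfrak{S}_m$ the IO-polynomial is \[ F_\pi(z)=\sum_{\zeta\in Q_m} z^{\lfloor (c(\zeta\pi)-1)/2\rfloor}. \] A permutation has type $\lambda$ (a partition of $m$) if the multiset of its cycle lengths is $\lambda$; $F_\pi$ depends only on the type of $\pi$, and $F_\lambda:=F_\pi$ for $\pi$ of type $\lambda$. The partition $2^k1^{n-2k}$ has $k$ parts equal to $2$ and $n-2k$ parts equal to $1$. A polynomial $\sum_k a_kz^k$ with nonnegative coefficients is log-concave if $a_k^2\ge a_{k-1}a_{k+1}$ for all $k$. -}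

module Defs where

open import Data.Nat using (ℕ; zero; suc; _≤_; _/_; _∸_; _≟_)
open import Data.Fin using (Fin; toℕ) renaming (zero to fzero)
open import Data.Fin.Properties as FinP using ()
open import Data.List using (List; []; _∷_; map; concatMap; length; filter; upTo; allFin)
open import Data.List.Relation.Unary.All using (All)
open import Data.List.Relation.Unary.All.Properties using ()
open import Data.List.Relation.Unary.AllPairs using (AllPairs)
open import Data.Vec using (Vec; []; _∷_; lookup)
open import Relation.Binary.PropositionalEquality using (_≡_; _≢_)
open import Relation.Nullary using (Dec; ¬_)
open import Relation.Nullary.Decidable using (_×-dec_)
open import Data.Product using (_×_)
open import Relation.Nullary.Decidable using (¬?)
import Data.List.Relation.Unary.All as All
import Data.List.Relation.Unary.AllPairs as AllPairs

Map : ℕ → Set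
Map n = Fin n → Fin n

iter : ∀ {n} → Map n → ℕ → Fin n → Fin n
iter η zero    x = x
iter η (suc j) x = η (iter η j x)

_·_ : ∀ {n} → Map n → Map n → Map n
(ζ · π) x = π (ζ x)

allVecs : (n m : ℕ) → List (Vec (Fin n) m)
allVecs n zero    = [] ∷ []
allVecs n (suc m) = concatMap (λ x → map (x ∷_) (allVecs n m)) (allFin n)

allMaps : (n : ℕ) → List (Map n)
allMaps n = map lookup (allVecs n n)

-- ζ : Fin (suc m) → Fin (suc m) is an (m+1)-cycle iff the orbit
-- 0, ζ 0, ζ² 0, …, ζ^m 0 consists of m+1 pairwise distinct points
-- and ζ^{m+1} 0 = 0
-- (this forces ζ to be a bijection consisting of one single cycle).
IsFullCycle : ∀ {m} → Map (suc m) → Set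
IsFullCycle {m} ζ = AllPairs _≢_ (map (λ i → iter ζ i fzero) (upTo (suc m)))
                  × iter ζ (suc m) fzero ≡ fzero

isFullCycle? : ∀ {m} (ζ : Map (suc m)) → Dec (IsFullCycle ζ)
isFullCycle? {m} ζ = AllPairs.allPairs? (λ x y → ¬? (x FinP.≟ y)) _
                     ×-dec (iter ζ (suc m) fzero FinP.≟ fzero)

IsCycleMin : ∀ {n} → Map n → Fin n → Set
IsCycleMin {n} η x = All (λ j → toℕ x ≤ toℕ (iter η j x)) (upTo n)

isCycleMin? : ∀ {n} (η : Map n) (x : Fin n) → Dec (IsCycleMin η x)
isCycleMin? {n} η x = All.all? (λ j → toℕ x Data.Nat.≤? toℕ (iter η j x)) (upTo n)

-- number of cycles (fixed points included) of a permutation η: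
-- the number of points that are the minimum of their cycle
cycles : ∀ {n} → Map n → ℕ
cycles {n} η = length (filter (isCycleMin? η) (allFin n))

expo : ∀ {n} → Map n → Map n → ℕ
expo ζ π = (cycles (ζ · π) ∸ 1) / 2

fullCycles : (m : ℕ) → List (Map (suc m))
fullCycles m = filter isFullCycle? (allMaps (suc m))

-- coefficient of z^j in F_π(z) = Σ_{ζ ∈ Q_n} z^{⌊(c(ζπ)-1)/2⌋}
F-coeff : ∀ {m} → Map (suc m) → ℕ → ℕ
F-coeff {m} π j = length (filter (λ ζ → expo ζ π ≟ j) (fullCycles m))

-- log-concavity of a coefficient sequence a : ℕ → ℕ (a_{-1} = 0, so only
-- k ≥ 1 is nontrivial): a_k² ≥ a_{k-1} a_{k+1}
LogConcave : (ℕ → ℕ) → Set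
LogConcave a = ∀ k → a k Data.Nat.* a (suc (suc k)) ≤ a (suc k) Data.Nat.* a (suc k)

{-# OPTIONS --safe #-}
module Submission where

-- For q colours, q^c(ζπ) counts the colourings f with f(π(ζ x)) = f(x).  For
-- fixed f these ζ are the Eulerian tours of the digraph whose edges are
-- f(π x) → f(x).  Let P_π(q) = Σ_ζ q^c(ζπ), let π fix a ≠ b, let π′ = (a b) π,
-- and let B(q) count the pairs (ζ , f) for π with f(a) = f(b).
--   * Exactly one of ζπ, ζπ′ has a and b on one cycle, so
--     P_π′(q) + P_π(q) = (q + 1) B(q).
--   * Passing from π to π′ replaces two loops at u = f(a) and v = f(b) by two
--     opposite edges between u and v.  As for spanning trees in the BEST theorem,
--     this changes the number of tours by a multiple of the number of tours with
--     u and v identified, and summing over f gives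
--     P_π′(q + 1) = P_π(q + 1) + (q + 1) B(q).
-- Hence P_π′(q + 1) - P_π′(q) = P_π(q + 1) + P_π(q).  For an involution with k
-- transpositions it follows that (k + 1)! P_π is a multiple of h_k, where
-- h_(k+2) = 2 q h_(k+1) + (k + 2) (k + 1) h_k; this is the Harer–Zagier
-- recurrence.  The coefficients of consecutive h_k interlace, which propagates
-- log-concavity along the recurrence.

open import Defs
open import Algebra.Definitions using (Involutive)
open import Algebra.Properties.CommutativeSemigroup using (interchange; x∙yz≈y∙xz)
open import Data.Bool using (Bool; true; false; if_then_else_)
open import Data.Empty using (⊥-elim)
open import Data.Fin using (Fin; zero; suc; toℕ; punchIn)
open import Data.Fin.Permutation using (Permutation′; _⟨$⟩ʳ_; _⟨$⟩ˡ_; inverseˡ; inverseʳ; _∘ₚ_)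
import Data.Fin.Permutation as Permutation
open import Data.Fin.Permutation.Components using (transpose)
open import Data.Fin.Properties
  using (_≟_; all?; toℕ-injective; pigeonhole; toℕ≤pred[n]; punchIn-injective; punchInᵢ≢i)
import Data.Fin.Properties as Finₚ
open import Data.List
  using (List; []; _∷_; _++_; map; concatMap; filter; length; null; replicate; allFin; upTo;
         applyUpTo; iterate; cartesianProductWith)
import Data.List as List
open import Data.List.Membership.Propositional using (_∈_; _∉_; find; lose)
open import Data.List.Membership.Propositional.Properties
  using (∈-∃++; ∈-map⁺; ∈-map⁻; ∈-concatMap⁺; ∈-concatMap⁻; ∈-filter⁺; ∈-filter⁻; ∈-allFin;
         ∈-upTo⁺; ∈-lookup; ∈-length; ∈-cartesianProductWith⁺)
open import Data.List.Membership.Propositional.Properties.WithK using (unique∧set⇒bag)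
open import Data.List.Properties
  using (map-++; map-cong; map-∘; map-tabulate; map-upTo; map-applyUpTo; tabulate-cong;
         ++-identityʳ; ∷-injectiveˡ; ∷-injectiveʳ; filter-all; filter-complete; length-++;
         length-map; length-filter; length-replicate; length-tabulate; length-iterate)
open import Data.List.Relation.Binary.BagAndSetEquality using (∼bag⇒↭)
open import Data.List.Relation.Binary.Disjoint.Propositional using (Disjoint)
open import Data.List.Relation.Binary.Permutation.Propositional
  using (_↭_; prep; swap; ↭-refl; ↭-sym; ↭-trans; ↭⇒↭ₛ)
import Data.List.Relation.Binary.Permutation.Propositional as ↭
import Data.List.Relation.Binary.Permutation.Propositional.Properties as Perm
import Data.List.Relation.Binary.Permutation.Setoid.Properties as Permₛ
open import Data.List.Relation.Binary.Subset.Propositional using (_⊆_)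
open import Data.List.Relation.Unary.All using (All; []; _∷_)
import Data.List.Relation.Unary.All as All
import Data.List.Relation.Unary.All.Properties as Allₚ
open import Data.List.Relation.Unary.AllPairs using (AllPairs; []; _∷_)
import Data.List.Relation.Unary.AllPairs as AllPairs
import Data.List.Relation.Unary.AllPairs.Properties as AllPairsₚ
open import Data.List.Relation.Unary.Any using (here; there; index)
open import Data.List.Relation.Unary.Any.Properties using (lookup-index)
open import Data.List.Relation.Unary.Unique.Propositional using (Unique)
import Data.List.Relation.Unary.Unique.Propositional.Properties as Uniq
open import Data.Nat
  using (ℕ; zero; suc; _+_; _*_; _^_; _∸_; _/_; _%_; _!; _≤_; _<_; z≤n; s≤s; NonZero; ≢-nonZero)
import Data.Nat as ℕ
open import Data.Nat.Divisibility using (n∣m*n)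
open import Data.Nat.DivMod using (m≡m%n+[m/n]*n; m%n<n; [m+kn]%n≡m%n; m<n⇒m%n≡m; m*n/n≡m; +-distrib-/-∣ʳ)
open import Data.Nat.Induction using (<-wellFounded)
open import Data.Nat.ListAction using (sum)
open import Data.Nat.ListAction.Properties using (sum-++; sum-↭)
open import Data.Nat.Properties hiding (_≟_)
open import Data.Nat.Tactic.RingSolver using (solve-∀)
open import Data.Product using (∃; ∃₂; _×_; _,_; proj₁; proj₂; uncurry)
import Data.Product as Product
open import Data.Product.Function.NonDependent.Propositional using (_×-⇔_)
open import Data.Sum using (_⊎_; inj₁; inj₂)
open import Data.Vec using (Vec; []; _∷_; lookup; _[_]≔_)
import Data.Vec as Vec
open import Data.Vec.Properties using (lookup-map; lookup∘tabulate; lookup∘update; lookup∘update′)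
import Data.Vec.Properties as Vecₚ
open import Data.Vec.Relation.Binary.Pointwise.Extensional using (ext; Pointwise-≡⇒≡)
open import Function using (_∘_; _on_; id; _⇔_; mk⇔; Injection)
open import Function.Construct.Identity using (⇔-id)
open import Function.Definitions using (Injective)
open import Function.Properties.Inverse using (↔⇒↣)
open import Induction.WellFounded using (Acc; acc)
open import Level using (Level)
open import Relation.Binary using (Rel) renaming (Decidable to Decidable₂)
open import Relation.Binary.Definitions using (DecidableEquality)
open import Relation.Binary.PropositionalEquality
open import Relation.Nullary using (Dec; does; yes; no; ¬_)
open import Relation.Nullary.Decidable using (_×-dec_; _⊎-dec_; does-⇔; dec-true; dec-false)
open import Relation.Unary using (Pred; Decidable)
open ≡-Reasoning

private variable
  α β ℓ ℓ₁ ℓ₂ : Level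
  A : Set α
  B : Set β
  P : Set ℓ₁
  Q : Set ℓ₂
  k m n q : ℕ

-- Finite sums

∑ : List A → (A → ℕ) → ℕ
∑ xs φ = sum (map φ xs)

∑₂ : List (A × B) → (A → B → ℕ) → ℕ
∑₂ xs φ = ∑ xs (uncurry φ)

syntax ∑ xs (λ x → e) = ∑[ x ∈ xs ] e
syntax ∑₂ xs (λ x y → e) = ∑[ x , y ∈ xs ] e
infix 5 ∑ ∑₂

𝟙 : Dec P → ℕ
𝟙 d = if does d then 1 else 0

𝟙-yes : (d : Dec P) → P → 𝟙 d ≡ 1
𝟙-yes d p = cong (if_then 1 else 0) (dec-true d p)

𝟙-no : (d : Dec P) → ¬ P → 𝟙 d ≡ 0
𝟙-no d ¬p = cong (if_then 1 else 0) (dec-false d ¬p)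

𝟙-refl : (_≟_ : DecidableEquality A) (x : A) → 𝟙 (x ≟ x) ≡ 1
𝟙-refl _≟_ x = 𝟙-yes (x ≟ x) refl

𝟙-⇔ : P ⇔ Q → (d : Dec P) (e : Dec Q) → 𝟙 d ≡ 𝟙 e
𝟙-⇔ P⇔Q d e = cong (if_then 1 else 0) (does-⇔ P⇔Q d e)

𝟙-×-dec : (d : Dec P) (e : Dec Q) → 𝟙 (d ×-dec e) ≡ 𝟙 d * 𝟙 e
𝟙-×-dec (yes _) (yes _) = refl
𝟙-×-dec (yes _) (no _)  = refl
𝟙-×-dec (no _)  _       = refl

𝟙-guard : (d : Dec P) {a b : ℕ} → (P → a ≡ b) → 𝟙 d * a ≡ 𝟙 d * b
𝟙-guard (yes p) a≡b = cong (1 *_) (a≡b p)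
𝟙-guard (no _)  _   = refl

∑-cong : (xs : List A) {φ ψ : A → ℕ} → (∀ x → φ x ≡ ψ x) → ∑ xs φ ≡ ∑ xs ψ
∑-cong xs φ≗ψ = cong sum (map-cong φ≗ψ xs)

∑-cong-∈ : (xs : List A) {φ ψ : A → ℕ} → (∀ {x} → x ∈ xs → φ x ≡ ψ x) → ∑ xs φ ≡ ∑ xs ψ
∑-cong-∈ []       _   = refl
∑-cong-∈ (x ∷ xs) φ≡ψ = cong₂ _+_ (φ≡ψ (here refl)) (∑-cong-∈ xs (φ≡ψ ∘ there))

∑-++ : (xs ys : List A) (φ : A → ℕ) → ∑ (xs ++ ys) φ ≡ ∑ xs φ + ∑ ys φ
∑-++ xs ys φ = trans (cong sum (map-++ φ xs ys)) (sum-++ (map φ xs) (map φ ys))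

∑-map : (f : A → B) (xs : List A) (φ : B → ℕ) → ∑ (map f xs) φ ≡ ∑ xs (φ ∘ f)
∑-map f xs φ = cong sum (sym (map-∘ xs))

∑-↭ : {xs ys : List A} (φ : A → ℕ) → xs ↭ ys → ∑ xs φ ≡ ∑ ys φ
∑-↭ φ xs↭ys = sum-↭ (Perm.map⁺ φ xs↭ys)

∑-concatMap : (f : A → List B) (xs : List A) (φ : B → ℕ) →
  ∑ (concatMap f xs) φ ≡ ∑[ x ∈ xs ] ∑ (f x) φ
∑-concatMap f []       φ = refl
∑-concatMap f (x ∷ xs) φ =
  trans (∑-++ (f x) (concatMap f xs) φ) (cong (∑ (f x) φ +_) (∑-concatMap f xs φ))

∑-+ : (xs : List A) (φ ψ : A → ℕ) → ∑[ x ∈ xs ] (φ x + ψ x) ≡ ∑ xs φ + ∑ xs ψ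
∑-+ []       φ ψ = refl
∑-+ (x ∷ xs) φ ψ = trans (cong (φ x + ψ x +_) (∑-+ xs φ ψ))
  (interchange +-commutativeSemigroup (φ x) (ψ x) (∑ xs φ) (∑ xs ψ))

∑-*ˡ : (xs : List A) (k : ℕ) (φ : A → ℕ) → ∑[ x ∈ xs ] (k * φ x) ≡ k * ∑ xs φ
∑-*ˡ []       k φ = sym (*-zeroʳ k)
∑-*ˡ (x ∷ xs) k φ =
  trans (cong (k * φ x +_) (∑-*ˡ xs k φ)) (sym (*-distribˡ-+ k (φ x) (∑ xs φ)))

∑-*ʳ : (xs : List A) (k : ℕ) (φ : A → ℕ) → ∑[ x ∈ xs ] (φ x * k) ≡ ∑ xs φ * k
∑-*ʳ xs k φ = trans (∑-cong xs (λ x → *-comm (φ x) k)) (trans (∑-*ˡ xs k φ) (*-comm k (∑ xs φ)))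

∑-* : (xs : List A) (ys : List B) (φ : A → ℕ) (ψ : B → ℕ) →
  ∑[ x ∈ xs ] ∑[ y ∈ ys ] (φ x * ψ y) ≡ ∑ xs φ * ∑ ys ψ
∑-* xs ys φ ψ = trans (∑-cong xs (λ x → ∑-*ˡ ys (φ x) ψ)) (∑-*ʳ xs (∑ ys ψ) φ)

∑-linear : (xs : List A) (k l : ℕ) (δ φ ψ : A → ℕ) →
  ∑[ x ∈ xs ] (δ x * (k * φ x + l * ψ x)) ≡ k * (∑[ x ∈ xs ] (δ x * φ x)) + l * (∑[ x ∈ xs ] (δ x * ψ x))
∑-linear xs k l δ φ ψ = begin
  ∑[ x ∈ xs ] (δ x * (k * φ x + l * ψ x))
    ≡⟨ ∑-cong xs (λ x → distribute (δ x) k (φ x) l (ψ x)) ⟩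
  ∑[ x ∈ xs ] (k * (δ x * φ x) + l * (δ x * ψ x))
    ≡⟨ ∑-+ xs _ _ ⟩
  (∑[ x ∈ xs ] (k * (δ x * φ x))) + (∑[ x ∈ xs ] (l * (δ x * ψ x)))
    ≡⟨ cong₂ _+_ (∑-*ˡ xs k _) (∑-*ˡ xs l _) ⟩
  k * (∑[ x ∈ xs ] (δ x * φ x)) + l * (∑[ x ∈ xs ] (δ x * ψ x)) ∎
  where
  distribute : ∀ d k x l y → d * (k * x + l * y) ≡ k * (d * x) + l * (d * y)
  distribute = solve-∀

∑-const : (xs : List A) (k : ℕ) → ∑[ _ ∈ xs ] k ≡ length xs * k
∑-const []       k = refl
∑-const (x ∷ xs) k = cong (k +_) (∑-const xs k)

∑-replicate : (n : ℕ) (x : A) (φ : A → ℕ) → ∑ (replicate n x) φ ≡ n * φ x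
∑-replicate zero    x φ = refl
∑-replicate (suc n) x φ = cong (φ x +_) (∑-replicate n x φ)

∑-zero : (xs : List A) {φ : A → ℕ} → (∀ {x} → x ∈ xs → φ x ≡ 0) → ∑ xs φ ≡ 0
∑-zero xs φ≡0 = trans (∑-cong-∈ xs φ≡0) (trans (∑-const xs 0) (*-zeroʳ (length xs)))

∑-swap : (xs : List A) (ys : List B) (φ : A → B → ℕ) →
  ∑[ x ∈ xs ] ∑[ y ∈ ys ] φ x y ≡ ∑[ y ∈ ys ] ∑[ x ∈ xs ] φ x y
∑-swap []       ys φ = sym (∑-zero ys (λ _ → refl))
∑-swap (x ∷ xs) ys φ = begin
  ∑ ys (φ x) + (∑[ x′ ∈ xs ] ∑[ y ∈ ys ] φ x′ y)   ≡⟨ cong (∑ ys (φ x) +_) (∑-swap xs ys φ) ⟩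
  ∑ ys (φ x) + (∑[ y ∈ ys ] ∑[ x′ ∈ xs ] φ x′ y)   ≡⟨ ∑-+ ys (φ x) _ ⟨
  ∑[ y ∈ ys ] (φ x y + (∑[ x′ ∈ xs ] φ x′ y))      ∎

∑-filter : {P : Pred A ℓ} (P? : Decidable P) (xs : List A) (φ : A → ℕ) →
  ∑ (filter P? xs) φ ≡ ∑[ x ∈ xs ] (𝟙 (P? x) * φ x)
∑-filter P? []       φ = refl
∑-filter P? (x ∷ xs) φ with does (P? x)
... | true  = cong₂ _+_ (sym (*-identityˡ (φ x))) (∑-filter P? xs φ)
... | false = ∑-filter P? xs φ

∑-𝟙 : {P : Pred A ℓ} (P? : Decidable P) (xs : List A) → ∑[ x ∈ xs ] 𝟙 (P? x) ≡ length (filter P? xs)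
∑-𝟙 P? xs = sym (begin
  length (filter P? xs)          ≡⟨ *-identityʳ _ ⟨
  length (filter P? xs) * 1      ≡⟨ ∑-const (filter P? xs) 1 ⟨
  ∑[ _ ∈ filter P? xs ] 1        ≡⟨ ∑-filter P? xs (λ _ → 1) ⟩
  ∑[ x ∈ xs ] (𝟙 (P? x) * 1)     ≡⟨ ∑-cong xs (λ x → *-identityʳ _) ⟩
  ∑[ x ∈ xs ] 𝟙 (P? x)           ∎)

∑-concentrated : {xs : List A} {x : A} (φ : A → ℕ) → Unique xs → x ∈ xs →
  (∀ {y} → y ∈ xs → y ≢ x → φ y ≡ 0) → ∑ xs φ ≡ φ x
∑-concentrated {xs = x ∷ xs} φ (x∉xs ∷ _) (here refl) φ≡0 =
  trans (cong (φ x +_) (∑-zero xs (λ y∈xs → φ≡0 (there y∈xs) (λ { refl → All.lookup x∉xs y∈xs refl }))))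
        (+-identityʳ (φ x))
∑-concentrated {xs = y ∷ xs} φ (y∉xs ∷ u) (there x∈xs) φ≡0 =
  cong₂ _+_ (φ≡0 (here refl) (All.lookup y∉xs x∈xs)) (∑-concentrated φ u x∈xs (φ≡0 ∘ there))

-- Enumerations

∈-remove : {x : A} {xs : List A} → x ∈ xs → ∃ λ ys → xs ↭ x ∷ ys
∈-remove x∈xs with ys , zs , refl ← ∈-∃++ x∈xs = ys ++ zs , Perm.shift _ ys zs

∈-∷⇒∈ : {x y : A} {ys : List A} → y ≢ x → y ∈ x ∷ ys → y ∈ ys
∈-∷⇒∈ y≢x (here y≡x)   = ⊥-elim (y≢x y≡x)
∈-∷⇒∈ _   (there y∈ys) = y∈ys

unique∧⊆∧length≥⇒↭ : {xs ys : List A} → Unique xs → xs ⊆ ys → length ys ≤ length xs → xs ↭ ys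
unique∧⊆∧length≥⇒↭ {xs = []} {[]} _ _ _ = ↭-refl
unique∧⊆∧length≥⇒↭ {xs = x ∷ xs} {ys} (x∉xs ∷ u) xs⊆ys ∣ys∣≤∣xs∣
  with zs , ys↭x∷zs ← ∈-remove (xs⊆ys (here refl)) =
  ↭-trans (prep x (unique∧⊆∧length≥⇒↭ u
    (λ y∈xs → ∈-∷⇒∈ (λ { refl → All.lookup x∉xs y∈xs refl }) (Perm.∈-resp-↭ ys↭x∷zs (xs⊆ys (there y∈xs))))
    (≤-pred (subst (_≤ suc (length xs)) (Perm.↭-length ys↭x∷zs) ∣ys∣≤∣xs∣))))
  (↭-sym ys↭x∷zs)

injective⇒map-↭ : {xs : List A} (f : A → A) → Unique xs → (∀ x → x ∈ xs) → Injective _≡_ _≡_ f →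
  map f xs ↭ xs
injective⇒map-↭ {xs = xs} f u complete f-injective =
  unique∧⊆∧length≥⇒↭ (Uniq.map⁺ f-injective u) (λ {x} _ → complete x) (≤-reflexive (sym (length-map f xs)))

∑-reindex : {xs : List A} (f : A → A) → Unique xs → (∀ x → x ∈ xs) → Injective _≡_ _≡_ f →
  (φ : A → ℕ) → ∑ xs (φ ∘ f) ≡ ∑ xs φ
∑-reindex {xs = xs} f u complete f-injective φ =
  trans (sym (∑-map f xs φ)) (∑-↭ φ (injective⇒map-↭ f u complete f-injective))

length-allFin : ∀ n → length (allFin n) ≡ n
length-allFin n = length-tabulate {n = n} id

∑-allFin-const : ∀ n k → ∑[ _ ∈ allFin n ] k ≡ n * k
∑-allFin-const n k = trans (∑-const (allFin n) k) (cong (_* k) (length-allFin n))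

∑-tabulate : (f : Fin n → A) (φ : A → ℕ) → ∑ (List.tabulate f) φ ≡ ∑ (allFin n) (φ ∘ f)
∑-tabulate f φ = trans (cong (λ L → ∑ L φ) (sym (map-tabulate id f))) (∑-map f (allFin _) φ)

∑-allFin-reindex : (π : Fin n → Fin n) → Injective _≡_ _≡_ π → (φ : Fin n → ℕ) →
  ∑ (allFin n) (φ ∘ π) ≡ ∑ (allFin n) φ
∑-allFin-reindex π π-injective = ∑-reindex π (Uniq.allFin⁺ _) ∈-allFin π-injective

∑-δ : (i : Fin n) (φ : Fin n → ℕ) → ∑[ j ∈ allFin n ] (𝟙 (j ≟ i) * φ j) ≡ φ i
∑-δ i φ = begin
  ∑[ j ∈ allFin _ ] (𝟙 (j ≟ i) * φ j)
    ≡⟨ ∑-concentrated _ (Uniq.allFin⁺ _) (∈-allFin i) (λ {j} _ j≢i → cong (_* φ j) (𝟙-no (j ≟ i) j≢i)) ⟩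
  𝟙 (i ≟ i) * φ i   ≡⟨ cong (_* φ i) (𝟙-refl _≟_ i) ⟩
  1 * φ i           ≡⟨ *-identityˡ (φ i) ⟩
  φ i               ∎

injective⇒surjective : {π : Fin n → Fin n} → Injective _≡_ _≡_ π → ∀ y → ∃ λ x → π x ≡ y
injective⇒surjective {π = π} π-injective y
  with x , _ , y≡πx ← ∈-map⁻ π (Perm.∈-resp-↭
         (↭-sym (injective⇒map-↭ π (Uniq.allFin⁺ _) ∈-allFin π-injective)) (∈-allFin y)) =
  x , sym y≡πx

surjective⇒injective : {π : Fin n → Fin n} → (∀ y → ∃ λ x → π x ≡ y) → Injective _≡_ _≡_ π
surjective⇒injective {n = n} {π} π-surjective {x} {x′} πx≡πx′ =
  from-sections (injective⇒surjective section-injective x) (injective⇒surjective section-injective x′)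
  where
  section : Fin n → Fin n
  section = proj₁ ∘ π-surjective
  π-section : ∀ y → π (section y) ≡ y
  π-section = proj₂ ∘ π-surjective
  section-injective : Injective _≡_ _≡_ section
  section-injective {y} {y′} sy≡sy′ = trans (sym (π-section y)) (trans (cong π sy≡sy′) (π-section y′))
  from-sections : (∃ λ y → section y ≡ x) → (∃ λ y → section y ≡ x′) → x ≡ x′
  from-sections (y , refl) (y′ , refl) = cong section (trans (sym (π-section y)) (trans πx≡πx′ (π-section y′)))

allFin-punchIn : (i : Fin (suc n)) → i ∷ map (punchIn i) (allFin n) ↭ allFin (suc n)
allFin-punchIn {n} i = unique∧⊆∧length≥⇒↭ (All.tabulate i≢ ∷ Uniq.map⁺ (punchIn-injective i _ _) (Uniq.allFin⁺ n))
  (λ {j} _ → ∈-allFin j)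
  (≤-reflexive (trans (length-allFin (suc n))
    (cong suc (sym (trans (length-map (punchIn i) (allFin n)) (length-allFin n))))))
  where
  i≢ : ∀ {j} → j ∈ map (punchIn i) (allFin n) → i ≢ j
  i≢ j∈ i≡j with k , _ , j≡ ← ∈-map⁻ (punchIn i) j∈ = punchInᵢ≢i i k (sym (trans i≡j j≡))

∑-punchIn : (i : Fin (suc n)) (φ : Fin (suc n) → ℕ) →
  ∑ (allFin (suc n)) φ ≡ φ i + ∑ (allFin n) (φ ∘ punchIn i)
∑-punchIn {n} i φ = begin
  ∑ (allFin (suc n)) φ                       ≡⟨ ∑-↭ φ (allFin-punchIn i) ⟨
  φ i + ∑ (map (punchIn i) (allFin n)) φ     ≡⟨ cong (φ i +_) (∑-map (punchIn i) (allFin n) φ) ⟩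
  φ i + ∑ (allFin n) (φ ∘ punchIn i)         ∎

allVecs-suc : ∀ n m → allVecs n (suc m) ≡ cartesianProductWith _∷_ (allFin n) (allVecs n m)
allVecs-suc n m = concatMap-map (allFin n)
  where
  concatMap-map : ∀ xs → concatMap (λ x → map (x ∷_) (allVecs n m)) xs ≡ cartesianProductWith _∷_ xs (allVecs n m)
  concatMap-map []       = refl
  concatMap-map (x ∷ xs) = cong (map (x ∷_) (allVecs n m) ++_) (concatMap-map xs)

∈-allVecs : (v : Vec (Fin n) m) → v ∈ allVecs n m
∈-allVecs               []      = here refl
∈-allVecs {n} {suc m} (x ∷ v) =
  subst ((x ∷ v) ∈_) (sym (allVecs-suc n m)) (∈-cartesianProductWith⁺ _∷_ (∈-allFin x) (∈-allVecs v))

allVecs-unique : ∀ n m → Unique (allVecs n m)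
allVecs-unique n zero    = All.[] ∷ []
allVecs-unique n (suc m) = subst Unique (sym (allVecs-suc n m))
  (Uniq.cartesianProductWith⁺ _∷_ Vecₚ.∷-injective (Uniq.allFin⁺ n) (allVecs-unique n m))

∑-allVecs-∷ : ∀ n m (φ : Vec (Fin n) (suc m) → ℕ) →
  ∑ (allVecs n (suc m)) φ ≡ ∑[ x ∈ allFin n ] ∑[ v ∈ allVecs n m ] φ (x ∷ v)
∑-allVecs-∷ n m φ = trans (∑-concatMap _ (allFin n) φ)
  (∑-cong (allFin n) (λ x → ∑-map (x ∷_) (allVecs n m) φ))

length-allVecs : ∀ n m → length (allVecs n m) ≡ n ^ m
length-allVecs n zero    = refl
length-allVecs n (suc m) = begin
  length (allVecs n (suc m))
    ≡⟨ *-identityʳ _ ⟨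
  length (allVecs n (suc m)) * 1
    ≡⟨ ∑-const (allVecs n (suc m)) 1 ⟨
  ∑[ _ ∈ allVecs n (suc m) ] 1
    ≡⟨ ∑-allVecs-∷ n m _ ⟩
  ∑[ _ ∈ allFin n ] ∑[ _ ∈ allVecs n m ] 1
    ≡⟨ ∑-allFin-const n _ ⟩
  n * (∑[ _ ∈ allVecs n m ] 1)
    ≡⟨ cong (n *_) (trans (∑-const (allVecs n m) 1) (trans (*-identityʳ _) (length-allVecs n m))) ⟩
  n ^ suc m ∎

-- Orders of a list

picks : List A → List (A × List A)
picks []       = []
picks (x ∷ xs) = (x , xs) ∷ map (λ (y , ys) → y , x ∷ ys) (picks xs)

∑-picks-∷ : (x : A) (xs : List A) (φ : A → List A → ℕ) →
  ∑[ y , ys ∈ picks (x ∷ xs) ] φ y ys ≡ φ x xs + (∑[ y , ys ∈ picks xs ] φ y (x ∷ ys))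
∑-picks-∷ x xs φ = cong (φ x xs +_) (∑-map _ (picks xs) _)

picks-↭ : {L L′ : List A} {y : A} → (y , L′) ∈ picks L → L ↭ y ∷ L′
picks-↭ {L = x ∷ xs} (here refl) = ↭-refl
picks-↭ {L = x ∷ xs} (there p) with _ , p′ , refl ← ∈-map⁻ _ p =
  ↭-trans (prep x (picks-↭ p′)) (swap _ _ ↭-refl)

∑-picks-cong : (L : List A) {φ ψ : A → List A → ℕ} → (∀ {y L′} → L ↭ y ∷ L′ → φ y L′ ≡ ψ y L′) →
  ∑[ y , L′ ∈ picks L ] φ y L′ ≡ ∑[ y , L′ ∈ picks L ] ψ y L′
∑-picks-cong L φ≡ψ = ∑-cong-∈ (picks L) (φ≡ψ ∘ picks-↭)

map-proj₁-picks : (L : List A) → map proj₁ (picks L) ≡ L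
map-proj₁-picks []      = refl
map-proj₁-picks (x ∷ L) = cong (x ∷_) (trans (sym (map-∘ (picks L))) (map-proj₁-picks L))

∑-picks-proj₁ : (L : List A) (φ : A → ℕ) → ∑[ y , _ ∈ picks L ] φ y ≡ ∑ L φ
∑-picks-proj₁ L φ = trans (sym (∑-map proj₁ (picks L) φ)) (cong (λ M → ∑ M φ) (map-proj₁-picks L))

picks-∈ : {y : A} {L : List A} → y ∈ L → ∃ λ L′ → (y , L′) ∈ picks L
picks-∈ {y = y} {L} y∈L
  with (_ , L′) , p , refl ← ∈-map⁻ proj₁ {xs = picks L} (subst (y ∈_) (sym (map-proj₁-picks L)) y∈L) = L′ , p

∑-picks-map : (f : A → B) (L : List A) (φ : B → List B → ℕ) →
  ∑[ y , L′ ∈ picks (map f L) ] φ y L′ ≡ ∑[ y , L′ ∈ picks L ] φ (f y) (map f L′)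
∑-picks-map f []      φ = refl
∑-picks-map f (x ∷ L) φ = begin
  ∑[ y , L′ ∈ picks (map f (x ∷ L)) ] φ y L′
    ≡⟨ ∑-picks-∷ (f x) (map f L) φ ⟩
  φ (f x) (map f L) + (∑[ y , L′ ∈ picks (map f L) ] φ y (f x ∷ L′))
    ≡⟨ cong (φ (f x) (map f L) +_) (∑-picks-map f L _) ⟩
  φ (f x) (map f L) + (∑[ y , L′ ∈ picks L ] φ (f y) (f x ∷ map f L′))
    ≡⟨ ∑-picks-∷ x L _ ⟨
  ∑[ y , L′ ∈ picks (x ∷ L) ] φ (f y) (map f L′) ∎

∑-picks-∷-∷ : (x y : A) (L : List A) (φ : A → List A → ℕ) →
  ∑[ z , L′ ∈ picks (x ∷ y ∷ L) ] φ z L′ ≡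
  φ x (y ∷ L) + (φ y (x ∷ L) + (∑[ z , L′ ∈ picks L ] φ z (x ∷ y ∷ L′)))
∑-picks-∷-∷ x y L φ = trans (∑-picks-∷ x (y ∷ L) φ) (cong (φ x (y ∷ L) +_) (∑-picks-∷ y L _))

∑-picks-↭ : {L M : List A} (φ : A → List A → ℕ) → (∀ y {L′ M′} → L′ ↭ M′ → φ y L′ ≡ φ y M′) →
  L ↭ M → ∑[ y , L′ ∈ picks L ] φ y L′ ≡ ∑[ y , M′ ∈ picks M ] φ y M′
∑-picks-↭ φ φ-↭ ↭.refl = refl
∑-picks-↭ {L = x ∷ L} {M = x ∷ M} φ φ-↭ (prep x L↭M) = begin
  ∑[ y , L′ ∈ picks (x ∷ L) ] φ y L′
    ≡⟨ ∑-picks-∷ x L φ ⟩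
  φ x L + (∑[ y , L′ ∈ picks L ] φ y (x ∷ L′))
    ≡⟨ cong₂ _+_ (φ-↭ x L↭M) (∑-picks-↭ _ (λ y L′↭M′ → φ-↭ y (prep x L′↭M′)) L↭M) ⟩
  φ x M + (∑[ y , M′ ∈ picks M ] φ y (x ∷ M′))
    ≡⟨ ∑-picks-∷ x M φ ⟨
  ∑[ y , M′ ∈ picks (x ∷ M) ] φ y M′ ∎
∑-picks-↭ {L = x ∷ y ∷ L} {M = y ∷ x ∷ M} φ φ-↭ (swap x y L↭M) = begin
  ∑[ z , L′ ∈ picks (x ∷ y ∷ L) ] φ z L′
    ≡⟨ ∑-picks-∷-∷ x y L φ ⟩
  φ x (y ∷ L) + (φ y (x ∷ L) + (∑[ z , L′ ∈ picks L ] φ z (x ∷ y ∷ L′)))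
    ≡⟨ cong₂ _+_ (φ-↭ x (prep y L↭M)) (cong₂ _+_ (φ-↭ y (prep x L↭M))
         (trans (∑-picks-cong L (λ {z} _ → φ-↭ z (swap x y ↭-refl)))
                (∑-picks-↭ _ (λ z L′↭M′ → φ-↭ z (prep y (prep x L′↭M′))) L↭M))) ⟩
  φ x (y ∷ M) + (φ y (x ∷ M) + (∑[ z , M′ ∈ picks M ] φ z (y ∷ x ∷ M′)))
    ≡⟨ x∙yz≈y∙xz +-commutativeSemigroup (φ x (y ∷ M)) (φ y (x ∷ M)) _ ⟩
  φ y (x ∷ M) + (φ x (y ∷ M) + (∑[ z , M′ ∈ picks M ] φ z (y ∷ x ∷ M′)))
    ≡⟨ ∑-picks-∷-∷ y x M φ ⟨
  ∑[ z , M′ ∈ picks (y ∷ x ∷ M) ] φ z M′ ∎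
∑-picks-↭ φ φ-↭ (↭.trans L↭M M↭N) = trans (∑-picks-↭ φ φ-↭ L↭M) (∑-picks-↭ φ φ-↭ M↭N)

splits : List A → List (List A × List A)
splits []       = ([] , []) ∷ []
splits (x ∷ xs) = map (λ (l , r) → x ∷ l , r) (splits xs) ++ map (λ (l , r) → l , x ∷ r) (splits xs)

∑-splits-∷ : (x : A) (xs : List A) (φ : List A → List A → ℕ) →
  ∑[ l , r ∈ splits (x ∷ xs) ] φ l r ≡
  (∑[ l , r ∈ splits xs ] φ (x ∷ l) r) + (∑[ l , r ∈ splits xs ] φ l (x ∷ r))
∑-splits-∷ x xs φ = trans (∑-++ (map _ (splits xs)) (map _ (splits xs)) _)
  (cong₂ _+_ (∑-map _ (splits xs) _) (∑-map _ (splits xs) _))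

∑-splits-swap : (L : List A) (φ : List A → List A → ℕ) →
  ∑[ l , r ∈ splits L ] φ l r ≡ ∑[ l , r ∈ splits L ] φ r l
∑-splits-swap []      φ = refl
∑-splits-swap (x ∷ L) φ = begin
  ∑[ l , r ∈ splits (x ∷ L) ] φ l r
    ≡⟨ ∑-splits-∷ x L φ ⟩
  (∑[ l , r ∈ splits L ] φ (x ∷ l) r) + (∑[ l , r ∈ splits L ] φ l (x ∷ r))
    ≡⟨ cong₂ _+_ (∑-splits-swap L (φ ∘ (x ∷_))) (∑-splits-swap L (λ l r → φ l (x ∷ r))) ⟩
  (∑[ l , r ∈ splits L ] φ (x ∷ r) l) + (∑[ l , r ∈ splits L ] φ r (x ∷ l))
    ≡⟨ +-comm (∑[ l , r ∈ splits L ] φ (x ∷ r) l) _ ⟩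
  (∑[ l , r ∈ splits L ] φ r (x ∷ l)) + (∑[ l , r ∈ splits L ] φ (x ∷ r) l)
    ≡⟨ ∑-splits-∷ x L (λ l r → φ r l) ⟨
  ∑[ l , r ∈ splits (x ∷ L) ] φ r l ∎

∑-splits-picks : (L : List A) (φ : A → List A → List A → ℕ) →
  ∑[ l , r ∈ splits L ] ∑[ y , l′ ∈ picks l ] φ y l′ r ≡
  ∑[ y , L′ ∈ picks L ] ∑[ l , r ∈ splits L′ ] φ y l r
∑-splits-picks []      φ = refl
∑-splits-picks (x ∷ L) φ = begin
  ∑[ l , r ∈ splits (x ∷ L) ] ∑[ y , l′ ∈ picks l ] φ y l′ r
    ≡⟨ ∑-splits-∷ x L _ ⟩
  (∑[ l , r ∈ splits L ] ∑[ y , l′ ∈ picks (x ∷ l) ] φ y l′ r)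
    + (∑[ l , r ∈ splits L ] ∑[ y , l′ ∈ picks l ] φ y l′ (x ∷ r))
    ≡⟨ cong (_+ (∑[ l , r ∈ splits L ] ∑[ y , l′ ∈ picks l ] φ y l′ (x ∷ r)))
         (trans (∑-cong (splits L) (λ (l , r) → ∑-picks-∷ x l (λ y l′ → φ y l′ r))) (∑-+ (splits L) _ _)) ⟩
  x-picked + (∑[ l , r ∈ splits L ] ∑[ y , l′ ∈ picks l ] φ y (x ∷ l′) r)
    + (∑[ l , r ∈ splits L ] ∑[ y , l′ ∈ picks l ] φ y l′ (x ∷ r))
    ≡⟨ cong₂ (λ s t → x-picked + s + t)
         (∑-splits-picks L (λ y l r → φ y (x ∷ l) r)) (∑-splits-picks L (λ y l r → φ y l (x ∷ r))) ⟩
  x-picked + (∑[ y , L′ ∈ picks L ] ∑[ l , r ∈ splits L′ ] φ y (x ∷ l) r)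
    + (∑[ y , L′ ∈ picks L ] ∑[ l , r ∈ splits L′ ] φ y l (x ∷ r))
    ≡⟨ trans (+-assoc x-picked _ _) (cong (x-picked +_) (sym (∑-+ (picks L) _ _))) ⟩
  x-picked + (∑[ y , L′ ∈ picks L ]
    ((∑[ l , r ∈ splits L′ ] φ y (x ∷ l) r) + (∑[ l , r ∈ splits L′ ] φ y l (x ∷ r))))
    ≡⟨ cong (x-picked +_) (∑-cong (picks L) (λ (y , L′) → ∑-splits-∷ x L′ (φ y))) ⟨
  x-picked + (∑[ y , L′ ∈ picks L ] ∑[ l , r ∈ splits (x ∷ L′) ] φ y l r)
    ≡⟨ ∑-picks-∷ x L _ ⟨
  ∑[ y , L′ ∈ picks (x ∷ L) ] ∑[ l , r ∈ splits L′ ] φ y l r ∎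
  where x-picked = ∑[ l , r ∈ splits L ] φ x l r

𝟙-null : List A → ℕ
𝟙-null L = if null L then 1 else 0

∑-splits-null : (L : List A) (φ : List A → ℕ) → ∑[ l , r ∈ splits L ] (𝟙-null l * φ r) ≡ φ L
∑-splits-null []      φ = trans (+-identityʳ _) (+-identityʳ _)
∑-splits-null (x ∷ L) φ = trans (∑-splits-∷ x L _)
  (cong₂ _+_ (∑-zero (splits L) (λ _ → refl)) (∑-splits-null L (φ ∘ (x ∷_))))

ordersOfLength : ℕ → List A → List (List A)
ordersOfLength zero    L = [] ∷ []
ordersOfLength (suc k) L = concatMap (λ (y , L′) → map (y ∷_) (ordersOfLength k L′)) (picks L)

orders : List A → List (List A)
orders L = ordersOfLength (length L) L

∑-ordersOfLength-suc : ∀ k (L : List A) (φ : List A → ℕ) →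
  ∑ (ordersOfLength (suc k) L) φ ≡ ∑[ y , L′ ∈ picks L ] ∑[ o ∈ ordersOfLength k L′ ] φ (y ∷ o)
∑-ordersOfLength-suc k L φ = trans (∑-concatMap _ (picks L) φ)
  (∑-cong (picks L) (λ (y , L′) → ∑-map (y ∷_) (ordersOfLength k L′) φ))

∑-orders-∷ : (x : A) (L : List A) (φ : List A → ℕ) →
  ∑ (orders (x ∷ L)) φ ≡ ∑[ y , L′ ∈ picks (x ∷ L) ] ∑[ o ∈ orders L′ ] φ (y ∷ o)
∑-orders-∷ x L φ = trans (∑-ordersOfLength-suc (length L) (x ∷ L) φ)
  (∑-picks-cong (x ∷ L) (λ {y} {L′} L↭y∷L′ →
    cong (λ k → ∑[ o ∈ ordersOfLength k L′ ] φ (y ∷ o)) (suc-injective (Perm.↭-length L↭y∷L′))))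

∑-orders : (L : List A) (φ : List A → ℕ) →
  ∑ (orders L) φ ≡ 𝟙-null L * φ [] + (∑[ y , L′ ∈ picks L ] ∑[ o ∈ orders L′ ] φ (y ∷ o))
∑-orders []      φ = cong (_+ 0) (sym (*-identityˡ (φ [])))
∑-orders (x ∷ L) φ = ∑-orders-∷ x L φ

∑-orders-↭ : {L M : List A} (φ : List A → ℕ) → L ↭ M → ∑ (orders L) φ ≡ ∑ (orders M) φ
∑-orders-↭ {L = L} {M} φ L↭M =
  trans (of-length (length L) L↭M φ) (cong (λ k → ∑ (ordersOfLength k M) φ) (Perm.↭-length L↭M))
  where
  of-length : ∀ k {L M : List _} → L ↭ M → (φ : List _ → ℕ) → ∑ (ordersOfLength k L) φ ≡ ∑ (ordersOfLength k M) φ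
  of-length zero            L↭M φ = refl
  of-length (suc k) {L} {M} L↭M φ = begin
    ∑ (ordersOfLength (suc k) L) φ
      ≡⟨ ∑-ordersOfLength-suc k L φ ⟩
    ∑[ y , L′ ∈ picks L ] ∑[ o ∈ ordersOfLength k L′ ] φ (y ∷ o)
      ≡⟨ ∑-picks-↭ _ (λ y L′↭M′ → of-length k L′↭M′ (φ ∘ (y ∷_))) L↭M ⟩
    ∑[ y , M′ ∈ picks M ] ∑[ o ∈ ordersOfLength k M′ ] φ (y ∷ o)
      ≡⟨ ∑-ordersOfLength-suc k M φ ⟨
    ∑ (ordersOfLength (suc k) M) φ ∎

∑-orders-map : (f : A → B) (L : List A) (φ : List B → ℕ) → ∑ (orders (map f L)) φ ≡ ∑ (orders L) (φ ∘ map f)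
∑-orders-map f L φ =
  trans (cong (λ k → ∑ (ordersOfLength k (map f L)) φ) (length-map f L)) (of-length (length L) L φ)
  where
  of-length : ∀ k L φ → ∑ (ordersOfLength k (map f L)) φ ≡ ∑ (ordersOfLength k L) (φ ∘ map f)
  of-length zero    L φ = refl
  of-length (suc k) L φ = begin
    ∑ (ordersOfLength (suc k) (map f L)) φ
      ≡⟨ ∑-ordersOfLength-suc k (map f L) φ ⟩
    ∑[ y , L′ ∈ picks (map f L) ] ∑[ o ∈ ordersOfLength k L′ ] φ (y ∷ o)
      ≡⟨ ∑-picks-map f L _ ⟩
    ∑[ y , L′ ∈ picks L ] ∑[ o ∈ ordersOfLength k (map f L′) ] φ (f y ∷ o)
      ≡⟨ ∑-cong (picks L) (λ (y , L′) → of-length k L′ (φ ∘ (f y ∷_))) ⟩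
    ∑[ y , L′ ∈ picks L ] ∑[ o ∈ ordersOfLength k L′ ] φ (map f (y ∷ o))
      ≡⟨ ∑-ordersOfLength-suc k L (φ ∘ map f) ⟨
    ∑ (ordersOfLength (suc k) L) (φ ∘ map f) ∎

∑-orders-through : (e : A) (L : List A) (φ : List A → ℕ) →
  ∑ (orders (e ∷ L)) φ ≡ ∑[ l , r ∈ splits L ] ∑[ p ∈ orders l ] ∑[ s ∈ orders r ] φ (p ++ e ∷ s)
∑-orders-through {A = A} e L φ = by-length (length L) L φ refl
  where
  through : List A → (List A → ℕ) → ℕ
  through L φ = ∑[ l , r ∈ splits L ] ∑[ p ∈ orders l ] ∑[ s ∈ orders r ] φ (p ++ e ∷ s)

  after : (List A → ℕ) → List A → List A → ℕ
  after φ r p = ∑[ s ∈ orders r ] φ (p ++ e ∷ s)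

  by-length : ∀ k L φ → length L ≡ k → ∑ (orders (e ∷ L)) φ ≡ through L φ
  e-not-first : ∀ k L φ → length L ≡ k →
    ∑[ y , L′ ∈ picks L ] ∑[ o ∈ orders (e ∷ L′) ] φ (y ∷ o) ≡ ∑[ y , L′ ∈ picks L ] through L′ (φ ∘ (y ∷_))

  by-length k L φ ∣L∣≡k = begin
    ∑ (orders (e ∷ L)) φ
      ≡⟨ trans (∑-orders-∷ e L φ) (∑-picks-∷ e L _) ⟩
    after φ L [] + (∑[ y , L′ ∈ picks L ] ∑[ o ∈ orders (e ∷ L′) ] φ (y ∷ o))
      ≡⟨ cong (after φ L [] +_) (trans (e-not-first k L φ ∣L∣≡k) (sym (∑-splits-picks L _))) ⟩
    after φ L [] + (∑[ l , r ∈ splits L ] ∑[ y , l′ ∈ picks l ] ∑[ p ∈ orders l′ ] after φ r (y ∷ p))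
      ≡⟨ cong (_+ (∑[ l , r ∈ splits L ] ∑[ y , l′ ∈ picks l ] ∑[ p ∈ orders l′ ] after φ r (y ∷ p)))
           (∑-splits-null L (λ r → after φ r [])) ⟨
    (∑[ l , r ∈ splits L ] (𝟙-null l * after φ r []))
      + (∑[ l , r ∈ splits L ] ∑[ y , l′ ∈ picks l ] ∑[ p ∈ orders l′ ] after φ r (y ∷ p))
      ≡⟨ ∑-+ (splits L) _ _ ⟨
    ∑[ l , r ∈ splits L ] (𝟙-null l * after φ r [] + (∑[ y , l′ ∈ picks l ] ∑[ p ∈ orders l′ ] after φ r (y ∷ p)))
      ≡⟨ ∑-cong (splits L) (λ (l , r) → ∑-orders l (after φ r)) ⟨
    through L φ ∎

  e-not-first zero    []        φ _       = refl
  e-not-first (suc k) L@(_ ∷ _) φ ∣L∣≡1+k = ∑-picks-cong L (λ {y} {L′} L↭y∷L′ →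
    by-length k L′ (φ ∘ (y ∷_)) (suc-injective (trans (sym (Perm.↭-length L↭y∷L′)) ∣L∣≡1+k)))

ordersOfLength-∈⁻ : ∀ k {L o : List A} → o ∈ ordersOfLength (suc k) L →
  ∃₂ λ y L′ → ∃ λ o′ → o ≡ y ∷ o′ × (y , L′) ∈ picks L × o′ ∈ ordersOfLength k L′
ordersOfLength-∈⁻ k {L} o∈
  with (y , L′) , p , y∷o′∈ ← find (∈-concatMap⁻ (λ (y , L′) → map (y ∷_) (ordersOfLength k L′)) {xs = picks L} o∈)
  with o′ , o′∈ , refl ← ∈-map⁻ (y ∷_) y∷o′∈ = y , L′ , o′ , refl , p , o′∈

∈-orders⇒↭ : {L o : List A} → o ∈ orders L → o ↭ L
∈-orders⇒↭ {L = L} = of-length (length L) refl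
  where
  of-length : ∀ k {L o : List _} → length L ≡ k → o ∈ ordersOfLength k L → o ↭ L
  of-length zero    {[]} _       (here refl) = ↭-refl
  of-length (suc k) {L}  ∣L∣≡1+k o∈ with y , L′ , o′ , refl , p , o′∈ ← ordersOfLength-∈⁻ k {L} o∈ =
    ↭-trans (prep y (of-length k ∣L′∣≡k o′∈)) (↭-sym (picks-↭ p))
    where
    ∣L′∣≡k : length L′ ≡ k
    ∣L′∣≡k = suc-injective (trans (sym (Perm.↭-length (picks-↭ p))) ∣L∣≡1+k)

↭⇒∈-orders : {L o : List A} → o ↭ L → o ∈ orders L
↭⇒∈-orders {L = L} {o} o↭L = subst (λ k → o ∈ ordersOfLength k L) (Perm.↭-length o↭L) (by-head o o↭L)
  where
  by-head : ∀ o {L : List _} → o ↭ L → o ∈ ordersOfLength (length o) L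
  by-head []          o↭L   = here refl
  by-head (y ∷ o) {L} y∷o↭L with L′ , p ← picks-∈ (Perm.∈-resp-↭ y∷o↭L (here refl)) =
    ∈-concatMap⁺ (λ (y , L′) → map (y ∷_) (ordersOfLength (length o) L′)) {xs = picks L}
      (lose p (∈-map⁺ (y ∷_) (by-head o (Perm.drop-∷ (↭-trans y∷o↭L (picks-↭ p))))))

concatMap-unique : (f : A → List B) {xs : List A} → All (Unique ∘ f) xs → AllPairs (Disjoint on f) xs →
  Unique (concatMap f xs)
concatMap-unique f unique disjoint = Uniq.concat⁺ (Allₚ.map⁺ unique) (AllPairsₚ.map⁺ disjoint)

Unique-resp-↭ : {L M : List A} → L ↭ M → Unique L → Unique M
Unique-resp-↭ L↭M = Permₛ.Unique-resp-↭ (setoid _) (↭⇒↭ₛ L↭M)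

orders-unique : {L : List A} → Unique L → Unique (orders L)
orders-unique {L = L} = of-length (length L)
  where
  of-length : ∀ k {L : List _} → Unique L → Unique (ordersOfLength k L)
  of-length zero    _          = All.[] ∷ []
  of-length (suc k) {L} unique = concatMap-unique _
    (All.tabulate (λ p → Uniq.map⁺ ∷-injectiveʳ (of-length k (AllPairs.tail (Unique-resp-↭ (picks-↭ p) unique)))))
    (AllPairs.map disjoint (AllPairsₚ.map⁻ (subst Unique (sym (map-proj₁-picks L)) unique)))
    where
    disjoint : ∀ {(y , L′) (z , M′) : _ × List _} → y ≢ z →
      Disjoint (map (y ∷_) (ordersOfLength k L′)) (map (z ∷_) (ordersOfLength k M′))
    disjoint y≢z (y∷o∈ , z∷o∈) with _ , _ , refl ← ∈-map⁻ _ y∷o∈ | _ , _ , y∷≡z∷ ← ∈-map⁻ _ z∷o∈ =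
      y≢z (∷-injectiveˡ y∷≡z∷)

-- Hamiltonian circuits of a relation

Chain : Rel A ℓ → A → List A → A → Set ℓ
Chain R x []      z = R x z
Chain R x (y ∷ o) z = R x y × Chain R y o z

chain? : {R : Rel A ℓ} → Decidable₂ R → ∀ x o z → Dec (Chain R x o z)
chain? R? x []      z = R? x z
chain? R? x (y ∷ o) z = R? x y ×-dec chain? R? y o z

𝟙-chain-++ : {R : Rel A ℓ} (R? : Decidable₂ R) (p s : List A) {x y z : A} →
  𝟙 (chain? R? x (p ++ y ∷ s) z) ≡ 𝟙 (chain? R? x p y) * 𝟙 (chain? R? y s z)
𝟙-chain-++ R? []      s {x} {y} {z} = 𝟙-×-dec (R? x y) (chain? R? y s z)
𝟙-chain-++ R? (w ∷ p) s {x} {y} {z} = begin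
  𝟙 (chain? R? x (w ∷ p ++ y ∷ s) z)
    ≡⟨ 𝟙-×-dec (R? x w) (chain? R? w (p ++ y ∷ s) z) ⟩
  𝟙 (R? x w) * 𝟙 (chain? R? w (p ++ y ∷ s) z)
    ≡⟨ cong (𝟙 (R? x w) *_) (𝟙-chain-++ R? p s) ⟩
  𝟙 (R? x w) * (𝟙 (chain? R? w p y) * 𝟙 (chain? R? y s z))
    ≡⟨ *-assoc (𝟙 (R? x w)) _ _ ⟨
  𝟙 (R? x w) * 𝟙 (chain? R? w p y) * 𝟙 (chain? R? y s z)
    ≡⟨ cong (_* 𝟙 (chain? R? y s z)) (𝟙-×-dec (R? x w) (chain? R? w p y)) ⟨
  𝟙 (chain? R? x (w ∷ p) y) * 𝟙 (chain? R? y s z) ∎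

module _ {R : Rel A ℓ} (R? : Decidable₂ R) where

  paths : A → A → List A → ℕ
  paths x z L = ∑[ o ∈ orders L ] 𝟙 (chain? R? x o z)

  paths-↭ : ∀ x z {L M} → L ↭ M → paths x z L ≡ paths x z M
  paths-↭ x z = ∑-orders-↭ (λ o → 𝟙 (chain? R? x o z))

  paths-∷ : ∀ x z y L → paths x z (y ∷ L) ≡ ∑[ w , L′ ∈ picks (y ∷ L) ] (𝟙 (R? x w) * paths w z L′)
  paths-∷ x z y L = trans (∑-orders-∷ y L _) (∑-cong (picks (y ∷ L)) (λ (w , L′) →
    trans (∑-cong (orders L′) (λ o → 𝟙-×-dec (R? x w) (chain? R? w o z))) (∑-*ˡ (orders L′) (𝟙 (R? x w)) _)))

  paths-through : ∀ x z y L → paths x z (y ∷ L) ≡ ∑[ l , r ∈ splits L ] (paths x y l * paths y z r)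
  paths-through x z y L = trans (∑-orders-through y L _) (∑-cong (splits L) (λ (l , r) → trans
    (∑-cong (orders l) (λ p → ∑-cong (orders r) (λ s → 𝟙-chain-++ R? p s)))
    (∑-* (orders l) (orders r) _ _)))

  -- The number of cyclic orders of L in which each element is related to the next
  -- one; the value at [] is junk.
  circuits : List A → ℕ
  circuits []      = 0
  circuits (x ∷ L) = paths x x L

  circuits-swap : ∀ x y L → circuits (x ∷ y ∷ L) ≡ circuits (y ∷ x ∷ L)
  circuits-swap x y L = begin
    paths x x (y ∷ L)                                 ≡⟨ paths-through x x y L ⟩
    ∑[ l , r ∈ splits L ] (paths x y l * paths y x r) ≡⟨ ∑-splits-swap L _ ⟩
    ∑[ l , r ∈ splits L ] (paths x y r * paths y x l) ≡⟨ ∑-cong (splits L) (λ (l , r) → *-comm (paths x y r) _) ⟩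
    ∑[ l , r ∈ splits L ] (paths y x l * paths x y r) ≡⟨ paths-through y y x L ⟨
    paths y y (x ∷ L)                                 ∎

  circuits-↭ : {L M : List A} → L ↭ M → circuits L ≡ circuits M
  circuits-↭ ↭.refl                         = refl
  circuits-↭ (prep x L↭M)                   = paths-↭ x x L↭M
  circuits-↭ {M = _ ∷ _ ∷ M} (swap x y L↭M) = trans (paths-↭ x x (prep y L↭M)) (circuits-swap x y M)
  circuits-↭ (↭.trans L↭M M↭N)              = trans (circuits-↭ L↭M) (circuits-↭ M↭N)

chain-map : {R : Rel A ℓ₁} {S : Rel B ℓ₂} (f : A → B) → (∀ x y → R x y ⇔ S (f x) (f y)) →
  ∀ x o z → Chain R x o z ⇔ Chain S (f x) (map f o) (f z)
chain-map f R⇔S x []      z = R⇔S x z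
chain-map f R⇔S x (y ∷ o) z = R⇔S x y ×-⇔ chain-map f R⇔S y o z

circuits-map : {R : Rel A ℓ₁} {S : Rel B ℓ₂} (R? : Decidable₂ R) (S? : Decidable₂ S)
  (f : A → B) → (∀ x y → R x y ⇔ S (f x) (f y)) → ∀ L → circuits S? (map f L) ≡ circuits R? L
circuits-map R? S? f R⇔S []      = refl
circuits-map R? S? f R⇔S (x ∷ L) = trans (∑-orders-map f L _)
  (∑-cong (orders L) (λ o → sym (𝟙-⇔ (chain-map f R⇔S x o x) (chain? R? x o x) (chain? S? (f x) (map f o) (f x)))))

-- Eulerian tours

Edge : Set ℓ → Set ℓ
Edge V = V × V

source target : {V : Set ℓ} → Edge V → V
source = proj₁
target = proj₂

mapEdge : (A → B) → Edge A → Edge B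
mapEdge f = Product.map f f

module EulerianTours {V : Set ℓ} (_≟_ : DecidableEquality V) where

  Consecutive : Rel (Edge V) ℓ
  Consecutive e f = target e ≡ source f

  consecutive? : Decidable₂ Consecutive
  consecutive? e f = target e ≟ source f

  tours : List (Edge V) → ℕ
  tours = circuits consecutive?

  tours-↭ : {L M : List (Edge V)} → L ↭ M → tours L ≡ tours M
  tours-↭ = circuits-↭ consecutive?

  chain-endpoints : ∀ {a a′ b c d d′} o →
    Chain Consecutive (a , b) o (c , d) → Chain Consecutive (a′ , b) o (c , d′)
  chain-endpoints []      b≡c             = b≡c
  chain-endpoints (_ ∷ o) (b≡source , ch) = b≡source , chain-endpoints o ch

  tours-merge : ∀ a b x L → tours ((a , b) ∷ x ∷ L) ≡
    ∑[ y , L′ ∈ picks (x ∷ L) ] (𝟙 (b ≟ source y) * tours ((a , target y) ∷ L′))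
  tours-merge a b x L = trans (paths-∷ consecutive? (a , b) (a , b) x L)
    (∑-cong (picks (x ∷ L)) (λ (y , L′) → cong (𝟙 (b ≟ source y) *_) (∑-cong (orders L′) (λ o →
      𝟙-⇔ (mk⇔ (chain-endpoints o) (chain-endpoints o))
        (chain? consecutive? y o (a , b)) (chain? consecutive? (a , target y) o (a , target y))))))

  outdeg indeg : V → List (Edge V) → ℕ
  outdeg u L = ∑[ e ∈ L ] 𝟙 (u ≟ source e)
  indeg  u L = ∑[ e ∈ L ] 𝟙 (u ≟ target e)

  outdeg-↭ : ∀ u {L M} → L ↭ M → outdeg u L ≡ outdeg u M
  outdeg-↭ u {L} {M} = ∑-↭ {xs = L} {M} (λ e → 𝟙 (u ≟ source e))

  indeg-↭ : ∀ u {L M} → L ↭ M → indeg u L ≡ indeg u M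
  indeg-↭ u {L} {M} = ∑-↭ {xs = L} {M} (λ e → 𝟙 (u ≟ target e))

  tours-loop : ∀ u x L → tours ((u , u) ∷ x ∷ L) ≡ outdeg u (x ∷ L) * tours (x ∷ L)
  tours-loop u x L = begin
    tours ((u , u) ∷ x ∷ L)
      ≡⟨ tours-merge u u x L ⟩
    ∑[ y , L′ ∈ picks (x ∷ L) ] (𝟙 (u ≟ source y) * tours ((u , target y) ∷ L′))
      ≡⟨ ∑-picks-cong (x ∷ L) (λ {y} xL↭yL′ → 𝟙-guard (u ≟ source y) (λ { refl → tours-↭ (↭-sym xL↭yL′) })) ⟩
    ∑[ y , _ ∈ picks (x ∷ L) ] (𝟙 (u ≟ source y) * tours (x ∷ L))
      ≡⟨ ∑-picks-proj₁ (x ∷ L) _ ⟩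
    ∑[ y ∈ x ∷ L ] (𝟙 (u ≟ source y) * tours (x ∷ L))
      ≡⟨ ∑-*ʳ (x ∷ L) (tours (x ∷ L)) (λ y → 𝟙 (u ≟ source y)) ⟩
    outdeg u (x ∷ L) * tours (x ∷ L) ∎

  tours-insert-loop : ∀ u e f L →
    tours (e ∷ f ∷ (u , u) ∷ L) ≡ outdeg u (e ∷ f ∷ L) * tours (e ∷ f ∷ L)
  tours-insert-loop u e f L = trans (tours-↭ (Perm.shift (u , u) (e ∷ f ∷ []) L)) (tours-loop u e (f ∷ L))

  tours-merge-third : ∀ e f a b L → b ≢ source e → b ≢ source f → tours (e ∷ f ∷ (a , b) ∷ L) ≡
    ∑[ y , L′ ∈ picks L ] (𝟙 (b ≟ source y) * tours (e ∷ f ∷ (a , target y) ∷ L′))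
  tours-merge-third e f a b L b≢e b≢f = begin
    tours (e ∷ f ∷ (a , b) ∷ L)
      ≡⟨ tours-↭ (Perm.shift (a , b) (e ∷ f ∷ []) L) ⟩
    tours ((a , b) ∷ e ∷ f ∷ L)
      ≡⟨ tours-merge a b e (f ∷ L) ⟩
    ∑[ y , L′ ∈ picks (e ∷ f ∷ L) ] merged y L′
      ≡⟨ ∑-picks-∷-∷ e f L merged ⟩
    merged e (f ∷ L) + (merged f (e ∷ L) + (∑[ y , L′ ∈ picks L ] merged y (e ∷ f ∷ L′)))
      ≡⟨ cong₂ (λ s t → s + (t + (∑[ y , L′ ∈ picks L ] merged y (e ∷ f ∷ L′))))
           (merged-0 e (f ∷ L) b≢e) (merged-0 f (e ∷ L) b≢f) ⟩
    ∑[ y , L′ ∈ picks L ] merged y (e ∷ f ∷ L′)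
      ≡⟨ ∑-cong (picks L) (λ (y , L′) →
           cong (𝟙 (b ≟ source y) *_) (tours-↭ (Perm.shift (a , target y) (e ∷ f ∷ []) L′))) ⟨
    ∑[ y , L′ ∈ picks L ] (𝟙 (b ≟ source y) * tours (e ∷ f ∷ (a , target y) ∷ L′)) ∎
    where
    merged : Edge V → List (Edge V) → ℕ
    merged y L′ = 𝟙 (b ≟ source y) * tours ((a , target y) ∷ L′)
    merged-0 : ∀ y L′ → b ≢ source y → merged y L′ ≡ 0
    merged-0 y L′ b≢y = cong (_* tours ((a , target y) ∷ L′)) (𝟙-no (b ≟ source y) b≢y)

  Balanced : V → List (Edge V) → Set
  Balanced w L = outdeg w L ≡ indeg w L

  balanced-resp-↭ : ∀ {L M} w → L ↭ M → Balanced w L → Balanced w M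
  balanced-resp-↭ w L↭M balanced = trans (sym (outdeg-↭ w L↭M)) (trans balanced (indeg-↭ w L↭M))

  balanced-drop-loop : ∀ w x L → Balanced w ((x , x) ∷ L) → Balanced w L
  balanced-drop-loop w x L = +-cancelˡ-≡ (𝟙 (w ≟ x)) _ _

  outdeg-merge : ∀ w a b c L → b ≢ w → outdeg w ((a , b) ∷ (b , c) ∷ L) ≡ outdeg w ((a , c) ∷ L)
  outdeg-merge w a b c L b≢w = cong (λ d → 𝟙 (w ≟ a) + (d + outdeg w L)) (𝟙-no (w ≟ b) (b≢w ∘ sym))

  indeg-merge : ∀ w a b c L → b ≢ w → indeg w ((a , b) ∷ (b , c) ∷ L) ≡ indeg w ((a , c) ∷ L)
  indeg-merge w a b c L b≢w = cong (λ d → d + (𝟙 (w ≟ c) + indeg w L)) (𝟙-no (w ≟ b) (b≢w ∘ sym))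

  balanced-merge : ∀ w a b c L → b ≢ w → Balanced w ((a , b) ∷ (b , c) ∷ L) → Balanced w ((a , c) ∷ L)
  balanced-merge w a b c L b≢w balanced =
    trans (sym (outdeg-merge w a b c L b≢w)) (trans balanced (indeg-merge w a b c L b≢w))

  tours-loops : ∀ u n → tours (replicate (suc n) (u , u)) ≡ n !
  tours-loops u zero    = trans (+-identityʳ _) (𝟙-refl _≟_ u)
  tours-loops u (suc n) = begin
    tours (replicate (2 + n) (u , u))
      ≡⟨ tours-loop u (u , u) (replicate n (u , u)) ⟩
    outdeg u (replicate (suc n) (u , u)) * tours (replicate (suc n) (u , u))
      ≡⟨ cong₂ _*_ (∑-replicate (suc n) (u , u) (λ e → 𝟙 (u ≟ source e))) (tours-loops u n) ⟩
    suc n * 𝟙 (u ≟ u) * n !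
      ≡⟨ cong (λ d → suc n * d * n !) (𝟙-refl _≟_ u) ⟩
    suc n * 1 * n !
      ≡⟨ cong (_* n !) (*-identityʳ (suc n)) ⟩
    suc n ! ∎

  module Contraction (u v : V) (u≢v : u ≢ v) where

    IsUV : V → Set ℓ
    IsUV x = u ≡ x ⊎ v ≡ x

    isUV? : ∀ x → Dec (IsUV x)
    isUV? x = (u ≟ x) ⊎-dec (v ≟ x)

    𝟙-isUV : ∀ x → 𝟙 (u ≟ x) + 𝟙 (v ≟ x) ≡ 𝟙 (isUV? x)
    𝟙-isUV x with u ≟ x | v ≟ x
    ... | yes refl | yes v≡u = ⊥-elim (u≢v (sym v≡u))
    ... | yes _    | no _    = refl
    ... | no _     | yes _   = refl
    ... | no _     | no _    = refl

    contract : V → V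
    contract x = if does (v ≟ x) then u else x

    contractEdges : List (Edge V) → List (Edge V)
    contractEdges = map (mapEdge contract)

    contract-uv : ∀ {x} → IsUV x → contract x ≡ u
    contract-uv (inj₁ refl) = cong (if_then u else u) (dec-false (v ≟ u) (u≢v ∘ sym))
    contract-uv (inj₂ refl) = cong (if_then u else v) (dec-true (v ≟ v) refl)

    contract-other : ∀ {x} → ¬ IsUV x → contract x ≡ x
    contract-other {x} ¬uv = cong (if_then u else x) (dec-false (v ≟ x) (¬uv ∘ inj₂))

    uu uv vu vv : Edge V
    uu = u , u
    uv = u , v
    vu = v , u
    vv = v , v

    alternating : ℕ → ℕ → List (Edge V)
    alternating r s = replicate r uv ++ replicate s vu

    ∑-alternating : ∀ r s (φ : Edge V → ℕ) → ∑ (alternating r s) φ ≡ r * φ uv + s * φ vu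
    ∑-alternating r s φ = trans (∑-++ (replicate r uv) (replicate s vu) φ)
      (cong₂ _+_ (∑-replicate r uv φ) (∑-replicate s vu φ))

    *1+*0 : ∀ r s {a b} → a ≡ 1 → b ≡ 0 → r * a + s * b ≡ r
    *1+*0 r s refl refl = trans (cong₂ _+_ (*-identityʳ r) (*-zeroʳ s)) (+-identityʳ r)

    *0+*1 : ∀ r s {a b} → a ≡ 0 → b ≡ 1 → r * a + s * b ≡ s
    *0+*1 r s refl refl = cong₂ _+_ (*-zeroʳ r) (*-identityʳ s)

    outdeg-u-alternating : ∀ r s → outdeg u (alternating r s) ≡ r
    outdeg-u-alternating r s =
      trans (∑-alternating r s _) (*1+*0 r s (𝟙-refl _≟_ u) (𝟙-no (u ≟ v) u≢v))

    outdeg-v-alternating : ∀ r s → outdeg v (alternating r s) ≡ s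
    outdeg-v-alternating r s =
      trans (∑-alternating r s _) (*0+*1 r s (𝟙-no (v ≟ u) (u≢v ∘ sym)) (𝟙-refl _≟_ v))

    indeg-u-alternating : ∀ r s → indeg u (alternating r s) ≡ s
    indeg-u-alternating r s =
      trans (∑-alternating r s _) (*0+*1 r s (𝟙-no (u ≟ v) u≢v) (𝟙-refl _≟_ u))

    alternating-suc-↭ : ∀ r s → alternating r (suc s) ↭ vu ∷ alternating r s
    alternating-suc-↭ r s = Perm.shift vu (replicate r uv) (replicate s vu)

    source-v⇒vu : ∀ r s → All (λ e → v ≡ source e → e ≡ vu) (alternating r s)
    source-v⇒vu r s =
      Allₚ.++⁺ (Allₚ.replicate⁺ r (λ v≡u → ⊥-elim (u≢v (sym v≡u)))) (Allₚ.replicate⁺ s (λ _ → refl))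

    tours-uv-alternating : ∀ r s → tours (uv ∷ alternating r (suc s)) ≡ suc s * tours (uu ∷ alternating r s)
    tours-uv-alternating r s = begin
      tours (uv ∷ alternating r (suc s))
        ≡⟨ tours-↭ (prep uv (alternating-suc-↭ r s)) ⟩
      tours (uv ∷ L)
        ≡⟨ tours-merge u v vu (alternating r s) ⟩
      ∑[ y , L′ ∈ picks L ] (𝟙 (v ≟ source y) * tours ((u , target y) ∷ L′))
        ≡⟨ ∑-picks-cong L (λ {y} L↭yL′ → 𝟙-guard (v ≟ source y) (merged L↭yL′)) ⟩
      ∑[ y , _ ∈ picks L ] (𝟙 (v ≟ source y) * tours (uu ∷ alternating r s))
        ≡⟨ ∑-picks-proj₁ L _ ⟩
      ∑[ y ∈ L ] (𝟙 (v ≟ source y) * tours (uu ∷ alternating r s))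
        ≡⟨ ∑-*ʳ L (tours (uu ∷ alternating r s)) (λ y → 𝟙 (v ≟ source y)) ⟩
      outdeg v L * tours (uu ∷ alternating r s)
        ≡⟨ cong (_* tours (uu ∷ alternating r s)) (cong₂ _+_ (𝟙-refl _≟_ v) (outdeg-v-alternating r s)) ⟩
      suc s * tours (uu ∷ alternating r s) ∎
      where
      L = vu ∷ alternating r s
      merged : ∀ {y L′} → L ↭ y ∷ L′ → v ≡ source y → tours ((u , target y) ∷ L′) ≡ tours (uu ∷ alternating r s)
      merged L↭yL′ v≡source with y∈L ← Perm.∈-resp-↭ (↭-sym L↭yL′) (here refl)
        with refl ← All.lookup ((λ _ → refl) ∷ source-v⇒vu r s) y∈L v≡source =
        tours-↭ (prep uu (↭-sym (Perm.drop-∷ L↭yL′)))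

    tours-alternating : ∀ r → tours (alternating (suc r) (suc r)) ≡ suc r ! * r !
    tours-alternating zero = trans (tours-uv-alternating 0 0) (trans (+-identityʳ _) (tours-loops u 0))
    tours-alternating (suc r) = begin
      tours (alternating (2 + r) (2 + r))
        ≡⟨ tours-uv-alternating (suc r) (suc r) ⟩
      (2 + r) * tours (uu ∷ alternating (suc r) (suc r))
        ≡⟨ cong ((2 + r) *_) (tours-loop u uv (alternating r (suc r))) ⟩
      (2 + r) * (outdeg u (alternating (suc r) (suc r)) * tours (alternating (suc r) (suc r)))
        ≡⟨ cong ((2 + r) *_) (cong₂ _*_ (outdeg-u-alternating (suc r) (suc r)) (tours-alternating r)) ⟩
      (2 + r) * (suc r * (suc r ! * r !))
        ≡⟨ regroup (2 + r) (suc r) (suc r !) (r !) ⟩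
      (2 + r) ! * suc r ! ∎
      where
      regroup : ∀ a b c d → a * (b * (c * d)) ≡ (a * c) * (b * d)
      regroup = solve-∀

    tours-loops-alternating : ∀ r → tours (uu ∷ vv ∷ alternating r r) ≡ r * (r ! * r !)
    tours-loops-alternating zero =
      trans (tours-loop u vv []) (cong (λ d → (d + 0) * tours (vv ∷ [])) (𝟙-no (u ≟ v) u≢v))
    tours-loops-alternating (suc r) = begin
      tours (uu ∷ vv ∷ L)
        ≡⟨ tours-loop u vv L ⟩
      (𝟙 (u ≟ v) + outdeg u L) * tours (vv ∷ L)
        ≡⟨ cong₂ _*_ (cong₂ _+_ (𝟙-no (u ≟ v) u≢v) (outdeg-u-alternating (suc r) (suc r)))
             (tours-loop v uv (alternating r (suc r))) ⟩
      suc r * (outdeg v L * tours L)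
        ≡⟨ cong (suc r *_) (cong₂ _*_ (outdeg-v-alternating (suc r) (suc r)) (tours-alternating r)) ⟩
      suc r * (suc r * (suc r ! * r !))
        ≡⟨ cong (suc r *_) (x∙yz≈y∙xz *-commutativeSemigroup (suc r) (suc r !) (r !)) ⟩
      suc r * (suc r ! * suc r !) ∎
      where L = alternating (suc r) (suc r)

    Within : Edge V → Set ℓ
    Within e = IsUV (source e) × IsUV (target e)

    contractEdges-within : ∀ {L} → All Within L → contractEdges L ≡ replicate (length L) uu
    contractEdges-within []                 = refl
    contractEdges-within ((s , t) ∷ within) =
      cong₂ _∷_ (cong₂ _,_ (contract-uv s) (contract-uv t)) (contractEdges-within within)

    tours-contract-alternating : ∀ r → tours (uu ∷ uu ∷ contractEdges (alternating r r)) ≡ suc (r + r) !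
    tours-contract-alternating r = begin
      tours (uu ∷ uu ∷ contractEdges (alternating r r))
        ≡⟨ cong (λ M → tours (uu ∷ uu ∷ M)) (contractEdges-within
             (Allₚ.++⁺ (Allₚ.replicate⁺ r (inj₁ refl , inj₂ refl)) (Allₚ.replicate⁺ r (inj₂ refl , inj₁ refl)))) ⟩
      tours (replicate (2 + length (alternating r r)) uu)
        ≡⟨ tours-loops u (suc (length (alternating r r))) ⟩
      suc (length (alternating r r)) !
        ≡⟨ cong (λ n → suc n !)
             (trans (length-++ (replicate r uv)) (cong₂ _+_ (length-replicate r) (length-replicate r))) ⟩
      suc (r + r) ! ∎

    ContractionIdentity : ℕ → ℕ → List (Edge V) → Set
    ContractionIdentity s t L =
      s * tours (uv ∷ vu ∷ L) ≡ s * tours (uu ∷ vv ∷ L) + t * tours (uu ∷ uu ∷ contractEdges L)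

    -- By the BEST theorem a balanced digraph has τ · Π (deg − 1)! tours, where τ
    -- counts spanning trees, and τ(G + uv) − τ(G) = τ(G / uv).
    Contracts : List (Edge V) → Set
    Contracts L = ContractionIdentity (suc (outdeg u L + outdeg v L) !) (outdeg u L ! * outdeg v L !) L

    contracts : ∀ {i j} L → outdeg u L ≡ i → outdeg v L ≡ j →
      ContractionIdentity (suc (i + j) !) (i ! * j !) L → Contracts L
    contracts L refl refl identity = identity

    contracts-resp-↭ : ∀ {L M} → L ↭ M → Contracts L → Contracts M
    contracts-resp-↭ {L} {M} L↭M identity = contracts M (sym (outdeg-↭ u L↭M)) (sym (outdeg-↭ v L↭M))
      (subst₂ (λ s t → suc (outdeg u L + outdeg v L) ! * s ≡ t) (tours-↭ (prep uv (prep vu L↭M)))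
        (cong₂ (λ s t → suc (outdeg u L + outdeg v L) ! * s + outdeg u L ! * outdeg v L ! * t)
          (tours-↭ (prep uu (prep vv L↭M))) (tours-↭ (prep uu (prep uu (Perm.map⁺ (mapEdge contract) L↭M)))))
        identity)

    contracts-alternating : ∀ r → Contracts (alternating r r)
    contracts-alternating r = contracts L (outdeg-u-alternating r r) (outdeg-v-alternating r r) (begin
      suc (r + r) ! * tours (uv ∷ vu ∷ L)
        ≡⟨ cong (suc (r + r) ! *_) (trans (tours-↭ (prep uv (↭-sym (alternating-suc-↭ r r)))) (tours-alternating r)) ⟩
      suc (r + r) ! * (suc r ! * r !)
        ≡⟨ regroup (suc (r + r) !) r (r !) ⟩
      suc (r + r) ! * (r * (r ! * r !)) + r ! * r ! * suc (r + r) !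
        ≡⟨ cong₂ (λ s t → suc (r + r) ! * s + r ! * r ! * t)
             (tours-loops-alternating r) (tours-contract-alternating r) ⟨
      suc (r + r) ! * tours (uu ∷ vv ∷ L) + r ! * r ! * tours (uu ∷ uu ∷ contractEdges L) ∎)
      where
      L = alternating r r
      regroup : ∀ k r f → k * (suc r * f * f) ≡ k * (r * (f * f)) + f * f * k
      regroup = solve-∀

    outdeg-contract : ∀ L → outdeg u (contractEdges L) ≡ outdeg u L + outdeg v L
    outdeg-contract L = begin
      outdeg u (contractEdges L)                          ≡⟨ ∑-map (mapEdge contract) L _ ⟩
      ∑[ e ∈ L ] 𝟙 (u ≟ contract (source e))              ≡⟨ ∑-cong L (λ e → contracted (source e)) ⟩
      ∑[ e ∈ L ] (𝟙 (u ≟ source e) + 𝟙 (v ≟ source e))    ≡⟨ ∑-+ L _ _ ⟩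
      outdeg u L + outdeg v L                             ∎
      where
      contracted : ∀ x → 𝟙 (u ≟ contract x) ≡ 𝟙 (u ≟ x) + 𝟙 (v ≟ x)
      contracted x = trans (𝟙-⇔ (mk⇔ to from) (u ≟ contract x) (isUV? x)) (sym (𝟙-isUV x))
        where
        to : u ≡ contract x → IsUV x
        to u≡cx with isUV? x
        ... | yes uv = uv
        ... | no ¬uv = inj₁ (trans u≡cx (contract-other ¬uv))
        from : IsUV x → u ≡ contract x
        from = sym ∘ contract-uv

    outdeg-endpoints : ∀ {w} → IsUV w → ∀ x y L → outdeg w ((u , x) ∷ (v , y) ∷ L) ≡ suc (outdeg w L)
    outdeg-endpoints (inj₁ refl) x y L =
      cong₂ (λ a b → a + (b + outdeg u L)) (𝟙-refl _≟_ u) (𝟙-no (u ≟ v) u≢v)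
    outdeg-endpoints (inj₂ refl) x y L =
      cong₂ (λ a b → a + (b + outdeg v L)) (𝟙-no (v ≟ u) (u≢v ∘ sym)) (𝟙-refl _≟_ v)

    tours-endpoints-loop : ∀ {w} → IsUV w → ∀ x y L →
      tours ((u , x) ∷ (v , y) ∷ (w , w) ∷ L) ≡ suc (outdeg w L) * tours ((u , x) ∷ (v , y) ∷ L)
    tours-endpoints-loop {w} w∈uv x y L = trans (tours-insert-loop w (u , x) (v , y) L)
      (cong (_* tours ((u , x) ∷ (v , y) ∷ L)) (outdeg-endpoints w∈uv x y L))

    tours-contract-loop : ∀ {w} → IsUV w → ∀ L → tours (uu ∷ uu ∷ contractEdges ((w , w) ∷ L)) ≡
      suc (suc (outdeg u L + outdeg v L)) * tours (uu ∷ uu ∷ contractEdges L)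
    tours-contract-loop {w} w∈uv L = begin
      tours (uu ∷ uu ∷ (contract w , contract w) ∷ cL)
        ≡⟨ cong (λ x → tours (uu ∷ uu ∷ (x , x) ∷ cL)) (contract-uv w∈uv) ⟩
      tours (uu ∷ uu ∷ uu ∷ cL)
        ≡⟨ tours-loop u uu (uu ∷ cL) ⟩
      (𝟙 (u ≟ u) + (𝟙 (u ≟ u) + outdeg u cL)) * tours (uu ∷ uu ∷ cL)
        ≡⟨ cong (_* tours (uu ∷ uu ∷ cL)) (cong₂ (λ a d → a + (a + d)) (𝟙-refl _≟_ u) (outdeg-contract L)) ⟩
      suc (suc (outdeg u L + outdeg v L)) * tours (uu ∷ uu ∷ cL) ∎
      where cL = contractEdges L

    contraction-identity-loop : ∀ {w} → IsUV w → ∀ L → let i = outdeg u L ; j = outdeg v L in Contracts L →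
      ContractionIdentity (suc (suc (i + j)) !) (suc (outdeg w L) * (i ! * j !)) ((w , w) ∷ L)
    contraction-identity-loop {w} w∈uv L identity = begin
      suc total * total ! * tours (uv ∷ vu ∷ (w , w) ∷ L)
        ≡⟨ cong (suc total * total ! *_) (tours-endpoints-loop w∈uv v u L) ⟩
      suc total * total ! * (visits * tours (uv ∷ vu ∷ L))
        ≡⟨ regroup (suc total) (total !) visits (tours (uv ∷ vu ∷ L)) ⟩
      suc total * visits * (total ! * tours (uv ∷ vu ∷ L))
        ≡⟨ cong (suc total * visits *_) identity ⟩
      suc total * visits * (total ! * tours (uu ∷ vv ∷ L) + product * tours (uu ∷ uu ∷ contractEdges L))
        ≡⟨ distribute (suc total) (total !) visits product (tours (uu ∷ vv ∷ L)) (tours (uu ∷ uu ∷ contractEdges L)) ⟩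
      suc total * total ! * (visits * tours (uu ∷ vv ∷ L))
        + visits * product * (suc total * tours (uu ∷ uu ∷ contractEdges L))
        ≡⟨ cong₂ (λ s t → suc total * total ! * s + visits * product * t)
             (tours-endpoints-loop w∈uv u v L) (tours-contract-loop w∈uv L) ⟨
      suc total * total ! * tours (uu ∷ vv ∷ (w , w) ∷ L)
        + visits * product * tours (uu ∷ uu ∷ contractEdges ((w , w) ∷ L)) ∎
      where
      total   = suc (outdeg u L + outdeg v L)
      product = outdeg u L ! * outdeg v L !
      visits  = suc (outdeg w L)
      regroup : ∀ a b c x → a * b * (c * x) ≡ a * c * (b * x)
      regroup = solve-∀
      distribute : ∀ a b c d x y → a * c * (b * x + d * y) ≡ a * b * (c * x) + c * d * (a * y)
      distribute = solve-∀

    contracts-loop : ∀ {w} → IsUV w → ∀ L → Contracts L → Contracts ((w , w) ∷ L)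
    contracts-loop (inj₁ refl) L identity = contracts (uu ∷ L)
      (cong (_+ outdeg u L) (𝟙-refl _≟_ u)) (cong (_+ outdeg v L) (𝟙-no (v ≟ u) (u≢v ∘ sym)))
      (subst (λ t → ContractionIdentity (suc (suc (outdeg u L + outdeg v L)) !) t (uu ∷ L))
        (sym (*-assoc (suc (outdeg u L)) (outdeg u L !) (outdeg v L !)))
        (contraction-identity-loop (inj₁ refl) L identity))
    contracts-loop (inj₂ refl) L identity = contracts (vv ∷ L)
      (cong (_+ outdeg u L) (𝟙-no (u ≟ v) u≢v)) (cong (_+ outdeg v L) (𝟙-refl _≟_ v))
      (subst₂ (λ s t → ContractionIdentity (suc s !) t (vv ∷ L))
        (sym (+-suc (outdeg u L) (outdeg v L)))
        (x∙yz≈y∙xz *-commutativeSemigroup (suc (outdeg v L)) (outdeg u L !) (outdeg v L !))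
        (contraction-identity-loop (inj₂ refl) L identity))

    contracts-within : ∀ {L} r s → All Within L → Balanced u (L ++ alternating r s) → Contracts (L ++ alternating r s)
    contracts-within r s [] balanced
      with refl ← trans (sym (outdeg-u-alternating r s)) (trans balanced (indeg-u-alternating r s)) =
      contracts-alternating r
    contracts-within {_ ∷ L} r s ((inj₁ refl , inj₁ refl) ∷ within) balanced =
      contracts-loop (inj₁ refl) (L ++ alternating r s)
        (contracts-within r s within (balanced-drop-loop u u (L ++ alternating r s) balanced))
    contracts-within {_ ∷ L} r s ((inj₂ refl , inj₂ refl) ∷ within) balanced =
      contracts-loop (inj₂ refl) (L ++ alternating r s)
        (contracts-within r s within (balanced-drop-loop u v (L ++ alternating r s) balanced))
    contracts-within {_ ∷ L} r s ((inj₁ refl , inj₂ refl) ∷ within) balanced =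
      contracts-resp-↭ uv↭ (contracts-within (suc r) s within (balanced-resp-↭ u (↭-sym uv↭) balanced))
      where
      uv↭ : L ++ alternating (suc r) s ↭ uv ∷ L ++ alternating r s
      uv↭ = Perm.shift uv L (alternating r s)
    contracts-within {_ ∷ L} r s ((inj₂ refl , inj₁ refl) ∷ within) balanced =
      contracts-resp-↭ vu↭ (contracts-within r (suc s) within (balanced-resp-↭ u (↭-sym vu↭) balanced))
      where
      vu↭ : L ++ alternating r (suc s) ↭ vu ∷ L ++ alternating r s
      vu↭ = ↭-trans (Perm.++⁺ˡ L (alternating-suc-↭ r s)) (Perm.shift vu L (alternating r s))

    module _ {b : V} (b∉uv : ¬ IsUV b) where

      private
        b≢u : b ≢ u
        b≢u = b∉uv ∘ inj₁ ∘ sym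
        b≢v : b ≢ v
        b≢v = b∉uv ∘ inj₂ ∘ sym

      𝟙-contract : ∀ x → 𝟙 (b ≟ contract x) ≡ 𝟙 (b ≟ x)
      𝟙-contract x with isUV? x
      ... | yes x∈uv = trans (𝟙-no (b ≟ contract x) (λ b≡cx → b≢u (trans b≡cx (contract-uv x∈uv))))
                             (sym (𝟙-no (b ≟ x) λ { refl → b∉uv x∈uv }))
      ... | no x∉uv  = cong (λ y → 𝟙 (b ≟ y)) (contract-other x∉uv)

      tours-contract-merge : ∀ a L → tours (uu ∷ uu ∷ contractEdges ((a , b) ∷ L)) ≡
        ∑[ y , L′ ∈ picks L ] (𝟙 (b ≟ source y) * tours (uu ∷ uu ∷ contractEdges ((a , target y) ∷ L′)))
      tours-contract-merge a L = begin
        tours (uu ∷ uu ∷ (contract a , contract b) ∷ contractEdges L)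
          ≡⟨ cong (λ x → tours (uu ∷ uu ∷ (contract a , x) ∷ contractEdges L)) (contract-other b∉uv) ⟩
        tours (uu ∷ uu ∷ (contract a , b) ∷ contractEdges L)
          ≡⟨ tours-merge-third uu uu (contract a) b (contractEdges L) b≢u b≢u ⟩
        ∑[ y , L′ ∈ picks (contractEdges L) ] (𝟙 (b ≟ source y) * tours (uu ∷ uu ∷ (contract a , target y) ∷ L′))
          ≡⟨ ∑-picks-map (mapEdge contract) L _ ⟩
        ∑[ y , L′ ∈ picks L ] (𝟙 (b ≟ contract (source y)) * tours (uu ∷ uu ∷ contractEdges ((a , target y) ∷ L′)))
          ≡⟨ ∑-cong (picks L) (λ (y , L′) →
               cong (_* tours (uu ∷ uu ∷ contractEdges ((a , target y) ∷ L′))) (𝟙-contract (source y))) ⟩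
        ∑[ y , L′ ∈ picks L ] (𝟙 (b ≟ source y) * tours (uu ∷ uu ∷ contractEdges ((a , target y) ∷ L′))) ∎

      contracts-merge : ∀ a L → (∀ {c L′} → L ↭ (b , c) ∷ L′ → Contracts ((a , c) ∷ L′)) → Contracts ((a , b) ∷ L)
      contracts-merge a L merged-contracts = begin
        total ! * tours (uv ∷ vu ∷ (a , b) ∷ L)
          ≡⟨ cong (total ! *_) (tours-merge-third uv vu a b L b≢u b≢v) ⟩
        total ! * (∑[ y , L′ ∈ picks L ] (δ y * bridged y L′))
          ≡⟨ ∑-*ˡ (picks L) (total !) _ ⟨
        ∑[ y , L′ ∈ picks L ] (total ! * (δ y * bridged y L′))
          ≡⟨ ∑-cong (picks L) (λ (y , L′) → x∙yz≈y∙xz *-commutativeSemigroup (total !) (δ y) (bridged y L′)) ⟩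
        ∑[ y , L′ ∈ picks L ] (δ y * (total ! * bridged y L′))
          ≡⟨ ∑-picks-cong L (λ {y} L↭yL′ → 𝟙-guard (b ≟ source y) (λ { refl → merged-identity L↭yL′ })) ⟩
        ∑[ y , L′ ∈ picks L ] (δ y * (total ! * looped y L′ + product * contracted y L′))
          ≡⟨ ∑-linear (picks L) (total !) product (δ ∘ proj₁) _ _ ⟩
        total ! * (∑[ y , L′ ∈ picks L ] (δ y * looped y L′)) + product * (∑[ y , L′ ∈ picks L ] (δ y * contracted y L′))
          ≡⟨ cong₂ (λ s t → total ! * s + product * t)
               (tours-merge-third uu vv a b L b≢u b≢v) (tours-contract-merge a L) ⟨
        total ! * tours (uu ∷ vv ∷ (a , b) ∷ L) + product * tours (uu ∷ uu ∷ contractEdges ((a , b) ∷ L)) ∎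
        where
        total   = suc (outdeg u ((a , b) ∷ L) + outdeg v ((a , b) ∷ L))
        product = outdeg u ((a , b) ∷ L) ! * outdeg v ((a , b) ∷ L) !
        δ : Edge V → ℕ
        δ y = 𝟙 (b ≟ source y)
        bridged looped contracted : Edge V → List (Edge V) → ℕ
        bridged y L′    = tours (uv ∷ vu ∷ (a , target y) ∷ L′)
        looped y L′     = tours (uu ∷ vv ∷ (a , target y) ∷ L′)
        contracted y L′ = tours (uu ∷ uu ∷ contractEdges ((a , target y) ∷ L′))
        merged-identity : ∀ {c L′} → L ↭ (b , c) ∷ L′ → ContractionIdentity (total !) product ((a , c) ∷ L′)
        merged-identity {c} {L′} L↭bcL′ =
          subst₂ (λ i j → ContractionIdentity (suc (i + j) !) (i ! * j !) ((a , c) ∷ L′))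
            (sym (trans (outdeg-↭ u (prep (a , b) L↭bcL′)) (outdeg-merge u a b c L′ b≢u)))
            (sym (trans (outdeg-↭ v (prep (a , b) L↭bcL′)) (outdeg-merge v a b c L′ b≢v)))
            (merged-contracts L↭bcL′)

    count-isUV : ∀ (end : Edge V → V) L →
      (∑[ e ∈ L ] 𝟙 (u ≟ end e)) + (∑[ e ∈ L ] 𝟙 (v ≟ end e)) ≡ length (filter (isUV? ∘ end) L)
    count-isUV end L = begin
      (∑[ e ∈ L ] 𝟙 (u ≟ end e)) + (∑[ e ∈ L ] 𝟙 (v ≟ end e))   ≡⟨ ∑-+ L _ _ ⟨
      ∑[ e ∈ L ] (𝟙 (u ≟ end e) + 𝟙 (v ≟ end e))                ≡⟨ ∑-cong L (𝟙-isUV ∘ end) ⟩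
      ∑[ e ∈ L ] 𝟙 (isUV? (end e))                              ≡⟨ ∑-𝟙 (isUV? ∘ end) L ⟩
      length (filter (isUV? ∘ end) L)                           ∎

    targets-within⇒within : ∀ {L} → Balanced u L → Balanced v L → All (IsUV ∘ target) L → All Within L
    targets-within⇒within {L} balanced-u balanced-v targets = All.zip (sources , targets)
      where
      sources : All (IsUV ∘ source) L
      sources = subst (All (IsUV ∘ source)) (filter-complete (isUV? ∘ source) (begin
        length (filter (isUV? ∘ source) L)     ≡⟨ count-isUV source L ⟨
        outdeg u L + outdeg v L                ≡⟨ cong₂ _+_ balanced-u balanced-v ⟩
        indeg u L + indeg v L                  ≡⟨ count-isUV target L ⟩
        length (filter (isUV? ∘ target) L)     ≡⟨ cong length (filter-all (isUV? ∘ target) targets) ⟩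
        length L                               ∎)) (Allₚ.all-filter (isUV? ∘ source) L)

    -- Edges pointing to other vertices are merged with their successors until only
    -- the vertices u and v are left.
    contraction : ∀ L → Balanced u L → Balanced v L → Contracts L
    contraction L = by-length (length L) L refl
      where
      by-length : ∀ k L → length L ≡ k → Balanced u L → Balanced v L → Contracts L
      by-length k L ∣L∣≡k balanced-u balanced-v with All.all? (isUV? ∘ target) L
      ... | yes targets = subst Contracts (++-identityʳ L) (contracts-within 0 0
              (targets-within⇒within balanced-u balanced-v targets)
              (subst (Balanced u) (sym (++-identityʳ L)) balanced-u))
      by-length zero    []        _       _          _          | no ¬targets = ⊥-elim (¬targets [])
      by-length (suc k) L@(_ ∷ _) ∣L∣≡1+k balanced-u balanced-v | no ¬targets
        with (a , b) , e∈L , b∉uv ← find (Allₚ.¬All⇒Any¬ (isUV? ∘ target) L ¬targets)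
        with M , L↭abM ← ∈-remove e∈L =
        contracts-resp-↭ (↭-sym L↭abM) (contracts-merge b∉uv a M (λ {c} {M′} M↭bcM′ →
          let L↭abbcM′ = ↭-trans L↭abM (prep (a , b) M↭bcM′) in
          by-length k ((a , c) ∷ M′) (suc-injective (trans (sym (Perm.↭-length L↭abbcM′)) ∣L∣≡1+k))
            (balanced-merge u a b c M′ (b∉uv ∘ inj₁ ∘ sym) (balanced-resp-↭ u L↭abbcM′ balanced-u))
            (balanced-merge v a b c M′ (b∉uv ∘ inj₂ ∘ sym) (balanced-resp-↭ v L↭abbcM′ balanced-v))))

tours-relabel : {V : Set ℓ₁} {W : Set ℓ₂} (_≟ⱽ_ : DecidableEquality V) (_≟ᵂ_ : DecidableEquality W)
  (f : V → W) → Injective _≡_ _≡_ f → ∀ L →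
  EulerianTours.tours _≟ᵂ_ (map (mapEdge f) L) ≡ EulerianTours.tours _≟ⱽ_ L
tours-relabel _≟ⱽ_ _≟ᵂ_ f f-injective =
  circuits-map (EulerianTours.consecutive? _≟ⱽ_) (EulerianTours.consecutive? _≟ᵂ_) (mapEdge f)
    (λ _ _ → mk⇔ (cong f) f-injective)

-- Colourings

open module FinTours {q : ℕ} = EulerianTours (_≟_ {q})

edge : (Fin n → Fin n) → Vec (Fin q) n → Fin n → Edge (Fin q)
edge π f x = lookup f (π x) , lookup f x

edges : (Fin n → Fin n) → Vec (Fin q) n → List (Edge (Fin q))
edges π f = List.tabulate (edge π f)

edges-balanced : (π : Fin n → Fin n) → Injective _≡_ _≡_ π → (f : Vec (Fin q) n) (w : Fin q) →
  Balanced w (edges π f)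
edges-balanced π π-injective f w = begin
  outdeg w (edges π f)                        ≡⟨ ∑-tabulate (edge π f) (λ e → 𝟙 (w ≟ source e)) ⟩
  ∑[ x ∈ allFin _ ] 𝟙 (w ≟ lookup f (π x))    ≡⟨ ∑-allFin-reindex π π-injective (λ x → 𝟙 (w ≟ lookup f x)) ⟩
  ∑[ x ∈ allFin _ ] 𝟙 (w ≟ lookup f x)        ≡⟨ ∑-tabulate (edge π f) (λ e → 𝟙 (w ≟ target e)) ⟨
  indeg w (edges π f)                         ∎

edges-map : ∀ {p} (h : Fin q → Fin p) (π : Fin n → Fin n) (f : Vec (Fin q) n) →
  edges π (Vec.map h f) ≡ map (mapEdge h) (edges π f)
edges-map h π f = trans
  (tabulate-cong (λ x → cong₂ _,_ (lookup-map (π x) h f) (lookup-map x h f)))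
  (sym (map-tabulate (edge π f) (mapEdge h)))

multiplicity : Fin q → Vec (Fin q) n → ℕ
multiplicity w []      = 0
multiplicity w (x ∷ f) = 𝟙 (w ≟ x) + multiplicity w f

indeg-tabulate : (w : Fin q) (f : Vec (Fin q) n) (g : Fin n → Fin q) →
  indeg w (List.tabulate (λ x → g x , lookup f x)) ≡ multiplicity w f
indeg-tabulate w []      g = refl
indeg-tabulate w (x ∷ f) g = cong (𝟙 (w ≟ x) +_) (indeg-tabulate w f (g ∘ suc))

-- Colourings with a given contraction

module Fibre {q : ℕ} (v : Fin (suc q)) (u′ : Fin q) where

  u : Fin (suc q)
  u = punchIn v u′

  u≢v : u ≢ v
  u≢v = punchInᵢ≢i v u′

  open Contraction u v u≢v

  preimages : Fin q → List (Fin (suc q))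
  preimages z = if does (z ≟ u′) then u ∷ v ∷ [] else punchIn v z ∷ []

  fibre : Vec (Fin q) m → List (Vec (Fin (suc q)) m)
  fibre []      = [] ∷ []
  fibre (z ∷ g) = concatMap (λ x → map (x ∷_) (fibre g)) (preimages z)

  ∑-preimages : (φ : Fin (suc q) → ℕ) (z : Fin q) → ∑ (preimages z) φ ≡ φ (punchIn v z) + 𝟙 (z ≟ u′) * φ v
  ∑-preimages φ z with z ≟ u′
  ... | yes refl = refl
  ... | no _     = refl

  ∑-preimages-u′ : (φ : Fin (suc q) → ℕ) → ∑ (preimages u′) φ ≡ φ u + φ v
  ∑-preimages-u′ φ = trans (∑-preimages φ u′)
    (cong (φ u +_) (trans (cong (_* φ v) (𝟙-refl _≟_ u′)) (*-identityˡ (φ v))))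

  ∑-preimages-other : (φ : Fin (suc q) → ℕ) → ∀ {z} → z ≢ u′ → ∑ (preimages z) φ ≡ φ (punchIn v z)
  ∑-preimages-other φ {z} z≢u′ = trans (∑-preimages φ z)
    (trans (cong (λ k → φ (punchIn v z) + k * φ v) (𝟙-no (z ≟ u′) z≢u′)) (+-identityʳ _))

  ∑-all-preimages : (φ : Fin (suc q) → ℕ) → ∑ (allFin (suc q)) φ ≡ ∑[ z ∈ allFin q ] ∑ (preimages z) φ
  ∑-all-preimages φ = begin
    ∑ (allFin (suc q)) φ
      ≡⟨ trans (∑-punchIn v φ) (+-comm (φ v) _) ⟩
    (∑[ z ∈ allFin q ] φ (punchIn v z)) + φ v
      ≡⟨ cong ((∑[ z ∈ allFin q ] φ (punchIn v z)) +_) (∑-δ u′ (λ _ → φ v)) ⟨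
    (∑[ z ∈ allFin q ] φ (punchIn v z)) + (∑[ z ∈ allFin q ] (𝟙 (z ≟ u′) * φ v))
      ≡⟨ ∑-+ (allFin q) _ _ ⟨
    ∑[ z ∈ allFin q ] (φ (punchIn v z) + 𝟙 (z ≟ u′) * φ v)
      ≡⟨ ∑-cong (allFin q) (∑-preimages φ) ⟨
    ∑[ z ∈ allFin q ] ∑ (preimages z) φ ∎

  ∑-fibre-∷ : (z : Fin q) (g : Vec (Fin q) m) (φ : Vec (Fin (suc q)) (suc m) → ℕ) →
    ∑ (fibre (z ∷ g)) φ ≡ ∑[ x ∈ preimages z ] ∑[ f ∈ fibre g ] φ (x ∷ f)
  ∑-fibre-∷ z g φ = trans (∑-concatMap _ (preimages z) φ) (∑-cong (preimages z) (λ x → ∑-map (x ∷_) (fibre g) φ))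

  ∑-fibres : ∀ m (φ : Vec (Fin (suc q)) m → ℕ) → ∑ (allVecs (suc q) m) φ ≡ ∑[ g ∈ allVecs q m ] ∑ (fibre g) φ
  ∑-fibres zero    φ = sym (+-identityʳ _)
  ∑-fibres (suc m) φ = begin
    ∑ (allVecs (suc q) (suc m)) φ
      ≡⟨ ∑-allVecs-∷ (suc q) m φ ⟩
    ∑[ x ∈ allFin (suc q) ] ∑[ f ∈ allVecs (suc q) m ] φ (x ∷ f)
      ≡⟨ ∑-all-preimages _ ⟩
    ∑[ z ∈ allFin q ] ∑[ x ∈ preimages z ] ∑[ f ∈ allVecs (suc q) m ] φ (x ∷ f)
      ≡⟨ ∑-cong (allFin q) (λ z → ∑-cong (preimages z) (λ x → ∑-fibres m (φ ∘ (x ∷_)))) ⟩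
    ∑[ z ∈ allFin q ] ∑[ x ∈ preimages z ] ∑[ g ∈ allVecs q m ] ∑[ f ∈ fibre g ] φ (x ∷ f)
      ≡⟨ ∑-cong (allFin q) (λ z → ∑-swap (preimages z) (allVecs q m) _) ⟩
    ∑[ z ∈ allFin q ] ∑[ g ∈ allVecs q m ] ∑[ x ∈ preimages z ] ∑[ f ∈ fibre g ] φ (x ∷ f)
      ≡⟨ ∑-cong (allFin q) (λ z → ∑-cong (allVecs q m) (λ g → ∑-fibre-∷ z g φ)) ⟨
    ∑[ z ∈ allFin q ] ∑[ g ∈ allVecs q m ] ∑ (fibre (z ∷ g)) φ
      ≡⟨ ∑-allVecs-∷ q m _ ⟨
    ∑[ g ∈ allVecs q (suc m) ] ∑ (fibre g) φ ∎

  other∉uv : ∀ {z} → z ≢ u′ → ¬ IsUV (punchIn v z)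
  other∉uv         z≢u′ (inj₁ u≡punchIn) = z≢u′ (sym (punchIn-injective v _ _ u≡punchIn))
  other∉uv {z = z} z≢u′ (inj₂ v≡punchIn) = punchInᵢ≢i v z (sym v≡punchIn)

  preimage-colour : ∀ {x} z → x ∈ preimages z → 𝟙 (u ≟ x) + 𝟙 (v ≟ x) ≡ 𝟙 (u′ ≟ z) × contract x ≡ punchIn v z
  preimage-colour {x} z x∈ = trans (𝟙-isUV x) (proj₁ (classified x∈)) , proj₂ (classified x∈)
    where
    classified : x ∈ preimages z → 𝟙 (isUV? x) ≡ 𝟙 (u′ ≟ z) × contract x ≡ punchIn v z
    classified x∈ with z ≟ u′
    classified (here refl) | no z≢u′ =
      trans (𝟙-no (isUV? x) (other∉uv z≢u′)) (sym (𝟙-no (u′ ≟ z) (z≢u′ ∘ sym))) , contract-other (other∉uv z≢u′)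
    ... | yes refl = trans (𝟙-yes (isUV? x) (endpoint x∈)) (sym (𝟙-refl _≟_ u′)) , contract-uv (endpoint x∈)
      where
      endpoint : ∀ {x} → x ∈ u ∷ v ∷ [] → IsUV x
      endpoint (here refl)         = inj₁ refl
      endpoint (there (here refl)) = inj₂ refl

  fibre-∈ : (g : Vec (Fin q) m) {f : Vec (Fin (suc q)) m} → f ∈ fibre g →
    multiplicity u f + multiplicity v f ≡ multiplicity u′ g × Vec.map contract f ≡ Vec.map (punchIn v) g
  fibre-∈ []      (here refl) = refl , refl
  fibre-∈ (z ∷ g) f∈
    with x , x∈ , p ← find (∈-concatMap⁻ (λ x → map (x ∷_) (fibre g)) {xs = preimages z} f∈)
    with f , f∈′ , refl ← ∈-map⁻ (x ∷_) p
    with mult-x , contract-x ← preimage-colour z x∈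
    with mult-f , contract-f ← fibre-∈ g f∈′ =
      trans (interchange +-commutativeSemigroup (𝟙 (u ≟ x)) _ (𝟙 (v ≟ x)) _) (cong₂ _+_ mult-x mult-f) ,
      cong₂ _∷_ contract-x contract-f

  factorials : ℕ → ℕ → Vec (Fin (suc q)) m → ℕ
  factorials i j f = (i + multiplicity u f) ! * (j + multiplicity v f) !

  factorials-∷ : ∀ i j x (f : Vec (Fin (suc q)) m) →
    factorials i j (x ∷ f) ≡ factorials (i + 𝟙 (u ≟ x)) (j + 𝟙 (v ≟ x)) f
  factorials-∷ i j x f = sym (cong₂ (λ a b → a ! * b !) (+-assoc i (𝟙 (u ≟ x)) _) (+-assoc j (𝟙 (v ≟ x)) _))

  ∑-factorials-∷ : ∀ i j {a b} x → 𝟙 (u ≟ x) ≡ a → 𝟙 (v ≟ x) ≡ b → (g : Vec (Fin q) m) →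
    ∑[ f ∈ fibre g ] factorials i j (x ∷ f) ≡ ∑ (fibre g) (factorials (i + a) (j + b))
  ∑-factorials-∷ i j x refl refl g = ∑-cong (fibre g) (factorials-∷ i j x)

  ∑-fibre-factorials-u′ : ∀ i j (g : Vec (Fin q) m) → ∑ (fibre (u′ ∷ g)) (factorials i j) ≡
    ∑ (fibre g) (factorials (suc i) j) + ∑ (fibre g) (factorials i (suc j))
  ∑-fibre-factorials-u′ i j g = trans (∑-fibre-∷ u′ g (factorials i j)) (trans (∑-preimages-u′ _) (cong₂ _+_
    (trans (∑-factorials-∷ i j u (𝟙-refl _≟_ u) (𝟙-no (v ≟ u) (u≢v ∘ sym)) g)
      (cong₂ (λ a b → ∑ (fibre g) (factorials a b)) (+-comm i 1) (+-identityʳ j)))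
    (trans (∑-factorials-∷ i j v (𝟙-no (u ≟ v) u≢v) (𝟙-refl _≟_ v) g)
      (cong₂ (λ a b → ∑ (fibre g) (factorials a b)) (+-identityʳ i) (+-comm j 1)))))

  ∑-fibre-factorials-other : ∀ i j {z} (g : Vec (Fin q) m) → z ≢ u′ →
    ∑ (fibre (z ∷ g)) (factorials i j) ≡ ∑ (fibre g) (factorials i j)
  ∑-fibre-factorials-other i j {z} g z≢u′ =
    trans (∑-fibre-∷ z g (factorials i j)) (trans (∑-preimages-other _ z≢u′)
      (trans (∑-factorials-∷ i j (punchIn v z)
        (𝟙-no (u ≟ _) (other∉uv z≢u′ ∘ inj₁)) (𝟙-no (v ≟ _) (other∉uv z≢u′ ∘ inj₂)) g)
        (cong₂ (λ a b → ∑ (fibre g) (factorials a b)) (+-identityʳ i) (+-identityʳ j))))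

  -- The Pólya urn: i! j! counts pairs of linear orders, and each new element
  -- coloured u or v can be inserted into the two orders in i + j + 2 ways.
  ∑-fibre-factorials : (i j : ℕ) (g : Vec (Fin q) m) →
    suc (i + j) ! * ∑ (fibre g) (factorials i j) ≡ i ! * j ! * (suc (i + j) + multiplicity u′ g) !
  ∑-fibre-factorials i j [] = begin
    suc (i + j) ! * ((i + 0) ! * (j + 0) ! + 0)
      ≡⟨ cong (suc (i + j) ! *_)
           (trans (+-identityʳ _) (cong₂ (λ a b → a ! * b !) (+-identityʳ i) (+-identityʳ j))) ⟩
    suc (i + j) ! * (i ! * j !)
      ≡⟨ *-comm (suc (i + j) !) _ ⟩
    i ! * j ! * suc (i + j) !
      ≡⟨ cong (λ k → i ! * j ! * k !) (+-identityʳ (suc (i + j))) ⟨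
    i ! * j ! * (suc (i + j) + 0) ! ∎
  ∑-fibre-factorials i j (z ∷ g) = by-colour (z ≟ u′)
    where
    total = suc (i + j)
    mult  = multiplicity u′ g

    regroup : ∀ i j a b c → (suc i * a) * b * c + a * (suc j * b) * c ≡ suc (suc (i + j)) * (a * b * c)
    regroup = solve-∀

    by-colour : Dec (z ≡ u′) →
      total ! * ∑ (fibre (z ∷ g)) (factorials i j) ≡ i ! * j ! * (total + (𝟙 (u′ ≟ z) + mult)) !
    by-colour (no z≢u′) = begin
      total ! * ∑ (fibre (z ∷ g)) (factorials i j)
        ≡⟨ cong (total ! *_) (∑-fibre-factorials-other i j g z≢u′) ⟩
      total ! * ∑ (fibre g) (factorials i j)
        ≡⟨ ∑-fibre-factorials i j g ⟩
      i ! * j ! * (total + mult) !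
        ≡⟨ cong (λ a → i ! * j ! * (total + (a + mult)) !) (𝟙-no (u′ ≟ z) (z≢u′ ∘ sym)) ⟨
      i ! * j ! * (total + (𝟙 (u′ ≟ z) + mult)) ! ∎
    by-colour (yes refl) = *-cancelˡ-≡ _ _ (suc total) (begin
      suc total * (total ! * ∑ (fibre (u′ ∷ g)) (factorials i j))
        ≡⟨ *-assoc (suc total) (total !) _ ⟨
      suc total ! * ∑ (fibre (u′ ∷ g)) (factorials i j)
        ≡⟨ cong (suc total ! *_) (∑-fibre-factorials-u′ i j g) ⟩
      suc total ! * (∑ (fibre g) (factorials (suc i) j) + ∑ (fibre g) (factorials i (suc j)))
        ≡⟨ *-distribˡ-+ (suc total !) _ _ ⟩
      suc total ! * ∑ (fibre g) (factorials (suc i) j) + suc total ! * ∑ (fibre g) (factorials i (suc j))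
        ≡⟨ cong₂ _+_ (∑-fibre-factorials (suc i) j g)
             (subst (λ a → suc a ! * ∑ (fibre g) (factorials i (suc j)) ≡ i ! * suc j ! * (suc a + mult) !)
               (+-suc i j) (∑-fibre-factorials i (suc j) g)) ⟩
      suc i ! * j ! * (suc total + mult) ! + i ! * suc j ! * (suc total + mult) !
        ≡⟨ regroup i j (i !) (j !) ((suc total + mult) !) ⟩
      suc total * (i ! * j ! * (suc total + mult) !)
        ≡⟨ cong (λ a → suc total * (i ! * j ! * a !))
             (trans (cong (λ a → total + (a + mult)) (𝟙-refl _≟_ u′)) (+-suc total mult)) ⟨
      suc total * (i ! * j ! * (total + (𝟙 (u′ ≟ u′) + mult)) !) ∎)

-- Multiplying by a transposition of fixed points

tourCount : (Fin n → Fin n) → ℕ → ℕ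
tourCount π q = ∑[ f ∈ allVecs q _ ] tours (edges π f)

tourCount₌ : (Fin n → Fin n) → Fin n → Fin n → ℕ → ℕ
tourCount₌ π a b q = ∑[ f ∈ allVecs q _ ] (𝟙 (lookup f a ≟ lookup f b) * tours (edges π f))

module FixedPair {m : ℕ} (π : Fin (2 + m) → Fin (2 + m)) (π-injective : Injective _≡_ _≡_ π)
  (π0≡0 : π zero ≡ zero) (π1≡1 : π (suc zero) ≡ suc zero) where

  τ : Fin (2 + m) → Fin (2 + m)
  τ = transpose zero (suc zero)

  τπ≡π : ∀ x → τ (π (suc (suc x))) ≡ π (suc (suc x))
  τπ≡π x with π (suc (suc x)) in πx≡
  ... | zero        with () ← π-injective (trans πx≡ (sym π0≡0))
  ... | suc zero    with () ← π-injective (trans πx≡ (sym π1≡1))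
  ... | suc (suc _) = refl

  otherEdges : Vec (Fin q) (2 + m) → List (Edge (Fin q))
  otherEdges f = List.tabulate (λ x → edge π f (suc (suc x)))

  edges-π : (x y : Fin q) (f : Vec (Fin q) m) →
    edges π (x ∷ y ∷ f) ≡ (x , x) ∷ (y , y) ∷ otherEdges (x ∷ y ∷ f)
  edges-π x y f = cong₂ (λ a b → (colour a , x) ∷ (colour b , y) ∷ otherEdges (x ∷ y ∷ f)) π0≡0 π1≡1
    where colour = lookup (x ∷ y ∷ f)

  edges-τπ : (x y : Fin q) (f : Vec (Fin q) m) →
    edges (τ ∘ π) (x ∷ y ∷ f) ≡ (y , x) ∷ (x , y) ∷ otherEdges (x ∷ y ∷ f)
  edges-τπ x y f = cong₂ _∷_ (cong (λ a → colour (τ a) , x) π0≡0)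
    (cong₂ _∷_ (cong (λ a → colour (τ a) , y) π1≡1)
      (tabulate-cong (λ z → cong (λ a → colour a , lookup f z) (τπ≡π z))))
    where colour = lookup (x ∷ y ∷ f)

  module _ {q : ℕ} (v : Fin (suc q)) (u′ : Fin q) where
    open Fibre v u′
    open Contraction u v u≢v

    tours-contract-colouring : (f : Vec (Fin (suc q)) m) (g : Vec (Fin q) m) →
      Vec.map contract f ≡ Vec.map (punchIn v) g →
      tours (uu ∷ uu ∷ contractEdges (otherEdges (u ∷ v ∷ f))) ≡ tours (edges π (u′ ∷ u′ ∷ g))
    tours-contract-colouring f g contract-f = begin
      tours (uu ∷ uu ∷ contractEdges (otherEdges (u ∷ v ∷ f)))
        ≡⟨ cong₂ (λ a b → tours ((a , a) ∷ (b , b) ∷ contractEdges (otherEdges (u ∷ v ∷ f))))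
             contract-u contract-v ⟨
      tours (contractEdges (uu ∷ vv ∷ otherEdges (u ∷ v ∷ f)))
        ≡⟨ cong (tours ∘ contractEdges) (edges-π u v f) ⟨
      tours (contractEdges (edges π (u ∷ v ∷ f)))
        ≡⟨ cong tours (edges-map contract π (u ∷ v ∷ f)) ⟨
      tours (edges π (contract u ∷ contract v ∷ Vec.map contract f))
        ≡⟨ cong (tours ∘ edges π) (cong₂ _∷_ contract-u (cong₂ _∷_ contract-v contract-f)) ⟩
      tours (edges π (Vec.map (punchIn v) (u′ ∷ u′ ∷ g)))
        ≡⟨ cong tours (edges-map (punchIn v) π (u′ ∷ u′ ∷ g)) ⟩
      tours (map (mapEdge (punchIn v)) (edges π (u′ ∷ u′ ∷ g)))
        ≡⟨ tours-relabel _≟_ _≟_ (punchIn v) (punchIn-injective v _ _) (edges π (u′ ∷ u′ ∷ g)) ⟩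
      tours (edges π (u′ ∷ u′ ∷ g)) ∎
      where
      contract-u : contract u ≡ u
      contract-u = contract-uv (inj₁ refl)
      contract-v : contract v ≡ u
      contract-v = contract-uv (inj₂ refl)

    indeg-otherEdges : ∀ f w → indeg w (otherEdges (u ∷ v ∷ f)) ≡ multiplicity w f
    indeg-otherEdges f w = indeg-tabulate w f (λ x → lookup (u ∷ v ∷ f) (π (suc (suc x))))

    outdeg-otherEdges : ∀ f w → outdeg w (otherEdges (u ∷ v ∷ f)) ≡ multiplicity w f
    outdeg-otherEdges f w = trans
      (balanced-drop-loop w v (otherEdges (u ∷ v ∷ f)) (balanced-drop-loop w u (vv ∷ otherEdges (u ∷ v ∷ f))
        (subst (Balanced w) (edges-π u v f) (edges-balanced π π-injective (u ∷ v ∷ f) w))))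
      (indeg-otherEdges f w)

    tours-τπ : (f : Vec (Fin (suc q)) m) (g : Vec (Fin q) m) → f ∈ fibre g →
      suc (multiplicity u′ g) ! * tours (edges (τ ∘ π) (u ∷ v ∷ f)) ≡
      suc (multiplicity u′ g) ! * tours (edges π (u ∷ v ∷ f)) + factorials 0 0 f * tours (edges π (u′ ∷ u′ ∷ g))
    tours-τπ f g f∈ with mult-f , contract-f ← fibre-∈ g f∈ = begin
      suc (multiplicity u′ g) ! * tours (edges (τ ∘ π) (u ∷ v ∷ f))
        ≡⟨ cong₂ (λ k M → suc k ! * tours M) (sym mult-f) (edges-τπ u v f) ⟩
      suc (i + j) ! * tours (vu ∷ uv ∷ L)
        ≡⟨ cong (suc (i + j) ! *_) (circuits-swap consecutive? vu uv L) ⟩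
      suc (i + j) ! * tours (uv ∷ vu ∷ L)
        ≡⟨ identity ⟩
      suc (i + j) ! * tours (uu ∷ vv ∷ L) + i ! * j ! * tours (uu ∷ uu ∷ contractEdges L)
        ≡⟨ cong₂ _+_ (cong₂ (λ k M → suc k ! * tours M) (sym mult-f) (edges-π u v f))
             (cong (i ! * j ! *_) (sym (tours-contract-colouring f g contract-f))) ⟨
      suc (multiplicity u′ g) ! * tours (edges π (u ∷ v ∷ f)) + i ! * j ! * tours (edges π (u′ ∷ u′ ∷ g)) ∎
      where
      L = otherEdges (u ∷ v ∷ f)
      i = multiplicity u f
      j = multiplicity v f
      balanced : ∀ w → Balanced w L
      balanced w = trans (outdeg-otherEdges f w) (sym (indeg-otherEdges f w))
      identity : ContractionIdentity (suc (i + j) !) (i ! * j !) L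
      identity = subst₂ (λ a b → ContractionIdentity (suc (a + b) !) (a ! * b !) L)
        (outdeg-otherEdges f u) (outdeg-otherEdges f v) (contraction L (balanced u) (balanced v))

    ∑-fibre-τπ : (g : Vec (Fin q) m) → ∑[ f ∈ fibre g ] tours (edges (τ ∘ π) (u ∷ v ∷ f)) ≡
      (∑[ f ∈ fibre g ] tours (edges π (u ∷ v ∷ f))) + tours (edges π (u′ ∷ u′ ∷ g))
    ∑-fibre-τπ g = *-cancelˡ-≡ _ _ urn {{suc (multiplicity u′ g) !≢0}} (begin
      urn * (∑[ f ∈ fibre g ] tours (edges (τ ∘ π) (u ∷ v ∷ f)))
        ≡⟨ ∑-*ˡ (fibre g) urn _ ⟨
      ∑[ f ∈ fibre g ] (urn * tours (edges (τ ∘ π) (u ∷ v ∷ f)))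
        ≡⟨ ∑-cong-∈ (fibre g) (λ {f} f∈ → tours-τπ f g f∈) ⟩
      ∑[ f ∈ fibre g ] (urn * tours (edges π (u ∷ v ∷ f)) + factorials 0 0 f * contracted)
        ≡⟨ ∑-+ (fibre g) _ _ ⟩
      (∑[ f ∈ fibre g ] (urn * tours (edges π (u ∷ v ∷ f)))) + (∑[ f ∈ fibre g ] (factorials 0 0 f * contracted))
        ≡⟨ cong₂ _+_ (∑-*ˡ (fibre g) urn _) (trans (∑-*ʳ (fibre g) contracted _) (cong (_* contracted) ∑-urn)) ⟩
      urn * (∑[ f ∈ fibre g ] tours (edges π (u ∷ v ∷ f))) + urn * contracted
        ≡⟨ *-distribˡ-+ urn _ contracted ⟨
      urn * ((∑[ f ∈ fibre g ] tours (edges π (u ∷ v ∷ f))) + contracted) ∎)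
      where
      urn        = suc (multiplicity u′ g) !
      contracted = tours (edges π (u′ ∷ u′ ∷ g))
      ∑-urn : ∑ (fibre g) (factorials 0 0) ≡ urn
      ∑-urn = trans (sym (*-identityˡ _)) (trans (∑-fibre-factorials 0 0 g) (*-identityˡ urn))

    ∑-τπ : ∑[ f ∈ allVecs (suc q) m ] tours (edges (τ ∘ π) (punchIn v u′ ∷ v ∷ f)) ≡
      (∑[ f ∈ allVecs (suc q) m ] tours (edges π (punchIn v u′ ∷ v ∷ f)))
        + (∑[ g ∈ allVecs q m ] tours (edges π (u′ ∷ u′ ∷ g)))
    ∑-τπ = begin
      ∑[ f ∈ allVecs (suc q) m ] tours (edges (τ ∘ π) (u ∷ v ∷ f))
        ≡⟨ trans (∑-fibres m _) (∑-cong (allVecs q m) ∑-fibre-τπ) ⟩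
      ∑[ g ∈ allVecs q m ] ((∑[ f ∈ fibre g ] tours (edges π (u ∷ v ∷ f))) + tours (edges π (u′ ∷ u′ ∷ g)))
        ≡⟨ ∑-+ (allVecs q m) _ _ ⟩
      (∑[ g ∈ allVecs q m ] ∑[ f ∈ fibre g ] tours (edges π (u ∷ v ∷ f))) + ∑-contracted
        ≡⟨ cong (_+ ∑-contracted) (∑-fibres m _) ⟨
      (∑[ f ∈ allVecs (suc q) m ] tours (edges π (u ∷ v ∷ f))) + ∑-contracted ∎
      where ∑-contracted = ∑[ g ∈ allVecs q m ] tours (edges π (u′ ∷ u′ ∷ g))

  ∑-allVecs-∷-∷ : ∀ q (φ : Vec (Fin q) (2 + m) → ℕ) →
    ∑ (allVecs q (2 + m)) φ ≡ ∑[ y ∈ allFin q ] ∑[ x ∈ allFin q ] ∑[ f ∈ allVecs q m ] φ (x ∷ y ∷ f)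
  ∑-allVecs-∷-∷ q φ = trans (∑-allVecs-∷ q (suc m) φ)
    (trans (∑-cong (allFin q) (λ x → ∑-allVecs-∷ q m (φ ∘ (x ∷_)))) (∑-swap (allFin q) (allFin q) _))

  tourCount₌-diagonal : ∀ q →
    tourCount₌ π zero (suc zero) q ≡ ∑[ z ∈ allFin q ] ∑[ f ∈ allVecs q m ] tours (edges π (z ∷ z ∷ f))
  tourCount₌-diagonal q = trans (∑-allVecs-∷-∷ q _) (∑-cong (allFin q) (λ y → begin
    ∑[ x ∈ allFin q ] ∑[ f ∈ allVecs q m ] (𝟙 (x ≟ y) * tours (edges π (x ∷ y ∷ f)))
      ≡⟨ ∑-cong (allFin q) (λ x → ∑-*ˡ (allVecs q m) (𝟙 (x ≟ y)) _) ⟩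
    ∑[ x ∈ allFin q ] (𝟙 (x ≟ y) * (∑[ f ∈ allVecs q m ] tours (edges π (x ∷ y ∷ f))))
      ≡⟨ ∑-δ y _ ⟩
    ∑[ f ∈ allVecs q m ] tours (edges π (y ∷ y ∷ f)) ∎))

  private
    toursAt : (Fin (2 + m) → Fin (2 + m)) → Fin q → Fin q → ℕ
    toursAt ρ x y = ∑[ f ∈ allVecs _ m ] tours (edges ρ (x ∷ y ∷ f))

  toursAt-diagonal : ∀ {q} (y : Fin q) → toursAt (τ ∘ π) y y ≡ toursAt π y y
  toursAt-diagonal {q} y = ∑-cong (allVecs q m) (λ f → cong tours (trans (edges-τπ y y f) (sym (edges-π y y f))))

  ∑-toursAt-τπ : ∀ {q} (y : Fin (suc q)) → ∑[ x ∈ allFin (suc q) ] toursAt (τ ∘ π) x y ≡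
    (∑[ x ∈ allFin (suc q) ] toursAt π x y) + tourCount₌ π zero (suc zero) q
  ∑-toursAt-τπ {q} y = begin
    ∑[ x ∈ allFin (suc q) ] toursAt (τ ∘ π) x y
      ≡⟨ ∑-punchIn y _ ⟩
    toursAt (τ ∘ π) y y + (∑[ z ∈ allFin q ] toursAt (τ ∘ π) (punchIn y z) y)
      ≡⟨ cong₂ _+_ (toursAt-diagonal y) (trans (∑-cong (allFin q) (∑-τπ y)) (∑-+ (allFin q) _ _)) ⟩
    toursAt π y y + ((∑[ z ∈ allFin q ] toursAt π (punchIn y z) y) + (∑[ z ∈ allFin q ] toursAt π z z))
      ≡⟨ +-assoc (toursAt π y y) _ _ ⟨
    toursAt π y y + (∑[ z ∈ allFin q ] toursAt π (punchIn y z) y) + (∑[ z ∈ allFin q ] toursAt π z z)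
      ≡⟨ cong₂ _+_ (∑-punchIn y (λ x → toursAt π x y)) (tourCount₌-diagonal q) ⟨
    (∑[ x ∈ allFin (suc q) ] toursAt π x y) + tourCount₌ π zero (suc zero) q ∎

  tourCount-τπ : ∀ q → tourCount (τ ∘ π) (suc q) ≡ tourCount π (suc q) + suc q * tourCount₌ π zero (suc zero) q
  tourCount-τπ q = begin
    tourCount (τ ∘ π) (suc q)
      ≡⟨ ∑-allVecs-∷-∷ (suc q) _ ⟩
    ∑[ y ∈ allFin (suc q) ] ∑[ x ∈ allFin (suc q) ] toursAt (τ ∘ π) x y
      ≡⟨ ∑-cong (allFin (suc q)) ∑-toursAt-τπ ⟩
    ∑[ y ∈ allFin (suc q) ] ((∑[ x ∈ allFin (suc q) ] toursAt π x y) + tourCount₌ π zero (suc zero) q)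
      ≡⟨ ∑-+ (allFin (suc q)) (λ y → ∑[ x ∈ allFin (suc q) ] toursAt π x y) _ ⟩
    (∑[ y ∈ allFin (suc q) ] ∑[ x ∈ allFin (suc q) ] toursAt π x y)
      + (∑[ _ ∈ allFin (suc q) ] tourCount₌ π zero (suc zero) q)
      ≡⟨ cong₂ _+_ (sym (∑-allVecs-∷-∷ (suc q) _)) (∑-allFin-const (suc q) _) ⟩
    tourCount π (suc q) + suc q * tourCount₌ π zero (suc zero) q ∎

-- Transpositions and conjugation

transpose-left : (a b : Fin n) → transpose a b a ≡ b
transpose-left a b with a ≟ a
... | yes _  = refl
... | no a≢a = ⊥-elim (a≢a refl)

transpose-right : (a b : Fin n) → transpose a b b ≡ a
transpose-right a b with b ≟ a
... | yes b≡a = b≡a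
... | no _ with b ≟ b
...   | yes _  = refl
...   | no b≢b = ⊥-elim (b≢b refl)

transpose-other : (a b : Fin n) {x : Fin n} → x ≢ a → x ≢ b → transpose a b x ≡ x
transpose-other a b {x} x≢a x≢b with x ≟ a
... | yes x≡a = ⊥-elim (x≢a x≡a)
... | no _ with x ≟ b
...   | yes x≡b = ⊥-elim (x≢b x≡b)
...   | no _    = refl

data Position (a b x : Fin n) : Set where
  left  : x ≡ a → Position a b x
  right : x ≡ b → Position a b x
  other : x ≢ a → x ≢ b → Position a b x

position : (a b x : Fin n) → Position a b x
position a b x with x ≟ a
... | yes x≡a = left x≡a
... | no x≢a with x ≟ b
...   | yes x≡b = right x≡b
...   | no x≢b  = other x≢a x≢b

transpose-involutive : (a b x : Fin n) → transpose a b (transpose a b x) ≡ x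
transpose-involutive a b x with position a b x
... | left refl     = trans (cong (transpose a b) (transpose-left a b)) (transpose-right a b)
... | right refl    = trans (cong (transpose a b) (transpose-right a b)) (transpose-left a b)
... | other x≢a x≢b = trans (cong (transpose a b) (transpose-other a b x≢a x≢b)) (transpose-other a b x≢a x≢b)

involutive⇒injective : {f : A → A} → Involutive _≡_ f → Injective _≡_ _≡_ f
involutive⇒injective {f = f} f-involutive {x} {y} fx≡fy =
  trans (sym (f-involutive x)) (trans (cong f fx≡fy) (f-involutive y))

transpose-injective : (a b : Fin n) → Injective _≡_ _≡_ (transpose a b)
transpose-injective a b = involutive⇒injective (transpose-involutive a b)

transpose-conjugate : (σ : Fin n → Fin n) → Injective _≡_ _≡_ σ → ∀ a b x →
  transpose (σ a) (σ b) (σ x) ≡ σ (transpose a b x)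
transpose-conjugate σ σ-injective a b x with position a b x
... | left refl     = trans (transpose-left (σ a) (σ b)) (cong σ (sym (transpose-left a b)))
... | right refl    = trans (transpose-right (σ a) (σ b)) (cong σ (sym (transpose-right a b)))
... | other x≢a x≢b = trans (transpose-other (σ a) (σ b) (x≢a ∘ σ-injective) (x≢b ∘ σ-injective))
                            (cong σ (sym (transpose-other a b x≢a x≢b)))

lookup-extensional : {f g : Vec A n} → (∀ x → lookup f x ≡ lookup g x) → f ≡ g
lookup-extensional f≗g = Pointwise-≡⇒≡ (ext f≗g)

reindex : (Fin n → Fin n) → Vec A n → Vec A n
reindex σ f = Vec.tabulate (lookup f ∘ σ)

lookup-reindex : (σ : Fin n → Fin n) (f : Vec A n) (x : Fin n) → lookup (reindex σ f) x ≡ lookup f (σ x)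
lookup-reindex σ f = lookup∘tabulate (lookup f ∘ σ)

tourCount-cong : {π ρ : Fin n → Fin n} → (∀ x → π x ≡ ρ x) → ∀ q → tourCount π q ≡ tourCount ρ q
tourCount-cong π≗ρ q = ∑-cong (allVecs q _) (λ f →
  cong tours (tabulate-cong (λ x → cong (λ y → lookup f y , lookup f x) (π≗ρ x))))

permutation-injective : (σ : Permutation′ n) → Injective _≡_ _≡_ (σ ⟨$⟩ʳ_)
permutation-injective σ = Injection.injective (↔⇒↣ σ)

module Conjugation (σ : Permutation′ n) (π ρ : Fin n → Fin n) (πσ≗σρ : ∀ x → π (σ ⟨$⟩ʳ x) ≡ σ ⟨$⟩ʳ ρ x) where

  reindex-injective : Injective _≡_ _≡_ (reindex {A = A} (σ ⟨$⟩ʳ_))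
  reindex-injective {x = f} {g} σf≡σg = lookup-extensional (λ x → begin
    lookup f x                                   ≡⟨ cong (lookup f) (inverseʳ σ) ⟨
    lookup f (σ ⟨$⟩ʳ (σ ⟨$⟩ˡ x))                 ≡⟨ lookup-reindex (σ ⟨$⟩ʳ_) f (σ ⟨$⟩ˡ x) ⟨
    lookup (reindex (σ ⟨$⟩ʳ_) f) (σ ⟨$⟩ˡ x)      ≡⟨ cong (λ h → lookup h (σ ⟨$⟩ˡ x)) σf≡σg ⟩
    lookup (reindex (σ ⟨$⟩ʳ_) g) (σ ⟨$⟩ˡ x)      ≡⟨ lookup-reindex (σ ⟨$⟩ʳ_) g (σ ⟨$⟩ˡ x) ⟩
    lookup g (σ ⟨$⟩ʳ (σ ⟨$⟩ˡ x))                 ≡⟨ cong (lookup g) (inverseʳ σ) ⟩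
    lookup g x                                   ∎)

  tours-conjugate : (f : Vec (Fin q) n) → tours (edges ρ (reindex (σ ⟨$⟩ʳ_) f)) ≡ tours (edges π f)
  tours-conjugate f = begin
    tours (edges ρ (reindex (σ ⟨$⟩ʳ_) f))
      ≡⟨ cong tours (tabulate-cong (λ x → cong₂ _,_
           (trans (lookup-reindex (σ ⟨$⟩ʳ_) f (ρ x)) (cong (lookup f) (sym (πσ≗σρ x))))
           (lookup-reindex (σ ⟨$⟩ʳ_) f x))) ⟩
    tours (List.tabulate (edge π f ∘ (σ ⟨$⟩ʳ_)))
      ≡⟨ cong tours (trans (sym (map-tabulate id _)) (map-∘ (allFin n))) ⟩
    tours (map (edge π f) (map (σ ⟨$⟩ʳ_) (allFin n)))
      ≡⟨ tours-↭ (Perm.map⁺ (edge π f)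
           (injective⇒map-↭ (σ ⟨$⟩ʳ_) (Uniq.allFin⁺ n) ∈-allFin (permutation-injective σ))) ⟩
    tours (map (edge π f) (allFin n))
      ≡⟨ cong tours (map-tabulate id (edge π f)) ⟩
    tours (edges π f) ∎

  ∑-reindex-colourings : (φ : Vec (Fin q) n → ℕ) → ∑ (allVecs q n) (φ ∘ reindex (σ ⟨$⟩ʳ_)) ≡ ∑ (allVecs q n) φ
  ∑-reindex-colourings {q} = ∑-reindex (reindex (σ ⟨$⟩ʳ_)) (allVecs-unique q n) ∈-allVecs reindex-injective

  tourCount-conjugate : ∀ q → tourCount π q ≡ tourCount ρ q
  tourCount-conjugate q = trans (∑-cong (allVecs q n) (sym ∘ tours-conjugate)) (∑-reindex-colourings (tours ∘ edges ρ))

  tourCount₌-conjugate : ∀ a b q → tourCount₌ π (σ ⟨$⟩ʳ a) (σ ⟨$⟩ʳ b) q ≡ tourCount₌ ρ a b q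
  tourCount₌-conjugate a b q = trans
    (∑-cong (allVecs q n) (λ f → cong₂ _*_
      (cong₂ (λ x y → 𝟙 (x ≟ y)) (sym (lookup-reindex (σ ⟨$⟩ʳ_) f a)) (sym (lookup-reindex (σ ⟨$⟩ʳ_) f b)))
      (sym (tours-conjugate f))))
    (∑-reindex-colourings (λ f → 𝟙 (lookup f a ≟ lookup f b) * tours (edges ρ f)))

∃-permutation-01↦ : {a b : Fin (2 + m)} → a ≢ b →
  ∃ λ (σ : Permutation′ (2 + m)) → σ ⟨$⟩ʳ zero ≡ a × σ ⟨$⟩ʳ suc zero ≡ b
∃-permutation-01↦ {m} {a} {b} a≢b = Permutation.transpose (suc zero) b′ ∘ₚ Permutation.transpose zero a ,
  trans (cong (transpose zero a) (transpose-other (suc zero) b′ (λ ()) 0≢b′)) (transpose-left zero a) ,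
  trans (cong (transpose zero a) (transpose-left (suc zero) b′)) (transpose-involutive zero a b)
  where
  b′ : Fin (2 + m)
  b′ = transpose zero a b
  0≢b′ : zero ≢ b′
  0≢b′ 0≡b′ = a≢b (transpose-injective zero a (trans (transpose-right zero a) 0≡b′))

tourCount-transpose : (π : Fin n → Fin n) → Injective _≡_ _≡_ π → {a b : Fin n} → a ≢ b → π a ≡ a → π b ≡ b →
  ∀ q → tourCount (transpose a b ∘ π) (suc q) ≡ tourCount π (suc q) + suc q * tourCount₌ π a b q
tourCount-transpose {suc zero} π _ {zero} {zero} a≢b _ _ q = ⊥-elim (a≢b refl)
tourCount-transpose {suc (suc m)} π π-injective a≢b πa≡a πb≡b q
  with σ , refl , refl ← ∃-permutation-01↦ a≢b = begin
  tourCount (transpose a b ∘ π) (suc q)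
    ≡⟨ τπ.tourCount-conjugate (suc q) ⟩
  tourCount (transpose zero (suc zero) ∘ ρ) (suc q)
    ≡⟨ FixedPair.tourCount-τπ ρ ρ-injective (fixed πa≡a) (fixed πb≡b) q ⟩
  tourCount ρ (suc q) + suc q * tourCount₌ ρ zero (suc zero) q
    ≡⟨ cong₂ (λ s t → s + suc q * t) (π′.tourCount-conjugate (suc q)) (π′.tourCount₌-conjugate zero (suc zero) q) ⟨
  tourCount π (suc q) + suc q * tourCount₌ π a b q ∎
  where
  a b : Fin (2 + m)
  a = σ ⟨$⟩ʳ zero
  b = σ ⟨$⟩ʳ suc zero
  ρ : Fin (2 + m) → Fin (2 + m)
  ρ x = σ ⟨$⟩ˡ π (σ ⟨$⟩ʳ x)
  ρ-injective : Injective _≡_ _≡_ ρ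
  ρ-injective = permutation-injective σ ∘ π-injective ∘ permutation-injective (Permutation.flip σ)
  fixed : ∀ {x} → π (σ ⟨$⟩ʳ x) ≡ σ ⟨$⟩ʳ x → ρ x ≡ x
  fixed πσx≡σx = trans (cong (σ ⟨$⟩ˡ_) πσx≡σx) (inverseˡ σ)
  πσ≗σρ : ∀ x → π (σ ⟨$⟩ʳ x) ≡ σ ⟨$⟩ʳ ρ x
  πσ≗σρ x = sym (inverseʳ σ)
  τπσ≗στρ : ∀ x → transpose a b (π (σ ⟨$⟩ʳ x)) ≡ σ ⟨$⟩ʳ transpose zero (suc zero) (ρ x)
  τπσ≗στρ x = trans (cong (transpose a b) (πσ≗σρ x))
    (transpose-conjugate (σ ⟨$⟩ʳ_) (permutation-injective σ) zero (suc zero) (ρ x))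
  module π′ = Conjugation σ π ρ πσ≗σρ
  module τπ = Conjugation σ (transpose a b ∘ π) (transpose zero (suc zero) ∘ ρ) τπσ≗στρ

-- Full cycles

iter-suc : (η : Map n) (j : ℕ) (x : Fin n) → iter η j (η x) ≡ η (iter η j x)
iter-suc η zero    x = refl
iter-suc η (suc j) x = cong η (iter-suc η j x)

map-iter-upTo : (η : Map n) (x : Fin n) (k : ℕ) → map (λ i → iter η i x) (upTo k) ≡ iterate η x k
map-iter-upTo η x zero    = refl
map-iter-upTo η x (suc k) = cong (x ∷_) (begin
  map (λ i → iter η i x) (applyUpTo suc k)     ≡⟨ map-applyUpTo suc (λ i → iter η i x) k ⟩
  applyUpTo (λ i → iter η (suc i) x) k         ≡⟨ map-upTo (λ i → iter η (suc i) x) k ⟨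
  map (λ i → iter η (suc i) x) (upTo k)        ≡⟨ map-cong (λ i → iter-suc η i x) (upTo k) ⟨
  map (λ i → iter η i (η x)) (upTo k)          ≡⟨ map-iter-upTo η (η x) k ⟩
  iterate η (η x) k                            ∎)

Graph : Map n → Fin n → Fin n → Set
Graph η x y = η x ≡ y

chain-iterate : (η : Map n) (k : ℕ) (x : Fin n) → Chain (Graph η) x (iterate η (η x) k) (iter η (suc k) x)
chain-iterate η zero    x = refl
chain-iterate η (suc k) x =
  refl , subst (Chain (Graph η) (η x) (iterate η (η (η x)) k)) (iter-suc η (suc k) x) (chain-iterate η k (η x))

chain⇒iterate : (η : Map n) (o : List (Fin n)) {x z : Fin n} → Chain (Graph η) x o z →
  o ≡ iterate η (η x) (length o) × iter η (suc (length o)) x ≡ z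
chain⇒iterate η []      ηx≡z = refl , ηx≡z
chain⇒iterate η (y ∷ o) {x} (refl , chain) with o≡ , iter≡z ← chain⇒iterate η o chain =
  cong (η x ∷_) o≡ , trans (sym (iter-suc η (suc (length o)) x)) iter≡z

chain-zip : {R : Rel A ℓ₁} {S : Rel A ℓ₂} → ∀ {x} o {z} → Chain R x o z → Chain S x o z →
  ∀ {y} → y ∈ x ∷ o → ∃ λ y′ → R y y′ × S y y′
chain-zip []      r        s        (here refl) = _ , r , s
chain-zip (w ∷ o) (r , _)  (s , _)  (here refl) = w , r , s
chain-zip (w ∷ o) (_ , rs) (_ , ss) (there y∈)  = chain-zip o rs ss y∈

chain-weaken : {R : Rel A ℓ₁} {S : Rel A ℓ₂} → (∀ {x y} → R x y → S x y) →
  ∀ {x} o {z} → Chain R x o z → Chain S x o z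
chain-weaken R⇒S []      r        = R⇒S r
chain-weaken R⇒S (y ∷ o) (r , rs) = R⇒S r , chain-weaken R⇒S o rs

redirect : Fin n → List (Fin n) → Fin n → Vec (Fin n) n → Vec (Fin n) n
redirect x []      z v = v [ x ]≔ z
redirect x (y ∷ o) z v = redirect y o z v [ x ]≔ y

chain-update : (v : Vec (Fin n) n) (x w : Fin n) {y z : Fin n} (o : List (Fin n)) → x ∉ y ∷ o →
  Chain (Graph (lookup v)) y o z → Chain (Graph (lookup (v [ x ]≔ w))) y o z
chain-update v x w []      x∉ v[y]≡z         = trans (lookup∘update′ (x∉ ∘ here ∘ sym) v w) v[y]≡z
chain-update v x w (_ ∷ o) x∉ (v[y]≡ , chain) =
  trans (lookup∘update′ (x∉ ∘ here ∘ sym) v w) v[y]≡ , chain-update v x w o (x∉ ∘ there) chain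

chain-redirect : (x : Fin n) (o : List (Fin n)) (z : Fin n) (v : Vec (Fin n) n) → Unique (x ∷ o) →
  Chain (Graph (lookup (redirect x o z v))) x o z
chain-redirect x []      z v _           = lookup∘update x v z
chain-redirect x (y ∷ o) z v (x∉ ∷ unique) = lookup∘update x (redirect y o z v) y ,
  chain-update (redirect y o z v) x y o (λ x∈ → All.lookup x∉ x∈ refl) (chain-redirect y o z v unique)

module _ (ζ : Map (suc m)) (full : IsFullCycle ζ) where

  full⇒iterate-unique : Unique (iterate ζ zero (suc m))
  full⇒iterate-unique = subst Unique (map-iter-upTo ζ zero (suc m)) (proj₁ full)

  full⇒iterate-↭ : iterate ζ zero (suc m) ↭ allFin (suc m)
  full⇒iterate-↭ = unique∧⊆∧length≥⇒↭ full⇒iterate-unique (λ {x} _ → ∈-allFin x)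
    (≤-reflexive (trans (length-allFin (suc m)) (sym (length-iterate ζ zero (suc m)))))

  full⇒reachable : ∀ x → ∃ λ i → x ≡ iter ζ i zero
  full⇒reachable x
    with x∈iterate ← Perm.∈-resp-↭ (↭-sym full⇒iterate-↭) (∈-allFin x)
    with i , _ , x≡ ← ∈-map⁻ (λ i → iter ζ i zero) {xs = upTo (suc m)}
           (subst (x ∈_) (sym (map-iter-upTo ζ zero (suc m))) x∈iterate) = i , x≡

  full⇒injective : Injective _≡_ _≡_ ζ
  full⇒injective = surjective⇒injective preimage
    where
    preimage : ∀ y → ∃ λ x → ζ x ≡ y
    preimage y with full⇒reachable y
    ... | zero  , refl = iter ζ m zero , proj₂ full
    ... | suc i , refl = iter ζ i zero , refl

-- Full cycles as circuits

module _ {m : ℕ} where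

  nonzero : List (Fin (suc m))
  nonzero = List.tabulate suc

  ∈-orders⇒cover : ∀ {o} → o ∈ orders nonzero → zero ∷ o ↭ allFin (suc m)
  ∈-orders⇒cover o∈ = prep zero (∈-orders⇒↭ {L = nonzero} o∈)

  ∈-orders⇒length : ∀ {o} → o ∈ orders nonzero → length o ≡ m
  ∈-orders⇒length o∈ = trans (Perm.↭-length (∈-orders⇒↭ {L = nonzero} o∈)) (length-tabulate {A = Fin (suc m)} suc)

  ∈-orders⇒unique : ∀ {o} → o ∈ orders nonzero → Unique (zero ∷ o)
  ∈-orders⇒unique o∈ = Unique-resp-↭ (↭-sym (∈-orders⇒cover o∈)) (Uniq.allFin⁺ (suc m))

  Follows : Vec (Fin (suc m)) (suc m) → List (Fin (suc m)) → Set
  Follows v o = Chain (Graph (lookup v)) zero o zero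

  follows? : ∀ v o → Dec (Follows v o)
  follows? v o = chain? (λ x y → lookup v x ≟ y) zero o zero

  follows⇒iterate : ∀ v {o} → o ∈ orders nonzero → Follows v o →
    o ≡ iterate (lookup v) (lookup v zero) m × iter (lookup v) (suc m) zero ≡ zero
  follows⇒iterate v {o} o∈ follows =
    subst (λ k → o ≡ iterate (lookup v) (lookup v zero) k × iter (lookup v) (suc k) zero ≡ zero)
      (∈-orders⇒length o∈) (chain⇒iterate (lookup v) o follows)

  follows⇒full : ∀ v {o} → o ∈ orders nonzero → Follows v o → IsFullCycle (lookup v)
  follows⇒full v o∈ follows with o≡ , closed ← follows⇒iterate v o∈ follows =
    subst Unique (trans (cong (zero ∷_) o≡) (sym (map-iter-upTo (lookup v) zero (suc m)))) (∈-orders⇒unique o∈) ,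
    closed

  ∑-follows : ∀ v → ∑[ o ∈ orders nonzero ] 𝟙 (follows? v o) ≡ 𝟙 (isFullCycle? (lookup v))
  ∑-follows v with isFullCycle? (lookup v)
  ... | no ¬full = trans (∑-zero (orders nonzero) (λ {o} o∈ → 𝟙-no (follows? v o) (¬full ∘ follows⇒full v o∈)))
    (sym (𝟙-no (isFullCycle? (lookup v)) ¬full))
  ... | yes full = begin
    ∑[ o ∈ orders nonzero ] 𝟙 (follows? v o)
      ≡⟨ ∑-concentrated (λ o → 𝟙 (follows? v o)) (orders-unique {L = nonzero} (Uniq.tabulate⁺ Finₚ.suc-injective))
           (↭⇒∈-orders (Perm.drop-∷ (full⇒iterate-↭ (lookup v) full)))
           (λ {o} o∈ o≢orbit → 𝟙-no (follows? v o) (o≢orbit ∘ proj₁ ∘ follows⇒iterate v o∈)) ⟩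
    𝟙 (follows? v orbit)
      ≡⟨ 𝟙-yes (follows? v orbit)
           (subst (Chain (Graph (lookup v)) zero orbit) (proj₂ full) (chain-iterate (lookup v) m zero)) ⟩
    1
      ≡⟨ 𝟙-yes (isFullCycle? (lookup v)) full ⟨
    𝟙 (isFullCycle? (lookup v)) ∎
    where orbit = iterate (lookup v) (lookup v zero) m

  module _ {R : Rel (Fin (suc m)) ℓ} (R? : Decidable₂ R) where

    steps? : (ζ : Map (suc m)) → Dec (∀ x → R x (ζ x))
    steps? ζ = all? (λ x → R? x (ζ x))

    ∑-follows-steps : ∀ {o} → o ∈ orders nonzero →
      ∑[ v ∈ allVecs (suc m) (suc m) ] (𝟙 (follows? v o) * 𝟙 (steps? (lookup v))) ≡ 𝟙 (chain? R? zero o zero)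
    ∑-follows-steps {o} o∈ = begin
      ∑[ v ∈ allVecs (suc m) (suc m) ] (𝟙 (follows? v o) * 𝟙 (steps? (lookup v)))
        ≡⟨ ∑-concentrated _ (allVecs-unique (suc m) (suc m)) (∈-allVecs w)
             (λ {v} _ v≢w → cong (_* 𝟙 (steps? (lookup v))) (𝟙-no (follows? v o) (v≢w ∘ determined))) ⟩
      𝟙 (follows? w o) * 𝟙 (steps? (lookup w))
        ≡⟨ trans (cong (_* 𝟙 (steps? (lookup w))) (𝟙-yes (follows? w o) w-follows)) (*-identityˡ _) ⟩
      𝟙 (steps? (lookup w))
        ≡⟨ 𝟙-⇔ (mk⇔ steps⇒chain chain⇒steps) (steps? (lookup w)) (chain? R? zero o zero) ⟩
      𝟙 (chain? R? zero o zero) ∎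
      where
      w : Vec (Fin (suc m)) (suc m)
      w = redirect zero o zero (Vec.replicate (suc m) zero)
      w-follows : Follows w o
      w-follows = chain-redirect zero o zero _ (∈-orders⇒unique o∈)
      covers : ∀ x → x ∈ zero ∷ o
      covers x = Perm.∈-resp-↭ (↭-sym (∈-orders⇒cover o∈)) (∈-allFin x)
      determined : ∀ {v} → Follows v o → v ≡ w
      determined follows = lookup-extensional (λ x →
        let (_ , v[x]≡ , w[x]≡) = chain-zip o follows w-follows (covers x) in trans v[x]≡ (sym w[x]≡))
      steps⇒chain : (∀ x → R x (lookup w x)) → Chain R zero o zero
      steps⇒chain steps = chain-weaken (λ { {x} refl → steps x }) o w-follows
      chain⇒steps : Chain R zero o zero → ∀ x → R x (lookup w x)
      chain⇒steps chain x = let (_ , w[x]≡ , r) = chain-zip o w-follows chain (covers x) in subst (R x) (sym w[x]≡) r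

    ∑-fullCycles-steps : ∑[ ζ ∈ fullCycles m ] 𝟙 (steps? ζ) ≡ circuits R? (allFin (suc m))
    ∑-fullCycles-steps = begin
      ∑[ ζ ∈ fullCycles m ] 𝟙 (steps? ζ)
        ≡⟨ ∑-filter isFullCycle? (allMaps (suc m)) (λ ζ → 𝟙 (steps? ζ)) ⟩
      ∑[ ζ ∈ allMaps (suc m) ] (𝟙 (isFullCycle? ζ) * 𝟙 (steps? ζ))
        ≡⟨ ∑-map lookup V (λ ζ → 𝟙 (isFullCycle? ζ) * 𝟙 (steps? ζ)) ⟩
      ∑[ v ∈ V ] (𝟙 (isFullCycle? (lookup v)) * 𝟙 (steps? (lookup v)))
        ≡⟨ ∑-cong V (λ v → trans (cong (_* 𝟙 (steps? (lookup v))) (sym (∑-follows v)))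
             (sym (∑-*ʳ (orders nonzero) (𝟙 (steps? (lookup v))) _))) ⟩
      ∑[ v ∈ V ] ∑[ o ∈ orders nonzero ] (𝟙 (follows? v o) * 𝟙 (steps? (lookup v)))
        ≡⟨ ∑-swap V (orders nonzero) _ ⟩
      ∑[ o ∈ orders nonzero ] ∑[ v ∈ V ] (𝟙 (follows? v o) * 𝟙 (steps? (lookup v)))
        ≡⟨ ∑-cong-∈ (orders nonzero) ∑-follows-steps ⟩
      circuits R? (allFin (suc m)) ∎
      where V = allVecs (suc m) (suc m)

∑-fullCycles-tours : (g f : Fin (suc m) → Fin q) →
  ∑[ ζ ∈ fullCycles m ] 𝟙 (all? (λ x → f x ≟ g (ζ x))) ≡ tours (List.tabulate (λ x → g x , f x))
∑-fullCycles-tours {m} g f = begin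
  ∑[ ζ ∈ fullCycles m ] 𝟙 (all? (λ x → f x ≟ g (ζ x)))
    ≡⟨ ∑-fullCycles-steps match? ⟩
  circuits match? (allFin (suc m))
    ≡⟨ circuits-map match? consecutive? (λ x → g x , f x) (λ _ _ → ⇔-id _) (allFin (suc m)) ⟨
  tours (map (λ x → g x , f x) (allFin (suc m)))
    ≡⟨ cong tours (map-tabulate id (λ x → g x , f x)) ⟩
  tours (List.tabulate (λ x → g x , f x)) ∎
  where
  match? : Decidable₂ (λ x y → f x ≡ g y)
  match? x y = f x ≟ g y

-- Cycles of a permutation

iter-+ : (η : Map n) → ∀ i j x → iter η (i + j) x ≡ iter η i (iter η j x)
iter-+ η zero    j x = refl
iter-+ η (suc i) j x = cong η (iter-+ η i j x)

lookup-unique-injective : {xs : List A} → Unique xs → ∀ i j → List.lookup xs i ≡ List.lookup xs j → i ≡ j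
lookup-unique-injective (_  ∷ _) zero    zero    _  = refl
lookup-unique-injective (x∉ ∷ _) zero    (suc j) x≡ = ⊥-elim (All.lookup x∉ (∈-lookup j) x≡)
lookup-unique-injective (x∉ ∷ _) (suc i) zero    ≡x = ⊥-elim (All.lookup x∉ (∈-lookup i) (sym ≡x))
lookup-unique-injective (_  ∷ u) (suc i) (suc j) x≡ = cong suc (lookup-unique-injective u i j x≡)

module Cycles (η : Map n) (η-injective : Injective _≡_ _≡_ η) where

  iter-injective : ∀ j → Injective _≡_ _≡_ (iter η j)
  iter-injective zero    x≡y   = x≡y
  iter-injective (suc j) ηx≡ηy = iter-injective j (η-injective ηx≡ηy)

  period : ∀ x → ∃ λ p → suc p ≤ n × iter η (suc p) x ≡ x
  period x with i , j , i<j , ηⁱx≡ηʲx ← pigeonhole (n<1+n n) (λ (i : Fin (suc n)) → iter η (toℕ i) x) =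
    collision (toℕ≤pred[n] j) i<j ηⁱx≡ηʲx
    where
    collision : ∀ {i j} → j ≤ n → i < j → iter η i x ≡ iter η j x → ∃ λ p → suc p ≤ n × iter η (suc p) x ≡ x
    collision {i} {j} j≤n i<j ηⁱx≡ηʲx = p , subst (_≤ n) j∸i≡1+p (≤-trans (m∸n≤m j i) j≤n) , iter-injective i (begin
      iter η i (iter η (suc p) x)   ≡⟨ iter-+ η i (suc p) x ⟨
      iter η (i + suc p) x          ≡⟨ cong (λ k → iter η k x) i+1+p≡j ⟩
      iter η j x                    ≡⟨ ηⁱx≡ηʲx ⟨
      iter η i x                    ∎)
      where
      p = j ∸ suc i
      i+1+p≡j : i + suc p ≡ j
      i+1+p≡j = trans (+-suc i p) (m+[n∸m]≡n i<j)
      j∸i≡1+p : j ∸ i ≡ suc p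
      j∸i≡1+p = +-∸-assoc 1 i<j

  iter-multiple : ∀ {p x} → iter η p x ≡ x → ∀ k → iter η (k * p) x ≡ x
  iter-multiple         ηᵖx≡x zero    = refl
  iter-multiple {p} {x} ηᵖx≡x (suc k) =
    trans (iter-+ η p (k * p) x) (trans (cong (iter η p) (iter-multiple ηᵖx≡x k)) ηᵖx≡x)

  cycleMin⇒≤ : ∀ {x} → IsCycleMin η x → ∀ j → toℕ x ≤ toℕ (iter η j x)
  cycleMin⇒≤ {x} x-min j with p , p<n , closed ← period x =
    subst (λ y → toℕ x ≤ toℕ y) (sym reduce) (All.lookup x-min (∈-upTo⁺ (<-≤-trans (m%n<n j (suc p)) p<n)))
    where
    reduce : iter η j x ≡ iter η (j % suc p) x
    reduce = begin
      iter η j x                                          ≡⟨ cong (λ k → iter η k x) (m≡m%n+[m/n]*n j (suc p)) ⟩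
      iter η (j % suc p + j / suc p * suc p) x            ≡⟨ iter-+ η (j % suc p) (j / suc p * suc p) x ⟩
      iter η (j % suc p) (iter η (j / suc p * suc p) x)   ≡⟨ cong (iter η (j % suc p)) (iter-multiple closed (j / suc p)) ⟩
      iter η (j % suc p) x                                ∎

  iter-back : ∀ j x → ∃ λ k → iter η k (iter η j x) ≡ x
  iter-back j x with p , _ , closed ← period x = j * suc p ∸ j , (begin
    iter η (j * suc p ∸ j) (iter η j x)   ≡⟨ iter-+ η (j * suc p ∸ j) j x ⟨
    iter η (j * suc p ∸ j + j) x          ≡⟨ cong (λ k → iter η k x) (m∸n+n≡m (m≤m*n j (suc p))) ⟩
    iter η (j * suc p) x                  ≡⟨ iter-multiple closed j ⟩
    x                                     ∎)

  ∃-cycleMin : ∀ x → ∃ λ y → IsCycleMin η y × ∃ λ j → iter η j x ≡ y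
  ∃-cycleMin x = descend x (<-wellFounded (toℕ x))
    where
    descend : ∀ x → Acc _<_ (toℕ x) → ∃ λ y → IsCycleMin η y × ∃ λ j → iter η j x ≡ y
    descend x (acc rec) with isCycleMin? η x
    ... | yes x-min = x , x-min , 0 , refl
    ... | no ¬x-min
      with j , _ , x≰ηʲx ← find (Allₚ.¬All⇒Any¬ (λ j → toℕ x ℕ.≤? toℕ (iter η j x)) (upTo n) ¬x-min)
      with y , y-min , k , ηᵏηʲx≡y ← descend (iter η j x) (rec (≰⇒> x≰ηʲx)) =
      y , y-min , k + j , trans (iter-+ η k j x) ηᵏηʲx≡y

  cycleMin-unique : ∀ {y} j → IsCycleMin η y → IsCycleMin η (iter η j y) → y ≡ iter η j y
  cycleMin-unique {y} j y-min ηʲy-min with k , ηᵏηʲy≡y ← iter-back j y = toℕ-injective (≤-antisym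
    (cycleMin⇒≤ y-min j) (subst (λ z → toℕ (iter η j y) ≤ toℕ z) ηᵏηʲy≡y (cycleMin⇒≤ ηʲy-min k)))

  root : Fin n → Fin n
  root x = proj₁ (∃-cycleMin x)

  root-min : ∀ x → IsCycleMin η (root x)
  root-min x = proj₁ (proj₂ (∃-cycleMin x))

  root-reachable : ∀ x → ∃ λ j → iter η j x ≡ root x
  root-reachable x = proj₂ (proj₂ (∃-cycleMin x))

  root-cycleMin : ∀ {y} → IsCycleMin η y → root y ≡ y
  root-cycleMin {y} y-min with j , ηʲy≡root ← root-reachable y =
    trans (sym ηʲy≡root) (sym (cycleMin-unique j y-min (subst (IsCycleMin η) (sym ηʲy≡root) (root-min y))))

  root-η : ∀ x → root (η x) ≡ root x
  root-η x with j , ηʲηx≡root ← root-reachable (η x) | i , ηⁱx≡root ← root-reachable x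
    with k , ηᵏηⁱx≡x ← iter-back i x = sym (trans (cycleMin-unique (j + suc k) (root-min x) reach-min) reach)
    where
    reach : iter η (j + suc k) (root x) ≡ root (η x)
    reach = begin
      iter η (j + suc k) (root x)              ≡⟨ iter-+ η j (suc k) (root x) ⟩
      iter η j (η (iter η k (root x)))         ≡⟨ cong (iter η j ∘ η ∘ iter η k) ηⁱx≡root ⟨
      iter η j (η (iter η k (iter η i x)))     ≡⟨ cong (iter η j ∘ η) ηᵏηⁱx≡x ⟩
      iter η j (η x)                           ≡⟨ ηʲηx≡root ⟩
      root (η x)                               ∎
    reach-min : IsCycleMin η (iter η (j + suc k) (root x))
    reach-min = subst (IsCycleMin η) (sym reach) (root-min (η x))

-- Colourings constant on cycles

Invariant : Map n → Vec (Fin q) n → Set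
Invariant η f = ∀ x → lookup f x ≡ lookup f (η x)

invariant? : (η : Map n) (f : Vec (Fin q) n) → Dec (Invariant η f)
invariant? η f = all? (λ x → lookup f x ≟ lookup f (η x))

invariants : Map n → ℕ → ℕ
invariants η q = ∑[ f ∈ allVecs q _ ] 𝟙 (invariant? η f)

invariants₌ : Map n → Fin n → Fin n → ℕ → ℕ
invariants₌ η a b q = ∑[ f ∈ allVecs q _ ] (𝟙 (invariant? η f) * 𝟙 (lookup f a ≟ lookup f b))

invariant-iter : (η : Map n) (f : Vec (Fin q) n) → Invariant η f → ∀ j x → lookup f x ≡ lookup f (iter η j x)
invariant-iter η f invariant zero    x = refl
invariant-iter η f invariant (suc j) x = trans (invariant-iter η f invariant j x) (invariant (iter η j x))

module CycleColourings (η : Map n) (η-injective : Injective _≡_ _≡_ η) (q : ℕ) where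

  open Cycles η η-injective

  cycleMins : List (Fin n)
  cycleMins = filter (isCycleMin? η) (allFin n)

  root∈ : ∀ x → root x ∈ cycleMins
  root∈ x = ∈-filter⁺ (isCycleMin? η) (∈-allFin (root x)) (root-min x)

  cycleIndex : Fin n → Fin (cycles η)
  cycleIndex x = index (root∈ x)

  lookup-cycleIndex : ∀ x → List.lookup cycleMins (cycleIndex x) ≡ root x
  lookup-cycleIndex x = sym (lookup-index (root∈ x))

  cycleIndex-unique : ∀ x i → root x ≡ List.lookup cycleMins i → cycleIndex x ≡ i
  cycleIndex-unique x i root≡ = lookup-unique-injective (Uniq.filter⁺ (isCycleMin? η) (Uniq.allFin⁺ n)) _ _
    (trans (lookup-cycleIndex x) root≡)

  cycleIndex-η : ∀ x → cycleIndex x ≡ cycleIndex (η x)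
  cycleIndex-η x = cycleIndex-unique x _ (trans (sym (root-η x)) (sym (lookup-cycleIndex (η x))))

  restrict : Vec (Fin q) n → Vec (Fin q) (cycles η)
  restrict f = Vec.tabulate (lookup f ∘ List.lookup cycleMins)

  extend : Vec (Fin q) (cycles η) → Vec (Fin q) n
  extend g = Vec.tabulate (lookup g ∘ cycleIndex)

  lookup-extend : ∀ g x → lookup (extend g) x ≡ lookup g (cycleIndex x)
  lookup-extend g = lookup∘tabulate (lookup g ∘ cycleIndex)

  restrict-extend : ∀ g → restrict (extend g) ≡ g
  restrict-extend g = lookup-extensional (λ i → begin
    lookup (restrict (extend g)) i                      ≡⟨ lookup∘tabulate _ i ⟩
    lookup (extend g) (List.lookup cycleMins i)         ≡⟨ lookup-extend g _ ⟩
    lookup g (cycleIndex (List.lookup cycleMins i))     ≡⟨ cong (lookup g) (index-min i) ⟩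
    lookup g i                                          ∎)
    where
    min : ∀ i → IsCycleMin η (List.lookup cycleMins i)
    min i = proj₂ (∈-filter⁻ (isCycleMin? η) {xs = allFin n} (∈-lookup i))
    index-min : ∀ i → cycleIndex (List.lookup cycleMins i) ≡ i
    index-min i = cycleIndex-unique _ i (root-cycleMin (min i))

  extend-restrict : ∀ {f} → Invariant η f → extend (restrict f) ≡ f
  extend-restrict {f} invariant = lookup-extensional (λ x → let (j , ηʲx≡root) = root-reachable x in begin
    lookup (extend (restrict f)) x                     ≡⟨ lookup-extend (restrict f) x ⟩
    lookup (restrict f) (cycleIndex x)                 ≡⟨ lookup∘tabulate _ (cycleIndex x) ⟩
    lookup f (List.lookup cycleMins (cycleIndex x))    ≡⟨ cong (lookup f) (trans (lookup-cycleIndex x) (sym ηʲx≡root)) ⟩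
    lookup f (iter η j x)                              ≡⟨ invariant-iter η f invariant j x ⟨
    lookup f x                                         ∎)

  extend-invariant : ∀ g → Invariant η (extend g)
  extend-invariant g x = begin
    lookup (extend g) x            ≡⟨ lookup-extend g x ⟩
    lookup g (cycleIndex x)        ≡⟨ cong (lookup g) (cycleIndex-η x) ⟩
    lookup g (cycleIndex (η x))    ≡⟨ lookup-extend g (η x) ⟨
    lookup (extend g) (η x)        ∎

  extend-injective : Injective _≡_ _≡_ extend
  extend-injective {g} {h} eg≡eh = trans (sym (restrict-extend g)) (trans (cong restrict eg≡eh) (restrict-extend h))

  map-extend-↭ : map extend (allVecs q (cycles η)) ↭ filter (invariant? η) (allVecs q n)
  map-extend-↭ = ∼bag⇒↭ (unique∧set⇒bag
    (Uniq.map⁺ extend-injective (allVecs-unique q (cycles η)))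
    (Uniq.filter⁺ (invariant? η) (allVecs-unique q n))
    (mk⇔ extended⇒invariant invariant⇒extended))
    where
    extended⇒invariant : ∀ {f} → f ∈ map extend (allVecs q (cycles η)) → f ∈ filter (invariant? η) (allVecs q n)
    extended⇒invariant f∈ with g , _ , refl ← ∈-map⁻ extend f∈ =
      ∈-filter⁺ (invariant? η) (∈-allVecs (extend g)) (extend-invariant g)
    invariant⇒extended : ∀ {f} → f ∈ filter (invariant? η) (allVecs q n) → f ∈ map extend (allVecs q (cycles η))
    invariant⇒extended {f} f∈ = subst (_∈ map extend (allVecs q (cycles η)))
      (extend-restrict (proj₂ (∈-filter⁻ (invariant? η) {xs = allVecs q n} f∈)))
      (∈-map⁺ extend (∈-allVecs (restrict f)))

  invariants≡^cycles : invariants η q ≡ q ^ cycles η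
  invariants≡^cycles = begin
    invariants η q                                     ≡⟨ ∑-𝟙 (invariant? η) (allVecs q n) ⟩
    length (filter (invariant? η) (allVecs q n))       ≡⟨ Perm.↭-length map-extend-↭ ⟨
    length (map extend (allVecs q (cycles η)))         ≡⟨ length-map extend (allVecs q (cycles η)) ⟩
    length (allVecs q (cycles η))                      ≡⟨ length-allVecs q (cycles η) ⟩
    q ^ cycles η                                       ∎

module Separated (η : Map n) (S : Fin n → Bool) (S-invariant : ∀ x → S x ≡ S (η x))
  {a b : Fin n} (a∉S : S a ≡ false) (b∈S : S b ≡ true) (q : ℕ) where

  recolouring : Fin q → Fin q → Bool → Fin q → Fin q
  recolouring i j s c = if s then transpose i j c else c

  recolour : Fin q → Fin q → Vec (Fin q) n → Vec (Fin q) n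
  recolour i j f = Vec.tabulate (λ x → recolouring i j (S x) (lookup f x))

  lookup-recolour : ∀ i j f x → lookup (recolour i j f) x ≡ recolouring i j (S x) (lookup f x)
  lookup-recolour i j f = lookup∘tabulate (λ x → recolouring i j (S x) (lookup f x))

  recolour-involutive : ∀ i j f → recolour i j (recolour i j f) ≡ f
  recolour-involutive i j f = lookup-extensional (λ x → begin
    lookup (recolour i j (recolour i j f)) x
      ≡⟨ lookup-recolour i j (recolour i j f) x ⟩
    recolouring i j (S x) (lookup (recolour i j f) x)
      ≡⟨ cong (recolouring i j (S x)) (lookup-recolour i j f x) ⟩
    recolouring i j (S x) (recolouring i j (S x) (lookup f x))
      ≡⟨ recolouring-involutive (S x) (lookup f x) ⟩
    lookup f x ∎)
    where
    recolouring-involutive : ∀ s c → recolouring i j s (recolouring i j s c) ≡ c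
    recolouring-involutive true  c = transpose-involutive i j c
    recolouring-involutive false c = refl

  recolour-invariant : ∀ i j f → Invariant η f → Invariant η (recolour i j f)
  recolour-invariant i j f invariant x = trans (lookup-recolour i j f x)
    (trans (cong₂ (recolouring i j) (S-invariant x) (invariant x)) (sym (lookup-recolour i j f (η x))))

  recolour-invariant-⇔ : ∀ i j f → Invariant η (recolour i j f) ⇔ Invariant η f
  recolour-invariant-⇔ i j f = mk⇔
    (λ invariant → subst (Invariant η) (recolour-involutive i j f) (recolour-invariant i j (recolour i j f) invariant))
    (recolour-invariant i j f)

  recolour-a : ∀ i j f → lookup (recolour i j f) a ≡ lookup f a
  recolour-a i j f = trans (lookup-recolour i j f a) (cong (λ s → recolouring i j s (lookup f a)) a∉S)

  recolour-b : ∀ i j f → lookup (recolour i j f) b ≡ transpose i j (lookup f b)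
  recolour-b i j f = trans (lookup-recolour i j f b) (cong (λ s → recolouring i j s (lookup f b)) b∈S)

  coloured : Fin q → Fin q → ℕ
  coloured i j = ∑[ f ∈ allVecs q n ] (𝟙 (i ≟ lookup f a) * (𝟙 (j ≟ lookup f b) * 𝟙 (invariant? η f)))

  coloured-diagonal : ∀ i j → coloured i j ≡ coloured i i
  coloured-diagonal i j = trans
    (sym (∑-reindex (recolour i j) (allVecs-unique q n) ∈-allVecs (involutive⇒injective (recolour-involutive i j)) _))
    (∑-cong (allVecs q n) (λ f → cong₂ _*_
      (cong (λ c → 𝟙 (i ≟ c)) (recolour-a i j f))
      (cong₂ _*_
        (trans (cong (λ c → 𝟙 (j ≟ c)) (recolour-b i j f)) (𝟙-⇔ (mk⇔ (to f) (from f)) (j ≟ _) (i ≟ lookup f b)))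
        (𝟙-⇔ (recolour-invariant-⇔ i j f) (invariant? η (recolour i j f)) (invariant? η f)))))
    where
    to : ∀ f → j ≡ transpose i j (lookup f b) → i ≡ lookup f b
    to f j≡ = trans (sym (transpose-right i j))
      (trans (cong (transpose i j) j≡) (transpose-involutive i j (lookup f b)))
    from : ∀ f → i ≡ lookup f b → j ≡ transpose i j (lookup f b)
    from f i≡ = trans (sym (transpose-left i j)) (cong (transpose i j) i≡)

  ∑∑-coloured : ∑[ i ∈ allFin q ] ∑[ j ∈ allFin q ] coloured i j ≡ invariants η q
  ∑∑-coloured = begin
    ∑[ i ∈ allFin q ] ∑[ j ∈ allFin q ] coloured i j
      ≡⟨ ∑-cong (allFin q) (λ i → ∑-swap (allFin q) (allVecs q n) _) ⟩
    ∑[ i ∈ allFin q ] ∑[ f ∈ allVecs q n ] ∑[ j ∈ allFin q ]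
      (𝟙 (i ≟ lookup f a) * (𝟙 (j ≟ lookup f b) * 𝟙 (invariant? η f)))
      ≡⟨ ∑-cong (allFin q) (λ i → ∑-cong (allVecs q n) (λ f →
           trans (∑-*ˡ (allFin q) (𝟙 (i ≟ lookup f a)) _) (cong (𝟙 (i ≟ lookup f a) *_) (∑-δ (lookup f b) _)))) ⟩
    ∑[ i ∈ allFin q ] ∑[ f ∈ allVecs q n ] (𝟙 (i ≟ lookup f a) * 𝟙 (invariant? η f))
      ≡⟨ ∑-swap (allFin q) (allVecs q n) _ ⟩
    ∑[ f ∈ allVecs q n ] ∑[ i ∈ allFin q ] (𝟙 (i ≟ lookup f a) * 𝟙 (invariant? η f))
      ≡⟨ ∑-cong (allVecs q n) (λ f → ∑-δ (lookup f a) _) ⟩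
    invariants η q ∎

  ∑-coloured-diagonal : ∑[ i ∈ allFin q ] coloured i i ≡ invariants₌ η a b q
  ∑-coloured-diagonal = trans (∑-swap (allFin q) (allVecs q n) _) (∑-cong (allVecs q n) (λ f →
    trans (∑-δ (lookup f a) _) (*-comm (𝟙 (lookup f a ≟ lookup f b)) (𝟙 (invariant? η f)))))

  invariants-separated : invariants η q ≡ q * invariants₌ η a b q
  invariants-separated = begin
    invariants η q
      ≡⟨ ∑∑-coloured ⟨
    ∑[ i ∈ allFin q ] ∑[ j ∈ allFin q ] coloured i j
      ≡⟨ ∑-cong (allFin q) (λ i → trans (∑-cong (allFin q) (coloured-diagonal i)) (∑-allFin-const q (coloured i i))) ⟩
    ∑[ i ∈ allFin q ] (q * coloured i i)
      ≡⟨ ∑-*ˡ (allFin q) q _ ⟩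
    q * (∑[ i ∈ allFin q ] coloured i i)
      ≡⟨ cong (q *_) ∑-coloured-diagonal ⟩
    q * invariants₌ η a b q ∎

invariants-joined : (η : Map n) {a b : Fin n} {q : ℕ} →
  (∀ (f : Vec (Fin q) n) → Invariant η f → lookup f a ≡ lookup f b) → invariants η q ≡ invariants₌ η a b q
invariants-joined η {a} {b} joined = ∑-cong (allVecs _ _) (λ f → trans (sym (*-identityʳ _))
  (𝟙-guard (invariant? η f) (λ invariant → sym (𝟙-yes (lookup f a ≟ lookup f b) (joined f invariant)))))

invariants₌-transpose : (η : Map n) (a b : Fin n) → ∀ q → invariants₌ (transpose a b ∘ η) a b q ≡ invariants₌ η a b q
invariants₌-transpose η a b q = ∑-cong (allVecs q _) (λ f → begin
  𝟙 (invariant? (transpose a b ∘ η) f) * 𝟙 (lookup f a ≟ lookup f b)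
    ≡⟨ *-comm (𝟙 (invariant? (transpose a b ∘ η) f)) _ ⟩
  𝟙 (lookup f a ≟ lookup f b) * 𝟙 (invariant? (transpose a b ∘ η) f)
    ≡⟨ 𝟙-guard (lookup f a ≟ lookup f b) (λ fa≡fb → 𝟙-⇔ (mk⇔
         (λ invariant x → trans (invariant x) (lookup-transpose f fa≡fb (η x)))
         (λ invariant x → trans (invariant x) (sym (lookup-transpose f fa≡fb (η x)))))
         (invariant? _ f) (invariant? η f)) ⟩
  𝟙 (lookup f a ≟ lookup f b) * 𝟙 (invariant? η f)
    ≡⟨ *-comm (𝟙 (lookup f a ≟ lookup f b)) _ ⟩
  𝟙 (invariant? η f) * 𝟙 (lookup f a ≟ lookup f b) ∎)
  where
  lookup-transpose : ∀ (f : Vec (Fin q) _) → lookup f a ≡ lookup f b → ∀ y → lookup f (transpose a b y) ≡ lookup f y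
  lookup-transpose f fa≡fb y with position a b y
  ... | left refl       = trans (cong (lookup f) (transpose-left a b)) (sym fa≡fb)
  ... | right refl      = trans (cong (lookup f) (transpose-right a b)) fa≡fb
  ... | other y≢a y≢b   = cong (lookup f) (transpose-other a b y≢a y≢b)

module Return (η : Map n) (η-injective : Injective _≡_ _≡_ η) {a b : Fin n} (a≢b : a ≢ b) where

  Avoids : ℕ → Set
  Avoids t = ∀ s → s < t → iter η (suc s) b ≢ a × iter η (suc s) b ≢ b

  avoids-suc : ∀ {t} → Avoids t → iter η (suc t) b ≢ a → iter η (suc t) b ≢ b → Avoids (suc t)
  avoids-suc avoids ≢a ≢b s s<1+t with m<1+n⇒m<n∨m≡n s<1+t
  ... | inj₁ s<t  = avoids s s<t
  ... | inj₂ refl = ≢a , ≢b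

  FirstReturn : Set
  FirstReturn = ∃ λ t → Avoids t × (iter η (suc t) b ≡ a ⊎ iter η (suc t) b ≡ b)

  avoids⊎firstReturn : ∀ t → Avoids t ⊎ FirstReturn
  avoids⊎firstReturn zero = inj₁ (λ _ ())
  avoids⊎firstReturn (suc t) with avoids⊎firstReturn t
  ... | inj₂ return = inj₂ return
  ... | inj₁ avoids with position a b (iter η (suc t) b)
  ...   | left reaches-a = inj₂ (t , avoids , inj₁ reaches-a)
  ...   | right closes   = inj₂ (t , avoids , inj₂ closes)
  ...   | other ≢a ≢b    = inj₁ (avoids-suc avoids ≢a ≢b)

  firstReturn : FirstReturn
  firstReturn with p , _ , closes ← Cycles.period η η-injective b with avoids⊎firstReturn (suc p)
  ... | inj₂ return = return
  ... | inj₁ avoids = ⊥-elim (proj₂ (avoids p ≤-refl) closes)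

  module _ {t : ℕ} (avoids : Avoids t) where

    iter-transpose : ∀ s → s ≤ t → iter (transpose a b ∘ η) s b ≡ iter η s b
    iter-transpose zero    _   = refl
    iter-transpose (suc s) s<t = trans (cong (transpose a b ∘ η) (iter-transpose s (<⇒≤ s<t)))
      (transpose-other a b (proj₁ (avoids s s<t)) (proj₂ (avoids s s<t)))

    iter-transpose-suc : iter (transpose a b ∘ η) (suc t) b ≡ transpose a b (iter η (suc t) b)
    iter-transpose-suc = cong (transpose a b ∘ η) (iter-transpose t ≤-refl)

    OnCycle : Fin n → Set
    OnCycle x = ∃ λ s → s < suc t × iter η s b ≡ x

    onCycle? : ∀ x → Dec (OnCycle x)
    onCycle? x = anyUpTo? (λ s → iter η s b ≟ x) (suc t)

    a-notOnCycle : ¬ OnCycle a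
    a-notOnCycle (zero  , _       , b≡a)  = a≢b (sym b≡a)
    a-notOnCycle (suc s , s≤s s<t , ηˢb≡a) = proj₁ (avoids s s<t) ηˢb≡a

    onCycle-⇔ : iter η (suc t) b ≡ b → ∀ x → OnCycle x ⇔ OnCycle (η x)
    onCycle-⇔ closes x = mk⇔ forth back
      where
      forth : OnCycle x → OnCycle (η x)
      forth (s , s<1+t , refl) with m<1+n⇒m<n∨m≡n s<1+t
      ... | inj₁ s<t  = suc s , s≤s s<t , refl
      ... | inj₂ refl = 0 , s≤s z≤n , sym closes
      back : OnCycle (η x) → OnCycle x
      back (zero  , _     , b≡ηx)    = t , ≤-refl , η-injective (trans closes b≡ηx)
      back (suc s , s<1+t , ηˢ⁺¹b≡ηx) = s , <-trans (n<1+n s) s<1+t , η-injective ηˢ⁺¹b≡ηx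

    invariants-closes : iter η (suc t) b ≡ b → ∀ q → invariants η q ≡ q * invariants₌ η a b q
    invariants-closes closes = Separated.invariants-separated η (does ∘ onCycle?)
      (λ x → does-⇔ (onCycle-⇔ closes x) (onCycle? x) (onCycle? (η x)))
      (dec-false (onCycle? a) a-notOnCycle) (dec-true (onCycle? b) (0 , s≤s z≤n , refl))

    invariants-reaches : iter η (suc t) b ≡ a → ∀ q → invariants η q ≡ invariants₌ η a b q
    invariants-reaches reaches q = invariants-joined η (λ f invariant →
      trans (cong (lookup f) (sym reaches)) (sym (invariant-iter η f invariant (suc t) b)))

-- Exactly one of η and (a b) η has a and b on a common cycle.
invariants-transpose : (η : Map n) → Injective _≡_ _≡_ η → {a b : Fin n} → a ≢ b → ∀ q →
  invariants (transpose a b ∘ η) q + invariants η q ≡ suc q * invariants₌ η a b q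
invariants-transpose η η-injective {a} {b} a≢b q = by-return η.firstReturn
  where
  η′ : Map _
  η′ = transpose a b ∘ η
  module η  = Return η η-injective a≢b
  module η′ = Return η′ (η-injective ∘ transpose-injective a b) a≢b

  avoids′ : ∀ {t} → η.Avoids t → η′.Avoids t
  avoids′ avoids s s<t = subst (λ y → y ≢ a × y ≢ b) (sym (η.iter-transpose avoids (suc s) s<t)) (avoids s s<t)

  by-return : η.FirstReturn → invariants η′ q + invariants η q ≡ suc q * invariants₌ η a b q
  by-return (t , avoids , inj₂ closes) = cong₂ _+_
    (trans (η′.invariants-reaches (avoids′ avoids) reaches′ q) (invariants₌-transpose η a b q))
    (η.invariants-closes avoids closes q)
    where
    reaches′ : iter η′ (suc t) b ≡ a
    reaches′ = trans (η.iter-transpose-suc avoids) (trans (cong (transpose a b) closes) (transpose-right a b))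
  by-return (t , avoids , inj₁ reaches) = trans (+-comm (invariants η′ q) _) (cong₂ _+_
    (η.invariants-reaches avoids reaches q)
    (trans (η′.invariants-closes (avoids′ avoids) closes′ q) (cong (q *_) (invariants₌-transpose η a b q))))
    where
    closes′ : iter η′ (suc t) b ≡ b
    closes′ = trans (η.iter-transpose-suc avoids) (trans (cong (transpose a b) reaches) (transpose-left a b))

-- Polynomials as coefficient sequences

eval : ℕ → (ℕ → ℕ) → ℕ → ℕ
eval zero    a q = 0
eval (suc N) a q = a 0 + q * eval N (a ∘ suc) q

eval-cong : ∀ N {a b} → (∀ c → a c ≡ b c) → ∀ q → eval N a q ≡ eval N b q
eval-cong zero    a≗b q = refl
eval-cong (suc N) a≗b q = cong₂ (λ x y → x + q * y) (a≗b 0) (eval-cong N (a≗b ∘ suc) q)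

eval-zero : ∀ N q → eval N (λ _ → 0) q ≡ 0
eval-zero zero    q = refl
eval-zero (suc N) q = trans (cong (q *_) (eval-zero N q)) (*-zeroʳ q)

eval-+ : ∀ N a b q → eval N (λ c → a c + b c) q ≡ eval N a q + eval N b q
eval-+ zero    a b q = refl
eval-+ (suc N) a b q = trans (cong (λ z → a 0 + b 0 + q * z) (eval-+ N (a ∘ suc) (b ∘ suc) q))
  (regroup q (a 0) (b 0) (eval N (a ∘ suc) q) (eval N (b ∘ suc) q))
  where
  regroup : ∀ q x y X Y → x + y + q * (X + Y) ≡ (x + q * X) + (y + q * Y)
  regroup = solve-∀

eval-scale : ∀ N k a q → eval N (λ c → k * a c) q ≡ k * eval N a q
eval-scale zero    k a q = sym (*-zeroʳ k)
eval-scale (suc N) k a q = trans (cong (λ z → k * a 0 + q * z) (eval-scale N k (a ∘ suc) q))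
  (regroup k q (a 0) (eval N (a ∘ suc) q))
  where
  regroup : ∀ k q x X → k * x + q * (k * X) ≡ k * (x + q * X)
  regroup = solve-∀

weightedSum : ℕ → ℕ → (ℕ → ℕ) → (ℕ → ℕ) → ℕ → ℕ
weightedSum k l a b c = k * a c + l * b c

eval-weightedSum : ∀ N k l a b q → eval N (weightedSum k l a b) q ≡ k * eval N a q + l * eval N b q
eval-weightedSum N k l a b q = trans (eval-+ N _ _ q) (cong₂ _+_ (eval-scale N k a q) (eval-scale N l b q))

eval-∑ : (N : ℕ) (xs : List A) (φ : A → ℕ → ℕ) (q : ℕ) →
  eval N (λ c → ∑[ x ∈ xs ] φ x c) q ≡ ∑[ x ∈ xs ] eval N (φ x) q
eval-∑ N []       φ q = eval-zero N q
eval-∑ N (x ∷ xs) φ q = trans (eval-+ N (φ x) _ q) (cong (eval N (φ x) q +_) (eval-∑ N xs φ q))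

eval-monomial : ∀ N d q → d < N → eval N (λ c → 𝟙 (d ℕ.≟ c)) q ≡ q ^ d
eval-monomial (suc N) zero    q _         = cong suc (trans (cong (q *_) (trans
  (eval-cong N (λ c → 𝟙-no (0 ℕ.≟ suc c) (λ ())) q) (eval-zero N q))) (*-zeroʳ q))
eval-monomial (suc N) (suc d) q (s≤s d<N) = cong₂ (λ x y → x + q * y) (𝟙-no (suc d ℕ.≟ 0) (λ ()))
  (trans (eval-cong N (λ c → 𝟙-⇔ (mk⇔ suc-injective (cong suc)) (suc d ℕ.≟ suc c) (d ℕ.≟ c)) q)
    (eval-monomial N d q d<N))

eval-% : ∀ N a q → a 0 ≤ q → eval (suc N) a (suc q) % suc q ≡ a 0
eval-% N a q a₀≤q = begin
  (a 0 + suc q * eval N (a ∘ suc) (suc q)) % suc q   ≡⟨ cong (λ z → (a 0 + z) % suc q) (*-comm (suc q) _) ⟩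
  (a 0 + eval N (a ∘ suc) (suc q) * suc q) % suc q   ≡⟨ [m+kn]%n≡m%n (a 0) (eval N (a ∘ suc) (suc q)) (suc q) ⟩
  a 0 % suc q                                        ≡⟨ m<n⇒m%n≡m (s≤s a₀≤q) ⟩
  a 0                                                ∎

eval-injective : ∀ N Q a b → (∀ q → Q ≤ q → eval N a q ≡ eval N b q) → ∀ c → c < N → a c ≡ b c
eval-injective (suc N) Q a b eval≡ = λ where
    zero    _         → a₀≡b₀
    (suc c) (s≤s c<N) → eval-injective N (suc Q) (a ∘ suc) (b ∘ suc) eval-suc≡ c c<N
  where
  big = Q + (a 0 + b 0)
  a₀≡b₀ : a 0 ≡ b 0
  a₀≡b₀ = begin
    a 0                                    ≡⟨ eval-% N a big (≤-trans (m≤m+n (a 0) (b 0)) (m≤n+m (a 0 + b 0) Q)) ⟨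
    eval (suc N) a (suc big) % suc big     ≡⟨ cong (_% suc big) (eval≡ (suc big) (m≤n⇒m≤1+n (m≤m+n Q (a 0 + b 0)))) ⟩
    eval (suc N) b (suc big) % suc big     ≡⟨ eval-% N b big (≤-trans (m≤n+m (b 0) (a 0)) (m≤n+m (a 0 + b 0) Q)) ⟩
    b 0                                    ∎
  eval-suc≡ : ∀ q → suc Q ≤ q → eval N (a ∘ suc) q ≡ eval N (b ∘ suc) q
  eval-suc≡ q@(suc _) Q<q = *-cancelˡ-≡ _ _ q (+-cancelˡ-≡ (a 0) _ _
    (trans (eval≡ q (<⇒≤ Q<q)) (cong (_+ q * eval N (b ∘ suc) q) (sym a₀≡b₀))))

shift : (ℕ → ℕ) → ℕ → ℕ
shift a zero    = 0
shift a (suc c) = a c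

-- The Harer–Zagier polynomials

-- (k + 1)! times the coefficient of x^(k+1) in ((1 + x) / (1 - x))^q / 2.
hz : ℕ → ℕ → ℕ
hz zero          q = q
hz (suc zero)    q = 2 * (q * q)
hz (suc (suc k)) q = 2 * (q * hz (suc k) q) + (2 + k) * (1 + k) * hz k q

hzCoeff : ℕ → ℕ → ℕ
hzCoeff zero          zero          = 0
hzCoeff zero          (suc zero)    = 1
hzCoeff zero          (suc (suc c)) = 0
hzCoeff (suc zero)    c             = 2 * shift (hzCoeff zero) c
hzCoeff (suc (suc k)) c             = weightedSum 2 ((2 + k) * (1 + k)) (shift (hzCoeff (suc k))) (hzCoeff k) c

eval-hzCoeff : ∀ k N q → suc k < N → eval N (hzCoeff k) q ≡ hz k q
eval-hzCoeff zero (suc zero) q (s≤s ())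
eval-hzCoeff zero (suc (suc N)) q _ =
  trans (cong (λ z → q * (1 + q * z)) (eval-zero N q)) (trans (cong (λ z → q * suc z) (*-zeroʳ q)) (*-identityʳ q))
eval-hzCoeff (suc zero) (suc N) q (s≤s 1<N) =
  trans (eval-scale (suc N) 2 (shift (hzCoeff zero)) q) (cong (λ z → 2 * (q * z)) (eval-hzCoeff zero N q 1<N))
eval-hzCoeff (suc (suc k)) (suc N) q (s≤s 2+k<N) =
  trans (eval-weightedSum (suc N) 2 ((2 + k) * (1 + k)) (shift (hzCoeff (suc k))) (hzCoeff k) q)
    (cong₂ (λ x y → 2 * (q * x) + (2 + k) * (1 + k) * y)
      (eval-hzCoeff (suc k) N q 2+k<N) (eval-hzCoeff k (suc N) q (m≤n⇒m≤1+n (<⇒≤ 2+k<N))))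

hz-at-0 : ∀ k → hz k 0 ≡ 0
hz-at-0 zero          = refl
hz-at-0 (suc zero)    = refl
hz-at-0 (suc (suc k)) = trans (cong ((2 + k) * (1 + k) *_) (hz-at-0 k)) (*-zeroʳ ((2 + k) * (1 + k)))

-- For G_q = ((1 + x) / (1 - x))^q / 2 these say that (1 + x) G_q′ = q (G_(q+1) + G_q)
-- and G_(q+1) = G_q + x (G_(q+1) + G_q).
hz-derivative : ∀ k q → hz (suc k) q + (1 + k) * hz k q ≡ q * (hz k (suc q) + hz k q)
hz-difference : ∀ k q → hz (suc k) (suc q) ≡ hz (suc k) q + (2 + k) * (hz k (suc q) + hz k q)

hz-derivative zero q = expand q
  where
  expand : ∀ q → 2 * (q * q) + (1 + 0) * q ≡ q * (suc q + q)
  expand = solve-∀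
hz-derivative (suc k) q = begin
  2 * (q * hₖ₊₁) + (2 + k) * (1 + k) * hₖ + (2 + k) * hₖ₊₁
    ≡⟨ collect k q hₖ hₖ₊₁ ⟩
  2 * (q * hₖ₊₁) + (2 + k) * (hₖ₊₁ + (1 + k) * hₖ)
    ≡⟨ cong (λ z → 2 * (q * hₖ₊₁) + (2 + k) * z) (hz-derivative k q) ⟩
  2 * (q * hₖ₊₁) + (2 + k) * (q * (hₖ⁺ + hₖ))
    ≡⟨ factor k q (hₖ⁺ + hₖ) hₖ₊₁ ⟩
  q * (hₖ₊₁ + (2 + k) * (hₖ⁺ + hₖ) + hₖ₊₁)
    ≡⟨ cong (λ z → q * (z + hₖ₊₁)) (hz-difference k q) ⟨
  q * (hz (suc k) (suc q) + hₖ₊₁) ∎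
  where
  hₖ   = hz k q
  hₖ⁺  = hz k (suc q)
  hₖ₊₁ = hz (suc k) q
  collect : ∀ k q x y → 2 * (q * y) + (2 + k) * (1 + k) * x + (2 + k) * y ≡ 2 * (q * y) + (2 + k) * (y + (1 + k) * x)
  collect = solve-∀
  factor : ∀ k q x y → 2 * (q * y) + (2 + k) * (q * x) ≡ q * (y + (2 + k) * x + y)
  factor = solve-∀

hz-difference zero q = expand q
  where
  expand : ∀ q → 2 * (suc q * suc q) ≡ 2 * (q * q) + (2 + 0) * (suc q + q)
  expand = solve-∀
hz-difference (suc k) q = begin
  2 * (suc q * hz (suc k) (suc q)) + (2 + k) * (1 + k) * hₖ⁺
    ≡⟨ cong (λ z → 2 * (suc q * z) + (2 + k) * (1 + k) * hₖ⁺) (hz-difference k q) ⟩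
  2 * (suc q * (hₖ₊₁ + (2 + k) * (hₖ⁺ + hₖ))) + (2 + k) * (1 + k) * hₖ⁺
    ≡⟨ expand k q hₖ hₖ⁺ hₖ₊₁ ⟩
  2 * (suc q * hₖ₊₁) + (2 + k) * (2 * (hₖ⁺ + hₖ) + (1 + k) * hₖ⁺ + 2 * (q * (hₖ⁺ + hₖ)))
    ≡⟨ cong (λ z → 2 * (suc q * hₖ₊₁) + (2 + k) * (2 * (hₖ⁺ + hₖ) + (1 + k) * hₖ⁺ + 2 * z)) (hz-derivative k q) ⟨
  2 * (suc q * hₖ₊₁) + (2 + k) * (2 * (hₖ⁺ + hₖ) + (1 + k) * hₖ⁺ + 2 * (hₖ₊₁ + (1 + k) * hₖ))
    ≡⟨ collect k q hₖ hₖ⁺ hₖ₊₁ ⟩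
  2 * (q * hₖ₊₁) + (2 + k) * (1 + k) * hₖ + (3 + k) * (hₖ₊₁ + (2 + k) * (hₖ⁺ + hₖ) + hₖ₊₁)
    ≡⟨ cong (λ z → 2 * (q * hₖ₊₁) + (2 + k) * (1 + k) * hₖ + (3 + k) * (z + hₖ₊₁)) (hz-difference k q) ⟨
  2 * (q * hₖ₊₁) + (2 + k) * (1 + k) * hₖ + (3 + k) * (hz (suc k) (suc q) + hₖ₊₁) ∎
  where
  hₖ   = hz k q
  hₖ⁺  = hz k (suc q)
  hₖ₊₁ = hz (suc k) q
  expand : ∀ k q x x′ y → 2 * (suc q * (y + (2 + k) * (x′ + x))) + (2 + k) * (1 + k) * x′ ≡
    2 * (suc q * y) + (2 + k) * (2 * (x′ + x) + (1 + k) * x′ + 2 * (q * (x′ + x)))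
  expand = solve-∀
  collect : ∀ k q x x′ y →
    2 * (suc q * y) + (2 + k) * (2 * (x′ + x) + (1 + k) * x′ + 2 * (y + (1 + k) * x)) ≡
    2 * (q * y) + (2 + k) * (1 + k) * x + (3 + k) * (y + (2 + k) * (x′ + x) + y)
  collect = solve-∀

-- Interlacing and log-concavity

infix 4 _≼_ _⊑_

-- Where the terms are positive, b j / a j is nondecreasing in j.
_≼_ : (ℕ → ℕ) → (ℕ → ℕ) → Set
a ≼ b = ∀ j → a (suc j) * b j ≤ a j * b (suc j)

_⊑_ : (ℕ → ℕ) → (ℕ → ℕ) → Set
a ⊑ b = ∀ j → b j ≡ 0 → a j ≡ 0

≼-refl : ∀ {a} → a ≼ a
≼-refl {a} j = ≤-reflexive (*-comm (a (suc j)) (a j))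

≼-trans : ∀ {a b c} → a ⊑ b → a ∘ suc ⊑ a → a ≼ b → b ≼ c → a ≼ c
≼-trans {a} {b} {c} a⊑b a-closed a≼b b≼c j with b j ℕ.≟ 0 | b (suc j) ℕ.≟ 0
... | yes bⱼ≡0 | _          = ≤-trans (≤-reflexive (cong (_* c j) (a-closed j (a⊑b j bⱼ≡0)))) z≤n
... | no _     | yes bⱼ₊₁≡0 = ≤-trans (≤-reflexive (cong (_* c j) (a⊑b (suc j) bⱼ₊₁≡0))) z≤n
... | no bⱼ≢0  | no bⱼ₊₁≢0  = *-cancelˡ-≤ (b j * b (suc j)) {{m*n≢0 _ _ {{≢-nonZero bⱼ≢0}} {{≢-nonZero bⱼ₊₁≢0}}}}
  (subst₂ _≤_ (regroup-left (b j) (b (suc j)) (a (suc j)) (c j)) (regroup-right (b j) (b (suc j)) (a j) (c (suc j)))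
    (*-mono-≤ (a≼b j) (b≼c j)))
  where
  regroup-left : ∀ b b′ a c → (a * b) * (b′ * c) ≡ b * b′ * (a * c)
  regroup-left = solve-∀
  regroup-right : ∀ b b′ a c → (a * b′) * (b * c) ≡ b * b′ * (a * c)
  regroup-right = solve-∀

≼-shiftʳ : ∀ {a b} → a ∘ suc ≼ b → a ≼ shift b
≼-shiftʳ {a} _          zero    = ≤-trans (≤-reflexive (*-zeroʳ (a 1))) z≤n
≼-shiftʳ     a∘suc≼b (suc j) = a∘suc≼b j

≼-weightedSumʳ : ∀ k l {a b c} → a ≼ b → a ≼ c → a ≼ weightedSum k l b c
≼-weightedSumʳ k l {a} {b} {c} a≼b a≼c j = subst₂ _≤_
  (distribute (a (suc j)) k (b j) l (c j)) (distribute (a j) k (b (suc j)) l (c (suc j)))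
  (+-mono-≤ (*-monoʳ-≤ k (a≼b j)) (*-monoʳ-≤ l (a≼c j)))
  where
  distribute : ∀ a k b l c → k * (a * b) + l * (a * c) ≡ a * (k * b + l * c)
  distribute = solve-∀

≼-weightedSumˡ : ∀ k l {a b c} → a ≼ c → b ≼ c → weightedSum k l a b ≼ c
≼-weightedSumˡ k l {a} {b} {c} a≼c b≼c j = subst₂ _≤_
  (distribute (c j) k (a (suc j)) l (b (suc j))) (distribute (c (suc j)) k (a j) l (b j))
  (+-mono-≤ (*-monoʳ-≤ k (a≼c j)) (*-monoʳ-≤ l (b≼c j)))
  where
  distribute : ∀ c k a l b → k * (a * c) + l * (b * c) ≡ (k * a + l * b) * c
  distribute = solve-∀

≼-shift-weightedSum : ∀ k l {a b c} → a ≼ shift b → a ≼ shift c → a ≼ shift (weightedSum k l b c)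
≼-shift-weightedSum k l {a} {b} {c} a≼sb a≼sc =
  ≼-shiftʳ {a} {weightedSum k l b c} (≼-weightedSumʳ k l {a ∘ suc} {b} {c} (a≼sb ∘ suc) (a≼sc ∘ suc))

record Interlaced (e o : ℕ → ℕ) : Set where
  field
    o≼e       : o ≼ e
    e≼shift-o : e ≼ shift o
    o⊑e       : o ⊑ e
    e∘suc⊑o   : e ∘ suc ⊑ o

  e-closed : e ∘ suc ⊑ e
  e-closed j = e∘suc⊑o j ∘ o⊑e j

  o-closed : o ∘ suc ⊑ o
  o-closed j = o⊑e (suc j) ∘ e∘suc⊑o j

  e≼shift-e : e ≼ shift e
  e≼shift-e = ≼-shiftʳ {e} {e} (≼-trans {e ∘ suc} {o} {e} e∘suc⊑o (e-closed ∘ suc) (e≼shift-o ∘ suc) o≼e)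

  o≼shift-o : o ≼ shift o
  o≼shift-o = ≼-trans {o} {e} {shift o} o⊑e o-closed o≼e e≼shift-o

weightedSum≡0 : ∀ k l .{{_ : NonZero k}} .{{_ : NonZero l}} {x y} → k * x + l * y ≡ 0 → x ≡ 0 × y ≡ 0
weightedSum≡0 k l {x} {y} sum≡0 =
  m*n≡0⇒m≡0 x k (trans (*-comm x k) (m+n≡0⇒m≡0 (k * x) sum≡0)) ,
  m*n≡0⇒m≡0 y l (trans (*-comm y l) (m+n≡0⇒n≡0 (k * x) sum≡0))

0⇒weightedSum≡0 : ∀ k l {x y} → x ≡ 0 → y ≡ 0 → k * x + l * y ≡ 0
0⇒weightedSum≡0 k l refl refl = cong₂ _+_ (*-zeroʳ k) (*-zeroʳ l)

module _ {e o : ℕ → ℕ} (interlaced : Interlaced e o) (k l : ℕ) .{{_ : NonZero k}} .{{_ : NonZero l}} where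
  open Interlaced interlaced

  interlaced-stepˡ : Interlaced (weightedSum k l (shift o) e) o
  interlaced-stepˡ = record
    { o≼e       = ≼-weightedSumʳ k l {o} {shift o} {e} o≼shift-o o≼e
    ; e≼shift-o = ≼-weightedSumˡ k l {shift o} {e} {shift o} (≼-refl {shift o}) e≼shift-o
    ; o⊑e       = λ j → o⊑e j ∘ proj₂ ∘ weightedSum≡0 k l {shift o j}
    ; e∘suc⊑o   = λ j oⱼ≡0 → 0⇒weightedSum≡0 k l oⱼ≡0 (e∘suc⊑o j oⱼ≡0)
    }

  interlaced-stepʳ : Interlaced e (weightedSum k l e o)
  interlaced-stepʳ = record
    { o≼e       = ≼-weightedSumˡ k l {e} {o} {e} (≼-refl {e}) o≼e
    ; e≼shift-o = ≼-shift-weightedSum k l {e} {e} {o} e≼shift-e e≼shift-o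
    ; o⊑e       = λ j eⱼ≡0 → 0⇒weightedSum≡0 k l eⱼ≡0 (o⊑e j eⱼ≡0)
    ; e∘suc⊑o   = λ j → e∘suc⊑o j ∘ proj₂ ∘ weightedSum≡0 k l {e j}
    }

interlaced-cong : ∀ {e e′ o o′} → (∀ j → e j ≡ e′ j) → (∀ j → o j ≡ o′ j) → Interlaced e o → Interlaced e′ o′
interlaced-cong {e} {e′} {o} {o′} e≗e′ o≗o′ interlaced = record
  { o≼e       = λ j → subst₂ _≤_ (cong₂ _*_ (o≗o′ (suc j)) (e≗e′ j)) (cong₂ _*_ (o≗o′ j) (e≗e′ (suc j))) (o≼e j)
  ; e≼shift-o = λ j → subst₂ _≤_
      (cong₂ _*_ (e≗e′ (suc j)) (shift-cong j)) (cong₂ _*_ (e≗e′ j) (shift-cong (suc j))) (e≼shift-o j)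
  ; o⊑e       = λ j → trans (sym (o≗o′ j)) ∘ o⊑e j ∘ trans (e≗e′ j)
  ; e∘suc⊑o   = λ j → trans (sym (e≗e′ (suc j))) ∘ e∘suc⊑o j ∘ trans (o≗o′ j)
  }
  where
  open Interlaced interlaced
  shift-cong : ∀ j → shift o j ≡ shift o′ j
  shift-cong zero    = refl
  shift-cong (suc j) = o≗o′ j

hzCoeff-suc-0 : ∀ k → hzCoeff (suc k) 0 ≡ 0
hzCoeff-suc-0 zero          = refl
hzCoeff-suc-0 (suc zero)    = refl
hzCoeff-suc-0 (suc (suc k)) = trans (cong ((3 + k) * (2 + k) *_) (hzCoeff-suc-0 k)) (*-zeroʳ ((3 + k) * (2 + k)))

hzEven hzOdd : ℕ → ℕ → ℕ
hzEven r j = hzCoeff (r * 2) (suc (j * 2))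
hzOdd  r j = hzCoeff (suc (r * 2)) (suc (suc (j * 2)))

hzEven-suc : ∀ r j → weightedSum 2 ((2 + r * 2) * (1 + r * 2)) (shift (hzOdd r)) (hzEven r) j ≡ hzEven (suc r) j
hzEven-suc r j = cong (λ x → 2 * x + (2 + r * 2) * (1 + r * 2) * hzEven r j) (shift-hzOdd j)
  where
  shift-hzOdd : ∀ j → shift (hzOdd r) j ≡ hzCoeff (suc (r * 2)) (j * 2)
  shift-hzOdd zero    = sym (hzCoeff-suc-0 (r * 2))
  shift-hzOdd (suc j) = refl

hz-interlaced : ∀ r → Interlaced (hzEven r) (hzOdd r)
hz-interlaced zero = record
  { o≼e       = λ j → z≤n
  ; e≼shift-o = λ j → z≤n
  ; o⊑e       = λ { zero () ; (suc j) _ → refl }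
  ; e∘suc⊑o   = λ j _ → refl
  }
hz-interlaced (suc r) = interlaced-stepʳ
  (interlaced-cong (hzEven-suc r) (λ _ → refl)
    (interlaced-stepˡ (hz-interlaced r) 2 ((2 + r * 2) * (1 + r * 2))))
  2 ((3 + r * 2) * (2 + r * 2))

hzCoeff-even-even : ∀ r j → hzCoeff (r * 2) (j * 2) ≡ 0
hzCoeff-odd-odd   : ∀ r j → hzCoeff (suc (r * 2)) (suc (j * 2)) ≡ 0

hzCoeff-even-even zero    zero    = refl
hzCoeff-even-even zero    (suc j) = refl
hzCoeff-even-even (suc r) zero    = hzCoeff-suc-0 (suc (r * 2))
hzCoeff-even-even (suc r) (suc j) =
  0⇒weightedSum≡0 2 ((2 + r * 2) * (1 + r * 2)) (hzCoeff-odd-odd r j) (hzCoeff-even-even r (suc j))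

hzCoeff-odd-odd zero    j = cong (2 *_) (hzCoeff-even-even zero j)
hzCoeff-odd-odd (suc r) j =
  0⇒weightedSum≡0 2 ((3 + r * 2) * (2 + r * 2)) (hzCoeff-even-even (suc r) j) (hzCoeff-odd-odd r j)

≼-shift⇒logConcave : ∀ {a} → a ≼ shift a → LogConcave a
≼-shift⇒logConcave {a} a≼shift-a j = ≤-trans (≤-reflexive (*-comm (a j) (a (2 + j)))) (a≼shift-a (suc j))

logConcave-scale : ∀ {a b} k l → .{{NonZero k}} → (∀ j → k * a j ≡ l * b j) → LogConcave b → LogConcave a
logConcave-scale {a} {b} k l ka≗lb b-logConcave j = *-cancelˡ-≤ (k * k) {{m*n≢0 k k}}
  (subst₂ _≤_ (rescale j (2 + j)) (rescale (1 + j) (1 + j)) (*-monoʳ-≤ (l * l) (b-logConcave j)))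
  where
  rescale : ∀ i j → l * l * (b i * b j) ≡ k * k * (a i * a j)
  rescale i j = begin
    l * l * (b i * b j)       ≡⟨ interchange *-commutativeSemigroup l l (b i) (b j) ⟩
    (l * b i) * (l * b j)     ≡⟨ cong₂ _*_ (ka≗lb i) (ka≗lb j) ⟨
    (k * a i) * (k * a j)     ≡⟨ interchange *-commutativeSemigroup k k (a i) (a j) ⟨
    k * k * (a i * a j)       ∎

logConcave-cong : ∀ {a b} → (∀ j → a j ≡ b j) → LogConcave b → LogConcave a
logConcave-cong a≗b = logConcave-scale 1 1 (cong (1 *_) ∘ a≗b)

parity : ∀ k → ∃ λ r → k ≡ r * 2 ⊎ k ≡ suc (r * 2)
parity zero    = 0 , inj₁ refl
parity (suc k) with parity k
... | r , inj₁ refl = r , inj₂ refl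
... | r , inj₂ refl = suc r , inj₁ refl

hzPaired : ℕ → ℕ → ℕ
hzPaired k j = hzCoeff k (suc (j * 2)) + hzCoeff k (suc (suc (j * 2)))

-- By parity one of the two coefficients merged by the exponent ⌊(c - 1) / 2⌋ vanishes.
hzPaired-logConcave : ∀ k → LogConcave (hzPaired k)
hzPaired-logConcave k with parity k
... | r , inj₁ refl = logConcave-cong
  (λ j → trans (cong (hzEven r j +_) (hzCoeff-even-even r (suc j))) (+-identityʳ _))
  (≼-shift⇒logConcave {hzEven r} (Interlaced.e≼shift-e (hz-interlaced r)))
... | r , inj₂ refl = logConcave-cong
  (λ j → cong (_+ hzOdd r j) (hzCoeff-odd-odd r j))
  (≼-shift⇒logConcave {hzOdd r} (Interlaced.o≼shift-o (hz-interlaced r)))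

-- Tours of involutions

fullCycleCount : ℕ → ℕ
fullCycleCount m = length (fullCycles m)

∈-fullCycles⇒full : {ζ : Map (suc m)} → ζ ∈ fullCycles m → IsFullCycle ζ
∈-fullCycles⇒full {m} ζ∈ = proj₂ (∈-filter⁻ isFullCycle? {xs = allMaps (suc m)} ζ∈)

·-injective : {π ζ : Map (suc m)} → Injective _≡_ _≡_ π → ζ ∈ fullCycles m → Injective _≡_ _≡_ (ζ · π)
·-injective π-injective ζ∈ = full⇒injective _ (∈-fullCycles⇒full ζ∈) ∘ π-injective

∑-fullCycles-invariant : (π : Map (suc m)) (q : ℕ) (φ : Vec (Fin q) (suc m) → ℕ) →
  ∑[ ζ ∈ fullCycles m ] ∑[ f ∈ allVecs q (suc m) ] (𝟙 (invariant? (ζ · π) f) * φ f) ≡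
  ∑[ f ∈ allVecs q (suc m) ] (φ f * tours (edges π f))
∑-fullCycles-invariant {m} π q φ = begin
  ∑[ ζ ∈ fullCycles m ] ∑[ f ∈ allVecs q (suc m) ] (𝟙 (invariant? (ζ · π) f) * φ f)
    ≡⟨ ∑-swap (fullCycles m) (allVecs q (suc m)) _ ⟩
  ∑[ f ∈ allVecs q (suc m) ] ∑[ ζ ∈ fullCycles m ] (𝟙 (invariant? (ζ · π) f) * φ f)
    ≡⟨ ∑-cong (allVecs q (suc m)) (λ f → ∑-*ʳ (fullCycles m) (φ f) _) ⟩
  ∑[ f ∈ allVecs q (suc m) ] ((∑[ ζ ∈ fullCycles m ] 𝟙 (invariant? (ζ · π) f)) * φ f)
    ≡⟨ ∑-cong (allVecs q (suc m)) (λ f →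
         trans (*-comm _ (φ f)) (cong (φ f *_) (∑-fullCycles-tours (lookup f ∘ π) (lookup f)))) ⟩
  ∑[ f ∈ allVecs q (suc m) ] (φ f * tours (edges π f)) ∎

∑-fullCycles-invariants : (π : Map (suc m)) (q : ℕ) → ∑[ ζ ∈ fullCycles m ] invariants (ζ · π) q ≡ tourCount π q
∑-fullCycles-invariants {m} π q = begin
  ∑[ ζ ∈ fullCycles m ] invariants (ζ · π) q
    ≡⟨ ∑-cong (fullCycles m) (λ ζ → ∑-cong (allVecs q (suc m)) (λ f → *-identityʳ _)) ⟨
  ∑[ ζ ∈ fullCycles m ] ∑[ f ∈ allVecs q (suc m) ] (𝟙 (invariant? (ζ · π) f) * 1)
    ≡⟨ ∑-fullCycles-invariant π q (λ _ → 1) ⟩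
  ∑[ f ∈ allVecs q (suc m) ] (1 * tours (edges π f))
    ≡⟨ ∑-cong (allVecs q (suc m)) (λ f → *-identityˡ _) ⟩
  tourCount π q ∎

∑-^cycles : {π : Map (suc m)} → Injective _≡_ _≡_ π → ∀ q →
  ∑[ ζ ∈ fullCycles m ] (q ^ cycles (ζ · π)) ≡ tourCount π q
∑-^cycles {m} {π} π-injective q = trans
  (∑-cong-∈ (fullCycles m) (λ {ζ} ζ∈ →
    sym (CycleColourings.invariants≡^cycles (ζ · π) (·-injective π-injective ζ∈) q)))
  (∑-fullCycles-invariants π q)

tourCount-transpose-+ : (π : Map (suc m)) → Injective _≡_ _≡_ π → {a b : Fin (suc m)} → a ≢ b → ∀ q →
  tourCount (transpose a b ∘ π) q + tourCount π q ≡ suc q * tourCount₌ π a b q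
tourCount-transpose-+ {m} π π-injective {a} {b} a≢b q = begin
  tourCount (transpose a b ∘ π) q + tourCount π q
    ≡⟨ cong₂ _+_ (∑-fullCycles-invariants (transpose a b ∘ π) q) (∑-fullCycles-invariants π q) ⟨
  (∑[ ζ ∈ fullCycles m ] invariants (transpose a b ∘ (ζ · π)) q) + (∑[ ζ ∈ fullCycles m ] invariants (ζ · π) q)
    ≡⟨ ∑-+ (fullCycles m) _ _ ⟨
  ∑[ ζ ∈ fullCycles m ] (invariants (transpose a b ∘ (ζ · π)) q + invariants (ζ · π) q)
    ≡⟨ ∑-cong-∈ (fullCycles m) (λ {ζ} ζ∈ → invariants-transpose (ζ · π) (·-injective π-injective ζ∈) a≢b q) ⟩
  ∑[ ζ ∈ fullCycles m ] (suc q * invariants₌ (ζ · π) a b q)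
    ≡⟨ ∑-*ˡ (fullCycles m) (suc q) _ ⟩
  suc q * (∑[ ζ ∈ fullCycles m ] invariants₌ (ζ · π) a b q)
    ≡⟨ cong (suc q *_) (∑-fullCycles-invariant π q (λ f → 𝟙 (lookup f a ≟ lookup f b))) ⟩
  suc q * tourCount₌ π a b q ∎

tourCount-difference : (π : Map (suc m)) → Injective _≡_ _≡_ π →
  {a b : Fin (suc m)} → a ≢ b → π a ≡ a → π b ≡ b → ∀ q →
  tourCount (transpose a b ∘ π) (suc q) ≡ tourCount π (suc q) + (tourCount (transpose a b ∘ π) q + tourCount π q)
tourCount-difference π π-injective a≢b πa≡a πb≡b q = trans (tourCount-transpose π π-injective a≢b πa≡a πb≡b q)
  (cong (tourCount π (suc q) +_) (sym (tourCount-transpose-+ π π-injective a≢b q)))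

cycles-full : (ζ : Map (suc m)) → IsFullCycle ζ → cycles ζ ≡ 1
cycles-full {m} ζ full = begin
  cycles ζ
    ≡⟨ ∑-𝟙 (isCycleMin? ζ) (allFin (suc m)) ⟨
  ∑[ x ∈ allFin (suc m) ] 𝟙 (isCycleMin? ζ x)
    ≡⟨ ∑-concentrated (λ x → 𝟙 (isCycleMin? ζ x)) (Uniq.allFin⁺ (suc m)) (∈-allFin zero)
         (λ {x} _ x≢0 → 𝟙-no (isCycleMin? ζ x) (x≢0 ∘ cycleMin≡0)) ⟩
  𝟙 (isCycleMin? ζ zero)
    ≡⟨ 𝟙-yes (isCycleMin? ζ zero) 0-min ⟩
  1 ∎
  where
  0-min : IsCycleMin ζ zero
  0-min = All.tabulate (λ _ → z≤n)
  cycleMin≡0 : ∀ {x} → IsCycleMin ζ x → x ≡ zero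
  cycleMin≡0 {x} x-min with i , refl ← full⇒reachable ζ full x =
    sym (Cycles.cycleMin-unique ζ (full⇒injective ζ full) i 0-min x-min)

tourCount-id : ∀ m q → tourCount {suc m} id q ≡ fullCycleCount m * q
tourCount-id m q = begin
  tourCount {suc m} id q
    ≡⟨ ∑-^cycles id q ⟨
  ∑[ ζ ∈ fullCycles m ] (q ^ cycles ζ)
    ≡⟨ ∑-cong-∈ (fullCycles m) (λ {ζ} ζ∈ →
         trans (cong (q ^_) (cycles-full ζ (∈-fullCycles⇒full ζ∈))) (*-identityʳ q)) ⟩
  ∑[ _ ∈ fullCycles m ] q
    ≡⟨ ∑-const (fullCycles m) q ⟩
  fullCycleCount m * q ∎

data DisjointTranspositions : ℕ → Map n → Set where
  none : {π : Map n} → (∀ x → π x ≡ x) → DisjointTranspositions 0 π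
  add  : {π ρ : Map n} {a b : Fin n} → DisjointTranspositions k ρ → Injective _≡_ _≡_ ρ →
         a ≢ b → ρ a ≡ a → ρ b ≡ b → (∀ x → π x ≡ transpose a b (ρ x)) → DisjointTranspositions (suc k) π

module Untransposed (π : Map n) (π-involutive : Involutive _≡_ π) (a : Fin n) where

  ρ : Map n
  ρ = transpose a (π a) ∘ π

  ρa≡a : ρ a ≡ a
  ρa≡a = transpose-right a (π a)

  ρπa≡πa : ρ (π a) ≡ π a
  ρπa≡πa = trans (cong (transpose a (π a)) (π-involutive a)) (transpose-left a (π a))

  πx≢a : ∀ {x} → x ≢ π a → π x ≢ a
  πx≢a {x} x≢πa πx≡a = x≢πa (trans (sym (π-involutive x)) (cong π πx≡a))

  πx≢πa : ∀ {x} → x ≢ a → π x ≢ π a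
  πx≢πa x≢a = x≢a ∘ involutive⇒injective π-involutive

  ρ-other : ∀ {x} → x ≢ a → x ≢ π a → ρ x ≡ π x
  ρ-other x≢a x≢πa = transpose-other a (π a) (πx≢a x≢πa) (πx≢πa x≢a)

  ρ-involutive : Involutive _≡_ ρ
  ρ-involutive x with position a (π a) x
  ... | left refl      = trans (cong ρ ρa≡a) ρa≡a
  ... | right refl     = trans (cong ρ ρπa≡πa) ρπa≡πa
  ... | other x≢a x≢πa = begin
    ρ (ρ x)   ≡⟨ cong ρ (ρ-other x≢a x≢πa) ⟩
    ρ (π x)   ≡⟨ ρ-other (πx≢a x≢πa) (πx≢πa x≢a) ⟩
    π (π x)   ≡⟨ π-involutive x ⟩
    x         ∎

disjointTranspositions : (π : Map n) → Involutive _≡_ π → ∃ λ k → DisjointTranspositions k π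
disjointTranspositions {n} π π-involutive = decompose (allFin n) π π-involutive (λ x x∉ → ⊥-elim (x∉ (∈-allFin x)))
  where
  decompose : ∀ L (π : Map n) → Involutive _≡_ π → (∀ x → x ∉ L → π x ≡ x) → ∃ λ k → DisjointTranspositions k π
  decompose []      π π-involutive fixed = 0 , none (λ x → fixed x (λ ()))
  decompose (a ∷ L) π π-involutive fixed with π a ≟ a
  ... | yes πa≡a = decompose L π π-involutive fixed′
    where
    fixed′ : ∀ x → x ∉ L → π x ≡ x
    fixed′ x x∉L with x ≟ a
    ... | yes refl = πa≡a
    ... | no x≢a   = fixed x (x∉L ∘ ∈-∷⇒∈ x≢a)
  ... | no πa≢a = let (k , ρ-transpositions) = decompose L ρ ρ-involutive fixed′ in
      suc k , add ρ-transpositions (involutive⇒injective ρ-involutive) (πa≢a ∘ sym) ρa≡a ρπa≡πa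
        (λ x → sym (transpose-involutive a (π a) (π x)))
    where
    open Untransposed π π-involutive a
    fixed′ : ∀ x → x ∉ L → ρ x ≡ x
    fixed′ x x∉L with position a (π a) x
    ... | left refl      = ρa≡a
    ... | right refl     = ρπa≡πa
    ... | other x≢a x≢πa = trans (ρ-other x≢a x≢πa) (fixed x (x∉L ∘ ∈-∷⇒∈ x≢a))

tourCount-hz : {π : Map (suc m)} → DisjointTranspositions k π → ∀ q →
  suc k ! * tourCount π q ≡ fullCycleCount m * hz k q
tourCount-hz {m} (none π≗id) q = trans (*-identityˡ _) (trans (tourCount-cong π≗id q) (tourCount-id m q))
tourCount-hz {m} {suc k} (add {ρ = ρ} {a} {b} ρ-transpositions ρ-injective a≢b ρa≡a ρb≡b π≗τρ) q =
  trans (cong ((2 + k) ! *_) (tourCount-cong π≗τρ q)) (by-difference q)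
  where
  τρ : Map (suc m)
  τρ = transpose a b ∘ ρ

  distribute : ∀ c f x y z → c * f * (x + (y + z)) ≡ c * f * y + c * (f * x + f * z)
  distribute = solve-∀
  factor : ∀ c d x y z → d * x + c * (d * y + d * z) ≡ d * (x + c * (y + z))
  factor = solve-∀

  by-difference : ∀ q → (2 + k) ! * tourCount τρ q ≡ fullCycleCount m * hz (suc k) q
  by-difference zero = begin
    (2 + k) ! * 0                                ≡⟨ *-zeroʳ ((2 + k) !) ⟩
    0                                            ≡⟨ *-zeroʳ (fullCycleCount m) ⟨
    fullCycleCount m * 0                         ≡⟨ cong (fullCycleCount m *_) (hz-at-0 (suc k)) ⟨
    fullCycleCount m * hz (suc k) 0              ∎
  by-difference (suc q) = begin
    (2 + k) * suc k ! * tourCount τρ (suc q)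
      ≡⟨ cong ((2 + k) * suc k ! *_) (tourCount-difference ρ ρ-injective a≢b ρa≡a ρb≡b q) ⟩
    (2 + k) * suc k ! * (tourCount ρ (suc q) + (tourCount τρ q + tourCount ρ q))
      ≡⟨ distribute (2 + k) (suc k !) (tourCount ρ (suc q)) (tourCount τρ q) (tourCount ρ q) ⟩
    (2 + k) * suc k ! * tourCount τρ q + (2 + k) * (suc k ! * tourCount ρ (suc q) + suc k ! * tourCount ρ q)
      ≡⟨ cong₂ _+_ (by-difference q) (cong₂ (λ x y → (2 + k) * (x + y))
           (tourCount-hz ρ-transpositions (suc q)) (tourCount-hz ρ-transpositions q)) ⟩
    fullCycleCount m * hz (suc k) q + (2 + k) * (fullCycleCount m * hz k (suc q) + fullCycleCount m * hz k q)
      ≡⟨ factor (2 + k) (fullCycleCount m) (hz (suc k) q) (hz k (suc q)) (hz k q) ⟩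
    fullCycleCount m * (hz (suc k) q + (2 + k) * (hz k (suc q) + hz k q))
      ≡⟨ cong (fullCycleCount m *_) (hz-difference k q) ⟨
    fullCycleCount m * hz (suc k) (suc q) ∎

-- Coefficients

*2≢1+*2 : ∀ i j → i * 2 ≢ suc (j * 2)
*2≢1+*2 i j = subst₂ (λ x y → x ≢ suc y) (*-comm 2 i) (*-comm 2 j) (even≢odd i j)

𝟙-half : ∀ d j → 𝟙 (d / 2 ℕ.≟ j) ≡ 𝟙 (d ℕ.≟ j * 2) + 𝟙 (d ℕ.≟ suc (j * 2))
𝟙-half d j with parity d
... | i , inj₁ refl = begin
  𝟙 (i * 2 / 2 ℕ.≟ j)
    ≡⟨ cong (λ h → 𝟙 (h ℕ.≟ j)) (m*n/n≡m i 2) ⟩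
  𝟙 (i ℕ.≟ j)
    ≡⟨ 𝟙-⇔ (mk⇔ (cong (_* 2)) (*-cancelʳ-≡ i j 2)) (i ℕ.≟ j) (i * 2 ℕ.≟ j * 2) ⟩
  𝟙 (i * 2 ℕ.≟ j * 2)
    ≡⟨ +-identityʳ _ ⟨
  𝟙 (i * 2 ℕ.≟ j * 2) + 0
    ≡⟨ cong (𝟙 (i * 2 ℕ.≟ j * 2) +_) (𝟙-no (i * 2 ℕ.≟ suc (j * 2)) (*2≢1+*2 i j)) ⟨
  𝟙 (i * 2 ℕ.≟ j * 2) + 𝟙 (i * 2 ℕ.≟ suc (j * 2)) ∎
... | i , inj₂ refl = begin
  𝟙 (suc (i * 2) / 2 ℕ.≟ j)
    ≡⟨ cong (λ h → 𝟙 (h ℕ.≟ j)) (trans (+-distrib-/-∣ʳ 1 (n∣m*n i {2})) (m*n/n≡m i 2)) ⟩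
  𝟙 (i ℕ.≟ j)
    ≡⟨ 𝟙-⇔ (mk⇔ (cong (λ h → suc (h * 2))) (*-cancelʳ-≡ i j 2 ∘ suc-injective))
         (i ℕ.≟ j) (suc (i * 2) ℕ.≟ suc (j * 2)) ⟩
  𝟙 (suc (i * 2) ℕ.≟ suc (j * 2))
    ≡⟨ cong (_+ 𝟙 (suc (i * 2) ℕ.≟ suc (j * 2))) (𝟙-no (suc (i * 2) ℕ.≟ j * 2) (*2≢1+*2 j i ∘ sym)) ⟨
  𝟙 (suc (i * 2) ℕ.≟ j * 2) + 𝟙 (suc (i * 2) ℕ.≟ suc (j * 2)) ∎

cycles-positive : (η : Map (suc m)) → 0 < cycles η
cycles-positive η = ∈-length (∈-filter⁺ (isCycleMin? η) (∈-allFin zero) (All.tabulate (λ _ → z≤n)))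

cycles-≤ : (η : Map n) → cycles η ≤ n
cycles-≤ {n} η = ≤-trans (length-filter (isCycleMin? η) (allFin n)) (≤-reflexive (length-allFin n))

cycleCoeff : Map (suc m) → ℕ → ℕ
cycleCoeff {m} π c = ∑[ ζ ∈ fullCycles m ] 𝟙 (cycles (ζ · π) ℕ.≟ c)

F-coeff-cycleCoeff : (π : Map (suc m)) → ∀ j →
  F-coeff π j ≡ cycleCoeff π (suc (j * 2)) + cycleCoeff π (suc (suc (j * 2)))
F-coeff-cycleCoeff {m} π j = begin
  F-coeff π j
    ≡⟨ ∑-𝟙 (λ ζ → expo ζ π ℕ.≟ j) (fullCycles m) ⟨
  ∑[ ζ ∈ fullCycles m ] 𝟙 ((cycles (ζ · π) ∸ 1) / 2 ℕ.≟ j)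
    ≡⟨ ∑-cong (fullCycles m) (λ ζ → paired (cycles-positive (ζ · π))) ⟩
  ∑[ ζ ∈ fullCycles m ] (𝟙 (cycles (ζ · π) ℕ.≟ suc (j * 2)) + 𝟙 (cycles (ζ · π) ℕ.≟ suc (suc (j * 2))))
    ≡⟨ ∑-+ (fullCycles m) _ _ ⟩
  cycleCoeff π (suc (j * 2)) + cycleCoeff π (suc (suc (j * 2))) ∎
  where
  𝟙-suc : ∀ d e → 𝟙 (d ℕ.≟ e) ≡ 𝟙 (suc d ℕ.≟ suc e)
  𝟙-suc d e = 𝟙-⇔ (mk⇔ (cong suc) suc-injective) (d ℕ.≟ e) (suc d ℕ.≟ suc e)
  paired : ∀ {c} → 0 < c → 𝟙 ((c ∸ 1) / 2 ℕ.≟ j) ≡ 𝟙 (c ℕ.≟ suc (j * 2)) + 𝟙 (c ℕ.≟ suc (suc (j * 2)))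
  paired {suc d} _ = trans (𝟙-half d j) (cong₂ _+_ (𝟙-suc d (j * 2)) (𝟙-suc d (suc (j * 2))))

eval-cycleCoeff : {π : Map (suc m)} → Injective _≡_ _≡_ π → ∀ {N} → suc m < N → ∀ q →
  eval N (cycleCoeff π) q ≡ tourCount π q
eval-cycleCoeff {m} {π} π-injective {N} m<N q = begin
  eval N (cycleCoeff π) q
    ≡⟨ eval-∑ N (fullCycles m) (λ ζ c → 𝟙 (cycles (ζ · π) ℕ.≟ c)) q ⟩
  ∑[ ζ ∈ fullCycles m ] eval N (λ c → 𝟙 (cycles (ζ · π) ℕ.≟ c)) q
    ≡⟨ ∑-cong (fullCycles m) (λ ζ → eval-monomial N (cycles (ζ · π)) q (≤-<-trans (cycles-≤ (ζ · π)) m<N)) ⟩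
  ∑[ ζ ∈ fullCycles m ] (q ^ cycles (ζ · π))
    ≡⟨ ∑-^cycles π-injective q ⟩
  tourCount π q ∎

cycleCoeff-hzCoeff : {π : Map (suc m)} → Injective _≡_ _≡_ π → DisjointTranspositions k π →
  ∀ c → suc k ! * cycleCoeff π c ≡ fullCycleCount m * hzCoeff k c
cycleCoeff-hzCoeff {m} {k} {π} π-injective transpositions c =
  eval-injective N 0 (λ d → suc k ! * cycleCoeff π d) (λ d → fullCycleCount m * hzCoeff k d) (λ q _ → begin
    eval N (λ d → suc k ! * cycleCoeff π d) q             ≡⟨ eval-scale N (suc k !) (cycleCoeff π) q ⟩
    suc k ! * eval N (cycleCoeff π) q                     ≡⟨ cong (suc k ! *_) (eval-cycleCoeff π-injective m<N q) ⟩
    suc k ! * tourCount π q                               ≡⟨ tourCount-hz transpositions q ⟩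
    fullCycleCount m * hz k q                             ≡⟨ cong (fullCycleCount m *_) (eval-hzCoeff k N q k<N) ⟨
    fullCycleCount m * eval N (hzCoeff k) q               ≡⟨ eval-scale N (fullCycleCount m) (hzCoeff k) q ⟨
    eval N (λ d → fullCycleCount m * hzCoeff k d) q       ∎) c c<N
  where
  N = suc (suc m + suc k + c)
  m<N : suc m < N
  m<N = s≤s (≤-trans (m≤m+n (suc m) (suc k)) (m≤m+n (suc m + suc k) c))
  k<N : suc k < N
  k<N = s≤s (≤-trans (m≤n+m (suc k) (suc m)) (m≤m+n (suc m + suc k) c))
  c<N : c < N
  c<N = s≤s (m≤n+m c (suc m + suc k))

F-coeff-hzPaired : {π : Map (suc m)} → Injective _≡_ _≡_ π → DisjointTranspositions k π →
  ∀ j → suc k ! * F-coeff π j ≡ fullCycleCount m * hzPaired k j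
F-coeff-hzPaired {m} {k} {π} π-injective transpositions j = begin
  suc k ! * F-coeff π j
    ≡⟨ cong (suc k ! *_) (F-coeff-cycleCoeff π j) ⟩
  suc k ! * (cycleCoeff π (suc (j * 2)) + cycleCoeff π (suc (suc (j * 2))))
    ≡⟨ *-distribˡ-+ (suc k !) (cycleCoeff π (suc (j * 2))) _ ⟩
  suc k ! * cycleCoeff π (suc (j * 2)) + suc k ! * cycleCoeff π (suc (suc (j * 2)))
    ≡⟨ cong₂ _+_ (cycleCoeff-hzCoeff π-injective transpositions (suc (j * 2)))
                 (cycleCoeff-hzCoeff π-injective transpositions (suc (suc (j * 2)))) ⟩
  fullCycleCount m * hzCoeff k (suc (j * 2)) + fullCycleCount m * hzCoeff k (suc (suc (j * 2)))
    ≡⟨ *-distribˡ-+ (fullCycleCount m) (hzCoeff k (suc (j * 2))) _ ⟨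
  fullCycleCount m * hzPaired k j ∎

theorem2p3 : (m : ℕ) (π : Fin (suc m) → Fin (suc m)) →
    (∀ x → π (π x) ≡ x) →
    LogConcave (F-coeff π)
theorem2p3 m π π-involutive with k , transpositions ← disjointTranspositions π π-involutive =
  logConcave-scale {F-coeff π} {hzPaired k} (suc k !) (fullCycleCount m) {{suc k !≢0}}
    (F-coeff-hzPaired (involutive⇒injective π-involutive) transpositions)
    (hzPaired-logConcave k)
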